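{- Let $a$ and $b$ be relatively prime positive integers such that $a^{2}+b^{2}$ is not a perfect square. Suppose that the equation $x^{2}-(a^{2}+b^{2})y^{2}=-1$ has an integer solution, and that all coprime integer solutions $(x,y)$ of $$x^{2}-(a^{2}+b^{2})y^{2}=-b^{2}$$ are given by $$x+y\sqrt{a^{2}+b^{2}}=\pm\left(\pm a+\sqrt{a^{2}+b^{2}}\right)\alpha^{2k},\qquad k\in\mathbb{Z},$$ where $\alpha=(T_{1}+U_{1}\sqrt{a^{2}+b^{2}})/2$ and $(T_{1},U_{1})$ is the minimal solution in positive integers of $x^{2}-(a^{2}+b^{2})y^{2}=-4$. Then the equation $$X^{2}-(a^{2}+b^{2})Y^{4}=-b^{2}$$ has at most three solutions $(X,Y)$ in positive integers with $\gcd(X,Y)=1$.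
   Context: The two $\pm$ signs in the parametrisation are independent. -}

module Defs where

open import Data.Nat as ℕ using (ℕ; suc)
open import Data.Integer using (ℤ; +_; -[1+_]; _+_; _*_; _-_; -_; _^_; ∣_∣)
open import Data.Product using (_×_; _,_; ∃; Σ)
open import Data.Sum using (_⊎_)
open import Relation.Binary.PropositionalEquality using (_≡_)
open import Relation.Nullary using (¬_)
open import Data.Nat.Coprimality using (Coprime)

-- Elements u + v√D of ℤ[√D], represented as pairs (u , v).
ℤ√ : Set
ℤ√ = ℤ × ℤ

mul : ℤ → ℤ√ → ℤ√ → ℤ√
mul D (u , v) (s , t) = (u * s + D * (v * t) , u * t + v * s)

scale : ℤ → ℤ√ → ℤ√
scale c (u , v) = (c * u , c * v)

pow : ℤ → ℤ√ → ℕ → ℤ√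
pow D z ℕ.zero = (+ 1 , + 0)
pow D z (suc n) = mul D z (pow D z n)

IsSquare : ℕ → Set
IsSquare N = ∃ λ m → m ℕ.* m ≡ N

IsSign : ℤ → Set
IsSign e = (e ≡ + 1) ⊎ (e ≡ - (+ 1))

IsMinimalSol4 : ℕ → ℕ → ℕ → Set
IsMinimalSol4 D T₁ U₁ =
  (0 ℕ.< T₁) × (0 ℕ.< U₁) ×
  ((+ T₁) ^ 2 - (+ D) * (+ U₁) ^ 2 ≡ - (+ 4)) ×
  (∀ T U → 0 ℕ.< T → 0 ℕ.< U → (+ T) ^ 2 - (+ D) * (+ U) ^ 2 ≡ - (+ 4) →
     (T₁ ℕ.≤ T) × (U₁ ℕ.≤ U))

-- x + y√D = ε (δ a + √D) α^{2k}, where α = (T1 + U1 √D)/2.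
-- Cleared of the denominator 2 (and, for k < 0, of the negative power of α):
--   k = n ≥ 0   :  2^{2n} (x + y√D) = ε(δa + √D)(T1 + U1√D)^{2n}
--   k = -(n+1)  :  (x + y√D)(T1 + U1√D)^{2(n+1)} = 2^{2(n+1)} ε(δa + √D)
-- Equality in ℤ[√D] is componentwise since D is not a perfect square.
HasForm : (D a T₁ U₁ : ℕ) → ℤ → ℤ → ℤ → ℤ → ℤ → Set
HasForm D a T₁ U₁ x y ε δ (+ n) =
  scale ((+ 2) ^ (2 ℕ.* n)) (x , y)
    ≡ mul (+ D) (scale ε (δ * + a , + 1)) (pow (+ D) (+ T₁ , + U₁) (2 ℕ.* n))
HasForm D a T₁ U₁ x y ε δ -[1+ n ] =
  mul (+ D) (x , y) (pow (+ D) (+ T₁ , + U₁) (2 ℕ.* suc n))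
    ≡ scale ((+ 2) ^ (2 ℕ.* suc n)) (scale ε (δ * + a , + 1))

QuarticSol : (D b : ℕ) → ℕ × ℕ → Set
QuarticSol D b (X , Y) =
  (0 ℕ.< X) × (0 ℕ.< Y) × Coprime X Y ×
  ((+ X) ^ 2 - (+ D) * (+ Y) ^ 4 ≡ - ((+ b) ^ 2))

{-# OPTIONS --safe #-}
module Submission where

-- Put ω = a + ib and D = a² + b². Since α²ᵏ is a square, a solution (X , Y) of the
-- quartic equation yields a Gaussian integer γ of norm Y with Im (γ⁴ ω̄) = ± b, so
-- the argument of γ is, up to a multiple of π/4 and an error of order 1/Y², that of
-- the fourth root of ω. Two such γ satisfy the gap principle Y′ ≥ 3 Y³. If there were
-- three solutions 1 < Y₁ < Y₂ < Y₃, then γ₂ would be so large compared with a and b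
-- that Thue's method applies: with η = γ₂⁴ ω̄ and the Padé approximants Pᵣ of the fourth
-- root, the Gaussian integers γ₂ Pᵣ(η , η̄) approximate the same argument, and for a
-- suitable r the integer Im (u γ₂ γ̄₃ Pᵣ(η , η̄)) / r!, with u = 1, - i or 1 ± i, would
-- be nonzero and of absolute value less than 1.
-- So besides Y = 1 at most two values of Y occur.

-- Only exact integer identities occur, no real or complex numbers. Put x = u γ₂ γ̄₃ and η₃ = γ₃⁴
-- ω̄; then D x⁴ = u⁴ η η̄₃. If η₃ were real, Pᵣ(η , η̄) would be proportional to Pᵣ(x⁴ , x̄⁴), and
-- Im (x Pᵣ(x⁴ , x̄⁴)) contains the explicit factor (Im x)²ʳ⁺¹. As |Im η₃| = b is tiny beside |Re
-- η₃|, the true value differs from this by an error of relative size about b / |Re η₃|. So the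
-- integer has two contributions, compared with a fixed unit: the first decreases with r, the second
-- grows. The order r is taken where the first has just fallen below one half; the failure at the
-- previous order bounds r from above, and then the second is below one half too. Both contributions
-- carry a factor r!, so all depends on the coefficients of Pᵣ being divisible by r!. The value may
-- vanish at the chosen order. Two consecutive values cannot both vanish, so the next order serves
-- instead, where the three-term recurrence supplies an extra factor 30 b² that pays for the loss.
-- The smallest of the three solutions is used only to make the second one large.

module Naturals where
  open import Data.Nat
  open import Data.Nat.Properties
  open import Data.Nat.Divisibility
  open import Data.Nat.GCD
  open import Data.Nat.Coprimality as Coprimality using (Coprime; coprime-divisor; coprime⇒gcd≡1)
  open import Data.Nat.Tactic.RingSolver using (solve-∀)
  open import Data.Product using (∃; ∃₂; _×_; _,_; proj₁; proj₂)
  open import Data.Sum using (_⊎_; inj₁; inj₂; [_,_]′)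
  open import Data.Empty using (⊥; ⊥-elim)
  open import Relation.Nullary using (¬_; Dec; yes; no)
  open import Relation.Binary.PropositionalEquality
  open import Relation.Binary.Definitions using (tri<; tri≈; tri>)

  -- Factorials dividing products in arithmetic progression

  -- The binomial coefficient of i + k over i, indexed by its two parts so that Pascal's rule needs
  -- no subtraction.
  choose : ℕ → ℕ → ℕ
  choose zero    k       = 1
  choose (suc i) zero    = 1
  choose (suc i) (suc k) = choose i (suc k) + choose (suc i) k

  choose-! : ∀ i k → choose i k * (i ! * k !) ≡ (i + k) !
  choose-! zero    k       = trans (+-identityʳ _) (+-identityʳ _)
  choose-! (suc i) zero    =
    trans (+-identityʳ _) (trans (*-identityʳ _) (cong _! (sym (+-identityʳ (suc i)))))
  choose-! (suc i) (suc k) = begin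
    (choose i (suc k) + choose (suc i) k) * (suc i * i ! * (suc k * k !))
      ≡⟨ split (choose i (suc k)) (choose (suc i) k) i k (i !) (k !) ⟩
    suc i * (choose i (suc k) * (i ! * (suc k * k !)))
      + suc k * (choose (suc i) k * (suc i * i ! * k !))
      ≡⟨ cong₂ (λ x y → suc i * x + suc k * y) (choose-! i (suc k)) (choose-! (suc i) k) ⟩
    suc i * (i + suc k) ! + suc k * (suc i + k) !
      ≡⟨ cong (λ x → suc i * (i + suc k) ! + suc k * x !) (sym (+-suc i k)) ⟩
    suc i * (i + suc k) ! + suc k * (i + suc k) !
      ≡⟨ *-distribʳ-+ ((i + suc k) !) (suc i) (suc k) ⟨
    (suc i + suc k) ! ∎
    where
    open ≡-Reasoning
    split : ∀ p q i k x y → (p + q) * (suc i * x * (suc k * y))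
      ≡ suc i * (p * (x * (suc k * y))) + suc k * (q * (suc i * x * y))
    split = solve-∀

  -- The double factorial (2j - 1)!!.
  oddProduct : ℕ → ℕ
  oddProduct zero    = 1
  oddProduct (suc j) = oddProduct j * (2 * j + 1)

  oddProduct-odd : ∀ j → ∃ λ t → oddProduct j ≡ 2 * t + 1
  oddProduct-odd zero    = 0 , refl
  oddProduct-odd (suc j) with oddProduct-odd j
  ... | t , eq = 2 * t * j + t + j , trans (cong (_* (2 * j + 1)) eq) (lem t j)
    where
    lem : ∀ t j → (2 * t + 1) * (2 * j + 1) ≡ 2 * (2 * t * j + t + j) + 1
    lem = solve-∀

  [2j]! : ∀ j → (j + j) ! ≡ 2 ^ j * oddProduct j * j !
  [2j]! zero    = refl
  [2j]! (suc j) = begin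
    (suc j + suc j) !                               ≡⟨ cong (λ x → suc x !) (+-suc j j) ⟩
    suc (suc (j + j)) * (suc (j + j) * (j + j) !)    ≡⟨ cong (λ x → suc (suc (j + j)) * (suc (j + j) * x)) ([2j]! j) ⟩
    suc (suc (j + j)) * (suc (j + j) * (2 ^ j * oddProduct j * j !))
      ≡⟨ lem j (2 ^ j) (oddProduct j) (j !) ⟩
    2 ^ suc j * oddProduct (suc j) * suc j ! ∎
    where
    open ≡-Reasoning
    lem : ∀ j p o f → suc (suc (j + j)) * (suc (j + j) * (p * o * f))
      ≡ 2 * p * (o * (2 * j + 1)) * (suc j * f)
    lem = solve-∀

  -- The quotient is the central binomial coefficient, because (2j)! = 2ʲ (2j - 1)!! j!.
  j!∣2^j*odd : ∀ j → j ! ∣ 2 ^ j * oddProduct j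
  j!∣2^j*odd j = divides (choose j j) (*-cancelʳ-≡ _ _ (j !) {{j !≢0}} (begin
    2 ^ j * oddProduct j * j !  ≡⟨ [2j]! j ⟨
    (j + j) !                   ≡⟨ choose-! j j ⟨
    choose j j * (j ! * j !)    ≡⟨ *-assoc (choose j j) (j !) (j !) ⟨
    choose j j * j ! * j !      ∎))
    where open ≡-Reasoning

  progression : ℕ → ℕ → ℕ → ℕ
  progression d c zero    = 1
  progression d c (suc j) = progression d c j * (c + d * j)

  progression-suc : ∀ d c j → progression d c (suc j) ≡ c * progression d (c + d) j
  progression-suc d c zero    = lem c d
    where
    lem : ∀ c d → 1 * (c + d * 0) ≡ c * 1
    lem = solve-∀
  progression-suc d c (suc j) =
    trans (cong (_* (c + d * suc j)) (progression-suc d c j)) (lem c d j (progression d (c + d) j))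
    where
    lem : ∀ c d j p → c * p * (c + d * suc j) ≡ c * (p * (c + d + d * j))
    lem = solve-∀

  progression-1-! : ∀ h j → progression 1 (suc h) j * h ! ≡ (h + j) !
  progression-1-! h zero    = trans (+-identityʳ _) (cong _! (sym (+-identityʳ h)))
  progression-1-! h (suc j) = begin
    progression 1 (suc h) j * (suc h + 1 * j) * h !  ≡⟨ lem (progression 1 (suc h) j) h j (h !) ⟩
    suc (h + j) * (progression 1 (suc h) j * h !)    ≡⟨ cong (suc (h + j) *_) (progression-1-! h j) ⟩
    suc (h + j) !                                    ≡⟨ cong _! (+-suc h j) ⟨
    (h + suc j) !                                    ∎
    where
    open ≡-Reasoning
    lem : ∀ p h j f → p * (suc h + 1 * j) * f ≡ suc (h + j) * (p * f)
    lem = solve-∀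

  j!∣progression-1 : ∀ h j → j ! ∣ progression 1 (suc h) j
  j!∣progression-1 h j = divides (choose h j) (*-cancelʳ-≡ _ _ (h !) {{h !≢0}} (begin
    progression 1 (suc h) j * h !  ≡⟨ progression-1-! h j ⟩
    (h + j) !                      ≡⟨ choose-! h j ⟨
    choose h j * (h ! * j !)       ≡⟨ lem (choose h j) (h !) (j !) ⟩
    choose h j * j ! * h !         ∎))
    where
    open ≡-Reasoning
    lem : ∀ p x y → p * (x * y) ≡ p * y * x
    lem = solve-∀

  -- Factor by factor, 4 (h + j) is congruent to c + 4j modulo m as soon as 4h is congruent to c.
  progression-4 : ∀ c h m k j → 4 * h ≡ c + m * k →
    ∃ λ q → 4 ^ j * progression 1 h j ≡ progression 4 c j + m * q
  progression-4 c h m k zero    eq = 0 , sym (cong suc (*-zeroʳ m))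
  progression-4 c h m k (suc j) eq with progression-4 c h m k j eq
  ... | q , ih = q * (c + m * k + 4 * j) + progression 4 c j * k , (begin
    4 * 4 ^ j * (progression 1 h j * (h + 1 * j))  ≡⟨ lem₁ (4 ^ j) (progression 1 h j) h j ⟩
    4 ^ j * progression 1 h j * (4 * h + 4 * j)    ≡⟨ cong₂ (λ x y → x * (y + 4 * j)) ih eq ⟩
    (progression 4 c j + m * q) * (c + m * k + 4 * j) ≡⟨ lem₂ (progression 4 c j) m q c k j ⟩
    progression 4 c j * (c + 4 * j) + m * (q * (c + m * k + 4 * j) + progression 4 c j * k) ∎)
    where
    open ≡-Reasoning
    lem₁ : ∀ f p h j → 4 * f * (p * (h + 1 * j)) ≡ f * p * (4 * h + 4 * j)
    lem₁ = solve-∀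
    lem₂ : ∀ p m q c k j → (p + m * q) * (c + m * k + 4 * j)
      ≡ p * (c + 4 * j) + m * (q * (c + m * k + 4 * j) + p * k)
    lem₂ = solve-∀

  -- Modulo the odd number m = oddProduct j, 4 has an inverse, so the progression
  -- is congruent to a multiple of a product of j consecutive integers.
  j!∣2^j*progression-4 : ∀ c j → j ! ∣ 2 ^ j * progression 4 (suc c) j
  j!∣2^j*progression-4 c j with oddProduct-odd j
  ... | t , odd with progression-4 (suc c) (suc h) m (suc c * (m + 2)) j inverse
    where
    m h : ℕ
    m = oddProduct j
    -- With m = 2t + 1 one has 1 + m (m + 2) = (m + 1)² = 4 (t + 1)², so (t + 1)² inverts 4 modulo
    -- m. Here `suc h` is (c + 1)(t + 1)², with a successor split off because `j!∣progression-1`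
    -- asks for one.
    h = (t + c * suc t) + t * (suc t + c * suc t)
    inverse : 4 * suc h ≡ suc c + m * (suc c * (m + 2))
    inverse rewrite odd = lem c t
      where
      lem : ∀ c t → 4 * suc ((t + c * suc t) + t * (suc t + c * suc t))
        ≡ suc c + (2 * t + 1) * (suc c * (2 * t + 1 + 2))
      lem = solve-∀
  -- A congruence modulo `oddProduct j` is enough: after multiplication by 2ʲ the modulus itself is
  -- divisible by j!.
  ... | q , eq = ∣m+n∣m⇒∣n
    (subst (j ! ∣_) expand (∣n⇒∣m*n (2 ^ j) (∣n⇒∣m*n (4 ^ j) (j!∣progression-1 _ j))))
    (∣m⇒∣m*n q (j!∣2^j*odd j))
    where
    open ≡-Reasoning
    expand : 2 ^ j * (4 ^ j * progression 1 _ j)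
      ≡ 2 ^ j * oddProduct j * q + 2 ^ j * progression 4 (suc c) j
    expand = trans (cong (2 ^ j *_) eq) (lem (2 ^ j) (progression 4 (suc c) j) (oddProduct j) q)
      where
      lem : ∀ a p m q → a * (p + m * q) ≡ a * m * q + a * p
      lem = solve-∀

  ^-distribʳ-* : ∀ n x y → (x * y) ^ n ≡ x ^ n * y ^ n
  ^-distribʳ-* zero    x y = refl
  ^-distribʳ-* (suc n) x y = trans (cong (x * y *_) (^-distribʳ-* n x y)) (lem x y (x ^ n) (y ^ n))
    where
    lem : ∀ x y p q → x * y * (p * q) ≡ x * p * (y * q)
    lem = solve-∀

  -- The induction step of `perturbation-bound` with growth rate 17ρρ′. Put z = ρρ′ and y = bρ′, so
  -- 100y ≤ z. The left side is at most 272z² + 1000yz ≤ 282z², below 17² z² = 289z². The rate must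
  -- exceed 16 because the recurrence contributes 16 times the rate; 17 is the next integer.
  perturbation-≤ : ∀ b ρ ρ′ → 100 * b ≤ ρ → ρ ≤ ρ′ →
    16 * (17 * (ρ * ρ′)) * (ρ * ρ′ + b * b + b * ρ′)
      + 64 * ((b * ρ′ + ρ * b) * (b * ρ′ + ρ * b) + ρ′ * (ρ * (ρ * b + 2 * (b * ρ′))))
    ≤ 17 * (ρ * ρ′) * (17 * (ρ * ρ′))
  perturbation-≤ b ρ ρ′ 100b≤ρ ρ≤ρ′ = begin
    16 * (17 * z) * (z + b * b + y) + 64 * ((y + ρ * b) * (y + ρ * b) + ρ′ * (ρ * (ρ * b + 2 * y)))
      ≤⟨ +-mono-≤ (*-monoʳ-≤ (16 * (17 * z)) (+-monoˡ-≤ y (+-monoʳ-≤ z bb≤y)))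
           (*-monoʳ-≤ 64 (+-mono-≤ (*-mono-≤ (+-monoʳ-≤ y ρb≤y) (+-monoʳ-≤ y ρb≤y))
             (*-monoʳ-≤ ρ′ (*-monoʳ-≤ ρ (+-monoˡ-≤ (2 * y) ρb≤y))))) ⟩
    16 * (17 * z) * (z + y + y) + 64 * ((y + y) * (y + y) + ρ′ * (ρ * (y + 2 * y)))
      ≡⟨ lem₁ ρ ρ′ y ⟩
    272 * (z * z) + 736 * (y * z) + 256 * (y * y)
      ≤⟨ +-monoʳ-≤ (272 * (z * z) + 736 * (y * z)) (*-monoʳ-≤ 256 (*-monoʳ-≤ y y≤z)) ⟩
    272 * (z * z) + 736 * (y * z) + 256 * (y * z)
      ≤⟨ m≤m+n _ (8 * (y * z)) ⟩
    272 * (z * z) + 736 * (y * z) + 256 * (y * z) + 8 * (y * z)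
      ≡⟨ lem₂ y z ⟩
    272 * (z * z) + 10 * (100 * y * z)
      ≤⟨ +-monoʳ-≤ (272 * (z * z)) (*-monoʳ-≤ 10 (*-monoˡ-≤ z 100y≤z)) ⟩
    272 * (z * z) + 10 * (z * z)
      ≤⟨ m≤m+n _ (7 * (z * z)) ⟩
    272 * (z * z) + 10 * (z * z) + 7 * (z * z)
      ≡⟨ lem₃ z ⟩
    17 * z * (17 * z) ∎
    where
    open ≤-Reasoning
    y z : ℕ
    y = b * ρ′
    z = ρ * ρ′
    b≤ρ : b ≤ ρ
    b≤ρ = ≤-trans (m≤m+n b (99 * b)) 100b≤ρ
    bb≤y : b * b ≤ y
    bb≤y = *-monoʳ-≤ b (≤-trans b≤ρ ρ≤ρ′)
    ρb≤y : ρ * b ≤ y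
    ρb≤y = ≤-trans (≤-reflexive (*-comm ρ b)) (*-monoʳ-≤ b ρ≤ρ′)
    y≤z : y ≤ z
    y≤z = *-monoˡ-≤ ρ′ b≤ρ
    100y≤z : 100 * y ≤ z
    100y≤z = ≤-trans (≤-reflexive (sym (*-assoc 100 b ρ′))) (*-monoˡ-≤ ρ′ 100b≤ρ)
    lem₁ : ∀ ρ ρ′ y → 16 * (17 * (ρ * ρ′)) * (ρ * ρ′ + y + y) + 64 * ((y + y) * (y + y) + ρ′ * (ρ * (y + 2 * y)))
      ≡ 272 * (ρ * ρ′ * (ρ * ρ′)) + 736 * (y * (ρ * ρ′)) + 256 * (y * y)
    lem₁ = solve-∀
    lem₂ : ∀ y z → 272 * (z * z) + 736 * (y * z) + 256 * (y * z) + 8 * (y * z) ≡ 272 * (z * z) + 10 * (100 * y * z)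
    lem₂ = solve-∀
    lem₃ : ∀ z → 272 * (z * z) + 10 * (z * z) + 7 * (z * z) ≡ 17 * z * (17 * z)
    lem₃ = solve-∀

  -- Choice of the order r

  threshold : ∀ {P : ℕ → Set} → (∀ r → Dec (P r)) → ∀ k → P k → P 0 ⊎ ∃ λ r → P (suc r) × ¬ P r
  threshold P? zero    pk = inj₁ pk
  threshold P? (suc k) pk with P? k
  ... | yes p = threshold P? k p
  ... | no ¬p = inj₂ (k , pk , ¬p)

  n<2^n : ∀ n → n < 2 ^ n
  n<2^n zero    = s≤s z≤n
  n<2^n (suc n) = begin-strict
    suc n            <⟨ +-monoˡ-< n (s≤s (m^n>0 2 n)) ⟩
    suc (2 ^ n) + n  ≡⟨ +-suc (2 ^ n) n ⟨
    2 ^ n + suc n    ≤⟨ +-monoʳ-≤ (2 ^ n) (n<2^n n) ⟩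
    2 ^ n + 2 ^ n    ≡⟨ cong (2 ^ n +_) (+-identityʳ (2 ^ n)) ⟨
    2 ^ suc n        ∎
    where open ≤-Reasoning

  -- In the application ρ and ρ′ are the absolute values of the real parts of η and η₃, and μ, ν
  -- those of the real and imaginary parts of x.
  module Selection (b ρ ρ′ ν μ D : ℕ) (1≤b : 1 ≤ b) (1≤ν : 1 ≤ ν) (bb≤D : b * b ≤ D)
                   (225bbb≤ρ : 225 * (b * b * b) ≤ ρ) (39νρ≤10bμ : 39 * (ν * ρ) ≤ 10 * (b * μ))
                   (Dμ⁴≤8ρρ′ : D * (μ * μ * (μ * μ)) ≤ 8 * (ρ * ρ′)) where
    open ≤-Reasoning

    -- Equivalent to saying that the first term on the right of `MainBound r 1` is at most half of
    -- the left side. The factor 5b² has its source in `Sizes.main-term-small`.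
    Small : ℕ → Set
    Small r = 2 * ν * (5 * (b * b)) ^ r ≤ ρ ^ r

    small? : ∀ r → Dec (Small r)
    small? r = 2 * ν * (5 * (b * b)) ^ r ≤? ρ ^ r

    private
      instance
        b≢0 : NonZero b
        b≢0 = >-nonZero 1≤b
        ν≢0 : NonZero ν
        ν≢0 = >-nonZero 1≤ν
        bb≢0 : NonZero (b * b)
        bb≢0 = m*n≢0 b b

      225bb≤ρ : 225 * (b * b) ≤ ρ
      225bb≤ρ = ≤-trans (*-monoʳ-≤ 225 (m≤m*n (b * b) b)) 225bbb≤ρ

      instance
        ρ≢0 : NonZero ρ
        ρ≢0 = >-nonZero (<-≤-trans (m*n≢0⇒0< 225 (b * b)) 225bb≤ρ)
          where
          m*n≢0⇒0< : ∀ x y .{{_ : NonZero x}} .{{_ : NonZero y}} → 0 < x * y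
          m*n≢0⇒0< x y = >-nonZero⁻¹ (x * y) {{m*n≢0 x y}}

      5bb≤ρ : 5 * (b * b) ≤ ρ
      5bb≤ρ = ≤-trans (*-monoˡ-≤ (b * b) (m≤m+n 5 220)) 225bb≤ρ

    -- From 2ν ≤ 2^(ν+1) and 10b² ≤ ρ. The exponent is crude, as only the existence of a crossing
    -- matters.
    eventually-small : Small (suc ν)
    eventually-small = begin
      2 * ν * (5 * (b * b)) ^ suc ν
        ≤⟨ *-monoˡ-≤ ((5 * (b * b)) ^ suc ν) (*-monoʳ-≤ 2 (<⇒≤ (n<2^n ν))) ⟩
      2 ^ suc ν * (5 * (b * b)) ^ suc ν
        ≡⟨ ^-distribʳ-* (suc ν) 2 (5 * (b * b)) ⟨
      (2 * (5 * (b * b))) ^ suc ν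
        ≤⟨ ^-monoˡ-≤ (suc ν) (≤-trans (≤-reflexive (sym (*-assoc 2 5 (b * b)))) (≤-trans (*-monoˡ-≤ (b * b) (m≤m+n 10 215)) 225bb≤ρ)) ⟩
      ρ ^ suc ν ∎

    not-small-0 : ¬ Small 0
    not-small-0 2ν≤1 = <-irrefl refl (≤-trans (*-monoʳ-≤ 2 1≤ν) (≤-trans (≤-reflexive (sym (*-identityʳ (2 * ν)))) 2ν≤1))

    selection : ∃ λ r → Small (suc r) × ¬ Small r
    selection = [ (λ s → ⊥-elim (not-small-0 s)) , (λ x → x) ]′ (threshold small? (suc ν) eventually-small)

    private
      cube-^ : ∀ x r → x ^ r * x ^ r * x ^ r ≡ (x * x * x) ^ r
      cube-^ x r = sym (trans (^-distribʳ-* r (x * x) x) (cong (_* x ^ r) (^-distribʳ-* r x x)))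

      b⁶ : ℕ
      b⁶ = 125 * (b * b * b * (b * b * b))

      -- Two of the three factors ρ are replaced by 225b³ each, and 225² = 50625 exceeds 272 · 125 =
      -- 34000; `b⁶` is (5b²)³.
      cubic : 272 * ρ * b⁶ ≤ ρ * ρ * ρ
      cubic = begin
        272 * ρ * b⁶
          ≡⟨ lem′ 272 125 (b * b * b) ρ ⟩
        272 * 125 * (b * b * b * (b * b * b) * ρ)
          ≤⟨ *-monoˡ-≤ (b * b * b * (b * b * b) * ρ) (≤ᵇ⇒≤ (272 * 125) (225 * 225) _) ⟩
        225 * 225 * (b * b * b * (b * b * b) * ρ)
          ≡⟨ lem 225 (b * b * b) ρ ⟩
        225 * (b * b * b) * (225 * (b * b * b)) * ρ
          ≤⟨ *-monoˡ-≤ ρ (*-mono-≤ 225bbb≤ρ 225bbb≤ρ) ⟩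
        ρ * ρ * ρ ∎
        where
        lem′ : ∀ k l c ρ → k * ρ * (l * (c * c)) ≡ k * l * (c * c * ρ)
        lem′ = solve-∀
        lem : ∀ k c ρ → k * k * (c * c * ρ) ≡ k * c * (k * c) * ρ
        lem = solve-∀

    -- The failure of `Small r` bounds ρʳ by 2ν(5b²)ʳ; after cubing, `cubic` cancels the powers of
    -- 5b². In 272 = 16 · 17 the 17 matches the growth rate of the error term, and the 16 is a
    -- reserve spent in `tail′`.
    growth : ∀ r → ¬ Small r → (272 * ρ) ^ r ≤ 8 * (ν * ν * ν)
    growth r ¬s = *-cancelʳ-≤ _ _ (b⁶ ^ r) {{m^n≢0 b⁶ r {{m*n≢0 125 _ {{_}} {{m*n≢0 (b * b * b) (b * b * b) {{m*n≢0 (b * b) b}} {{m*n≢0 (b * b) b}}}}}}}} (begin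
      (272 * ρ) ^ r * b⁶ ^ r
        ≡⟨ ^-distribʳ-* r (272 * ρ) b⁶ ⟨
      (272 * ρ * b⁶) ^ r
        ≤⟨ ^-monoˡ-≤ r cubic ⟩
      (ρ * ρ * ρ) ^ r
        ≡⟨ cube-^ ρ r ⟨
      ρ ^ r * ρ ^ r * ρ ^ r
        ≤⟨ *-mono-≤ (*-mono-≤ large large) large ⟩
      2 * ν * (5 * (b * b)) ^ r * (2 * ν * (5 * (b * b)) ^ r) * (2 * ν * (5 * (b * b)) ^ r)
        ≡⟨ lem₁ ν ((5 * (b * b)) ^ r) ⟩
      8 * (ν * ν * ν) * ((5 * (b * b)) ^ r * (5 * (b * b)) ^ r * (5 * (b * b)) ^ r)
        ≡⟨ cong (8 * (ν * ν * ν) *_) (trans (cube-^ (5 * (b * b)) r) (cong (_^ r) (lem₂ b))) ⟩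
      8 * (ν * ν * ν) * b⁶ ^ r ∎)
      where
      large : ρ ^ r ≤ 2 * ν * (5 * (b * b)) ^ r
      large = <⇒≤ (≰⇒> ¬s)
      lem₁ : ∀ v x → 2 * v * x * (2 * v * x) * (2 * v * x) ≡ 8 * (v * v * v) * (x * x * x)
      lem₁ = solve-∀
      lem₂ : ∀ b → 5 * (b * b) * (5 * (b * b)) * (5 * (b * b)) ≡ 125 * (b * b * b * (b * b * b))
      lem₂ = solve-∀

    private
      cube-≤ : ∀ u v w .{{_ : NonZero v}} → u * (ν * ρ) ≤ v * (b * μ) → w * (v * v * v) ≤ u * u * u →
        w * (ν * ν * ν * (ρ * ρ * ρ)) ≤ b * μ * (b * μ) * (b * μ)
      cube-≤ u v w h num = *-cancelˡ-≤ (v * v * v) {{m*n≢0 (v * v) v {{m*n≢0 v v}}}} (begin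
        v * v * v * (w * (ν * ν * ν * (ρ * ρ * ρ)))
          ≡⟨ lem₁ v w (ν * ν * ν * (ρ * ρ * ρ)) ⟩
        w * (v * v * v) * (ν * ν * ν * (ρ * ρ * ρ))
          ≤⟨ *-monoˡ-≤ (ν * ν * ν * (ρ * ρ * ρ)) num ⟩
        u * u * u * (ν * ν * ν * (ρ * ρ * ρ))
          ≡⟨ lem₂ u ν ρ ⟩
        u * (ν * ρ) * (u * (ν * ρ)) * (u * (ν * ρ))
          ≤⟨ *-mono-≤ (*-mono-≤ h h) h ⟩
        v * (b * μ) * (v * (b * μ)) * (v * (b * μ))
          ≡⟨ lem₃ v (b * μ) ⟩
        v * v * v * (b * μ * (b * μ) * (b * μ)) ∎)
        where
        lem₁ : ∀ v w x → v * v * v * (w * x) ≡ w * (v * v * v) * x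
        lem₁ = solve-∀
        lem₂ : ∀ u v p → u * u * u * (v * v * v * (p * p * p)) ≡ u * (v * p) * (u * (v * p)) * (u * (v * p))
        lem₂ = solve-∀
        lem₃ : ∀ v x → v * x * (v * x) * (v * x) ≡ v * v * v * (x * x * x)
        lem₃ = solve-∀

      -- 59 is the integral part of 3.9³ = 59.319.
      bμ-cube : 59 * (ν * ν * ν * (ρ * ρ * ρ)) ≤ b * μ * (b * μ) * (b * μ)
      bμ-cube = cube-≤ 39 10 59 39νρ≤10bμ (≤ᵇ⇒≤ (59 * (10 * 10 * 10)) (39 * 39 * 39) _)

      instance
        bμ≢0 : NonZero (b * μ)
        bμ≢0 = ≢-nonZero λ bμ≡0 → n≮0 (≤-trans (>-nonZero⁻¹ (39 * (ν * ρ)) {{m*n≢0 39 (ν * ρ) {{_}} {{m*n≢0 ν ρ}}}})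
          (subst (λ x → 39 * (ν * ρ) ≤ 10 * x) bμ≡0 39νρ≤10bμ))
        μ≢0 : NonZero μ
        μ≢0 = m*n≢0⇒n≢0 b

      -- Bounds ρ′ from below by about μν³ρ²/b: the fourth power of μ in Dμ⁴ ≤ 8ρρ′ is split into μ
      -- and μ³, and the cube is replaced through `bμ-cube`. The resulting ν³ is what `growth` has
      -- to be weighed against.
      lower : 59 * (b * b * μ * (ν * ν * ν * (ρ * ρ * ρ))) ≤ 8 * (ρ * ρ′) * (b * b * b)
      lower = begin
        59 * (b * b * μ * (ν * ν * ν * (ρ * ρ * ρ)))
          ≡⟨ lem₁ (b * b * μ) (ν * ν * ν * (ρ * ρ * ρ)) ⟩
        b * b * μ * (59 * (ν * ν * ν * (ρ * ρ * ρ)))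
          ≤⟨ *-mono-≤ (*-monoˡ-≤ μ bb≤D) bμ-cube ⟩
        D * μ * (b * μ * (b * μ) * (b * μ))
          ≡⟨ lem₂ D μ b ⟩
        D * (μ * μ * (μ * μ)) * (b * b * b)
          ≤⟨ *-monoˡ-≤ (b * b * b) Dμ⁴≤8ρρ′ ⟩
        8 * (ρ * ρ′) * (b * b * b) ∎
        where
        lem₁ : ∀ x y → 59 * (x * y) ≡ x * (59 * y)
        lem₁ = solve-∀
        lem₂ : ∀ D μ b → D * μ * (b * μ * (b * μ) * (b * μ)) ≡ D * (μ * μ * (μ * μ)) * (b * b * b)
        lem₂ = solve-∀

      ν³ : ℕ
      ν³ = ν * ν * ν

      instance
        ν³≢0 : NonZero ν³
        ν³≢0 = m*n≢0 (ν * ν) ν {{m*n≢0 ν ν}}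

      common : ℕ
      common = b * b * μ * (ρ * ρ)

      instance
        common≢0 : NonZero common
        common≢0 = m*n≢0 (b * b * μ) (ρ * ρ) {{m*n≢0 (b * b) μ}} {{m*n≢0 ρ ρ}}

    -- Makes the second term of `MainBound (suc r) 1` less than half of the left side. After (17ρ)ʳ
    -- ≤ 8ν³ and `lower`, all that remains is 272 · 8 · b² < 59ρ, which follows from 225b² ≤ ρ.
    tail : ∀ r → (272 * ρ) ^ r ≤ 8 * ν³ → 2 * ((17 * ρ) ^ suc r * (b * μ)) < ρ′
    tail r g = *-cancelʳ-< (8 * ρ * (b * b * b)) _ _ (begin-strict
      2 * (17 * ρ * x * (b * μ)) * (8 * ρ * (b * b * b))
        ≡⟨ lem₁ ρ x b μ ⟩
      272 * common * (b * b) * x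
        ≤⟨ *-monoʳ-≤ (272 * common * (b * b)) (≤-trans (^-monoˡ-≤ r (*-monoˡ-≤ ρ (m≤m+n 17 255))) g) ⟩
      272 * common * (b * b) * (8 * ν³)
        ≡⟨ lem₂ 272 8 common (b * b) ν³ ⟩
      272 * 8 * (b * b) * (common * ν³)
        <⟨ *-monoˡ-< (common * ν³) {{m*n≢0 common ν³}} (*-monoˡ-< (b * b) (<ᵇ⇒< (272 * 8) (59 * 225) _)) ⟩
      59 * 225 * (b * b) * (common * ν³)
        ≡⟨ cong (_* (common * ν³)) (*-assoc 59 225 (b * b)) ⟩
      59 * (225 * (b * b)) * (common * ν³)
        ≤⟨ *-monoˡ-≤ (common * ν³) (*-monoʳ-≤ 59 225bb≤ρ) ⟩
      59 * ρ * (common * ν³)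
        ≡⟨ lem₃ ρ b μ ν³ ⟩
      59 * (b * b * μ * (ν³ * (ρ * ρ * ρ)))
        ≤⟨ lower ⟩
      8 * (ρ * ρ′) * (b * b * b)
        ≡⟨ lem₄ ρ ρ′ (b * b * b) ⟩
      ρ′ * (8 * ρ * (b * b * b)) ∎)
      where
      x : ℕ
      x = (17 * ρ) ^ r
      lem₁ : ∀ ρ x b μ → 2 * (17 * ρ * x * (b * μ)) * (8 * ρ * (b * b * b)) ≡ 272 * (b * b * μ * (ρ * ρ)) * (b * b) * x
      lem₁ = solve-∀
      lem₂ : ∀ k l c d v → k * c * d * (l * v) ≡ k * l * d * (c * v)
      lem₂ = solve-∀
      lem₃ : ∀ ρ b μ v → 59 * ρ * (b * b * μ * (ρ * ρ) * v) ≡ 59 * (b * b * μ * (v * (ρ * ρ * ρ)))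
      lem₃ = solve-∀
      lem₄ : ∀ ρ p c → 8 * (ρ * p) * c ≡ p * (8 * ρ * c)
      lem₄ = solve-∀

    -- The version for a skipped order, with two factors 17ρ more than `growth` controls. Two gains
    -- compensate: the exponent of 272ρ is positive, so 16 is available, and the left side of the
    -- bound now carries 30b². The constant is 59 = 2 · 30 - 1, and numerically 289 · 8 < 59².
    tail′ : ∀ t → (272 * ρ) ^ suc t ≤ 8 * ν³ → 2 * ((17 * ρ) ^ suc (suc (suc t)) * (b * μ)) < 59 * (b * b) * ρ′
    tail′ t g = *-cancelʳ-< (8 * ρ * (b * b * b)) _ _ (begin-strict
      2 * (17 * ρ * (17 * ρ * x) * (b * μ)) * (8 * ρ * (b * b * b))
        ≡⟨ lem₁ ρ x b μ ⟩
      289 * common * (b * b) * ρ * (16 * x)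
        ≤⟨ *-monoʳ-≤ (289 * common * (b * b) * ρ) 16x≤8ν³ ⟩
      289 * common * (b * b) * ρ * (8 * ν³)
        ≡⟨ lem₂ 289 8 common (b * b) ρ ν³ ⟩
      289 * 8 * (common * (b * b) * ρ * ν³)
        <⟨ *-monoˡ-< (common * (b * b) * ρ * ν³) {{m*n≢0 _ ν³ {{m*n≢0 _ ρ {{m*n≢0 common (b * b)}}}}}} (<ᵇ⇒< (289 * 8) (59 * 59) _) ⟩
      59 * 59 * (common * (b * b) * ρ * ν³)
        ≡⟨ lem₃ 59 ρ b μ ν³ ⟩
      59 * (b * b) * (59 * (b * b * μ * (ν³ * (ρ * ρ * ρ))))
        ≤⟨ *-monoʳ-≤ (59 * (b * b)) lower ⟩
      59 * (b * b) * (8 * (ρ * ρ′) * (b * b * b))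
        ≡⟨ lem₄ ρ ρ′ (b * b * b) (59 * (b * b)) ⟩
      59 * (b * b) * ρ′ * (8 * ρ * (b * b * b)) ∎)
      where
      x : ℕ
      x = (17 * ρ) ^ suc t
      16x≤8ν³ : 16 * x ≤ 8 * ν³
      16x≤8ν³ = begin
        16 * x                      ≤⟨ *-monoˡ-≤ x (^-monoʳ-≤ 16 (s≤s (z≤n {t}))) ⟩
        16 ^ suc t * x              ≡⟨ ^-distribʳ-* (suc t) 16 (17 * ρ) ⟨
        (16 * (17 * ρ)) ^ suc t     ≡⟨ cong (_^ suc t) (*-assoc 16 17 ρ) ⟨
        (272 * ρ) ^ suc t           ≤⟨ g ⟩
        8 * ν³                      ∎
      lem₁ : ∀ ρ x b μ → 2 * (17 * ρ * (17 * ρ * x) * (b * μ)) * (8 * ρ * (b * b * b)) ≡ 289 * (b * b * μ * (ρ * ρ)) * (b * b) * ρ * (16 * x)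
      lem₁ = solve-∀
      lem₂ : ∀ k l c d p v → k * c * d * p * (l * v) ≡ k * l * (c * d * p * v)
      lem₂ = solve-∀
      lem₃ : ∀ k ρ b μ v → k * k * (b * b * μ * (ρ * ρ) * (b * b) * ρ * v) ≡ k * (b * b) * (k * (b * b * μ * (v * (ρ * ρ * ρ))))
      lem₃ = solve-∀
      lem₄ : ∀ ρ p c d → d * (8 * (ρ * p) * c) ≡ d * p * (8 * ρ * c)
      lem₄ = solve-∀

    -- The main inequality divided by r!, for a value of L of absolute value at least r! G.
    MainBound : ℕ → ℕ → Set
    MainBound r G = ρ ^ r * ρ′ * G ≤ ν * (5 * (b * b)) ^ r * ρ′ + ρ ^ r * (17 * ρ) ^ r * (b * μ)

    impossible : ∀ r → Small (suc r) → ¬ Small r → ¬ MainBound (suc r) 1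
    impossible r s ¬s main = <-irrefl refl (begin-strict
      2 * (ρ ^ suc r * ρ′ * 1)
        ≤⟨ *-monoʳ-≤ 2 main ⟩
      2 * (ν * f * ρ′ + ρ ^ suc r * (17 * ρ) ^ suc r * (b * μ))
        ≡⟨ lem₁ ν f ρ′ (ρ ^ suc r) ((17 * ρ) ^ suc r) (b * μ) ⟩
      2 * ν * f * ρ′ + ρ ^ suc r * (2 * ((17 * ρ) ^ suc r * (b * μ)))
        <⟨ +-mono-≤-< (*-monoˡ-≤ ρ′ s) (*-monoʳ-< (ρ ^ suc r) {{m^n≢0 ρ (suc r)}} (tail r (growth r ¬s))) ⟩
      ρ ^ suc r * ρ′ + ρ ^ suc r * ρ′
        ≡⟨ lem₂ (ρ ^ suc r * ρ′) ⟩
      2 * (ρ ^ suc r * ρ′ * 1) ∎)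
      where
      f : ℕ
      f = (5 * (b * b)) ^ suc r
      lem₁ : ∀ v f p x y u → 2 * (v * f * p + x * y * u) ≡ 2 * v * f * p + x * (2 * (y * u))
      lem₁ = solve-∀
      lem₂ : ∀ x → x + x ≡ 2 * (x * 1)
      lem₂ = solve-∀

    -- One factor 5b² ≤ ρ carries `Small` to the next order. After doubling, the first term takes at
    -- most 1 ≤ b² and the second less than 59b² out of the available 60b².
    impossible′ : ∀ t → Small (suc (suc t)) → ¬ Small (suc t) → ¬ MainBound (suc (suc (suc t))) (30 * (b * b))
    impossible′ t s ¬s main = <-irrefl refl (begin-strict
      2 * (x * ρ′ * (30 * (b * b)))
        ≤⟨ *-monoʳ-≤ 2 main ⟩
      2 * (ν * (5 * (b * b) * f) * ρ′ + x * (17 * ρ) ^ r * (b * μ))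
        ≡⟨ lem₁ ν (5 * (b * b)) f ρ′ x ((17 * ρ) ^ r) (b * μ) ⟩
      5 * (b * b) * (2 * ν * f) * ρ′ + x * (2 * ((17 * ρ) ^ r * (b * μ)))
        <⟨ +-mono-≤-< (*-monoˡ-≤ ρ′ (*-mono-≤ 5bb≤ρ s)) (*-monoʳ-< x {{m^n≢0 ρ r}} (tail′ t (growth (suc t) ¬s))) ⟩
      x * ρ′ + x * (59 * (b * b) * ρ′)
        ≤⟨ +-monoˡ-≤ (x * (59 * (b * b) * ρ′)) (m≤m*n (x * ρ′) (b * b)) ⟩
      x * ρ′ * (b * b) + x * (59 * (b * b) * ρ′)
        ≡⟨ lem₂ x ρ′ (b * b) ⟩
      2 * (x * ρ′ * (30 * (b * b))) ∎)
      where
      r x f : ℕ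
      r = suc (suc (suc t))
      x = ρ ^ r
      f = (5 * (b * b)) ^ suc (suc t)
      lem₁ : ∀ v c f p x y u → 2 * (v * (c * f) * p + x * y * u) ≡ c * (2 * v * f) * p + x * (2 * (y * u))
      lem₁ = solve-∀
      lem₂ : ∀ x p d → x * p * d + x * (59 * d * p) ≡ 2 * (x * p * (30 * d))
      lem₂ = solve-∀

  -- Sizes of the real and imaginary parts of x

  -- Comparing D x⁴ with σ η η̄₃ gives 4Dνμ³ ≈ sbρ′ and Dμ⁴ ≈ sρρ′, hence 4νρ ≈ bμ. This is made
  -- precise by bootstrapping: 2ν ≤ μ gives a crude estimate, which with 1100b ≤ ρ improves to 1000ν
  -- ≤ μ, and then all constants are nearly exact.
  module Sizes (D s ρ ρ′ b ν μ δ H : ℕ) (0<D : 0 < D) (0<μ : 0 < μ) (0<b : 0 < b)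
               (2ν≤μ : 2 * ν ≤ μ) (s≤4 : s ≤ 4) (μμ≤δ+νν : μ * μ ≤ δ + ν * ν)
               (imaginary : D * (4 * (ν * μ * δ)) ≤ s * (b * (ρ + ρ′)))
               (norm : D * ((μ * μ + ν * ν) * (μ * μ + ν * ν)) ≡ s * H)
               (ρρ′≤H : ρ * ρ′ ≤ H) (H≤2ρρ′ : H ≤ 2 * (ρ * ρ′))
               (1100b≤ρ : 1100 * b ≤ ρ) (1000ρ≤ρ′ : 1000 * ρ ≤ ρ′) where
    open ≤-Reasoning

    private
      instance
        D≢0 : NonZero D
        D≢0 = >-nonZero 0<D
        μ≢0 : NonZero μ
        μ≢0 = >-nonZero 0<μ
        b≢0 : NonZero b
        b≢0 = >-nonZero 0<b
        μ²≢0 : NonZero (μ * μ)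
        μ²≢0 = m*n≢0 μ μ
        Dμ³≢0 : NonZero (D * (μ * μ * μ))
        Dμ³≢0 = m*n≢0 D (μ * μ * μ) {{D≢0}} {{m*n≢0 (μ * μ) μ}}

      ratio-squared : ∀ k → k * ν ≤ μ → k * k * (ν * ν) ≤ μ * μ
      ratio-squared k h = ≤-trans (≤-reflexive (lem k ν)) (*-mono-≤ h h)
        where
        lem : ∀ k v → k * k * (v * v) ≡ k * v * (k * v)
        lem = solve-∀

      -- Replaces the exact imaginary part 4νμδ by 4νμ³. The ratio u/v is the share of μ² that
      -- survives in δ ≥ μ² - ν².
      imaginary-below : ∀ u v → u * (μ * μ) + v * (ν * ν) ≤ v * (μ * μ) → u * (D * (4 * (ν * (μ * μ * μ)))) ≤ v * (s * (b * (ρ + ρ′)))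
      imaginary-below u v h = begin
        u * (D * (4 * (ν * (μ * μ * μ))))
          ≡⟨ lem₁ u D ν μ ⟩
        4 * D * ν * μ * (u * (μ * μ))
          ≤⟨ *-monoʳ-≤ (4 * D * ν * μ) (+-cancelʳ-≤ (v * (ν * ν)) _ _ (≤-trans h (≤-trans (*-monoʳ-≤ v μμ≤δ+νν) (≤-reflexive (*-distribˡ-+ v δ (ν * ν)))))) ⟩
        4 * D * ν * μ * (v * δ)
          ≡⟨ lem₂ D ν μ v δ ⟩
        v * (D * (4 * (ν * μ * δ)))
          ≤⟨ *-monoʳ-≤ v imaginary ⟩
        v * (s * (b * (ρ + ρ′))) ∎
        where
        lem₁ : ∀ u D ν μ → u * (D * (4 * (ν * (μ * μ * μ)))) ≡ 4 * D * ν * μ * (u * (μ * μ))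
        lem₁ = solve-∀
        lem₂ : ∀ D ν μ v δ → 4 * D * ν * μ * (v * δ) ≡ v * (D * (4 * (ν * μ * δ)))
        lem₂ = solve-∀

      norm-above : ∀ u v → v * (μ * μ + ν * ν) ≤ u * (μ * μ) → v * v * (s * (ρ * ρ′)) ≤ u * u * (D * (μ * μ * μ) * μ)
      norm-above u v h = begin
        v * v * (s * (ρ * ρ′))
          ≤⟨ *-monoʳ-≤ (v * v) (*-monoʳ-≤ s ρρ′≤H) ⟩
        v * v * (s * H)
          ≡⟨ cong (v * v *_) (sym norm) ⟩
        v * v * (D * ((μ * μ + ν * ν) * (μ * μ + ν * ν)))
          ≡⟨ lem₁ v D (μ * μ + ν * ν) ⟩
        D * (v * (μ * μ + ν * ν) * (v * (μ * μ + ν * ν)))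
          ≤⟨ *-monoʳ-≤ D (*-mono-≤ h h) ⟩
        D * (u * (μ * μ) * (u * (μ * μ)))
          ≡⟨ lem₂ D u μ ⟩
        u * u * (D * (μ * μ * μ) * μ) ∎
        where
        lem₁ : ∀ v D N → v * v * (D * (N * N)) ≡ D * (v * N * (v * N))
        lem₁ = solve-∀
        lem₂ : ∀ D u μ → D * (u * (μ * μ) * (u * (μ * μ))) ≡ u * u * (D * (μ * μ * μ) * μ)
        lem₂ = solve-∀

      -- With ν² ≤ μ²/4 the losses are 3/4 in δ, (5/4)² in the norm, and 2 in ρ + ρ′ ≤ 2ρ′; together
      -- they turn the ideal 4 into 24/25.
      rough : 24 * (ν * ρ) ≤ 25 * (b * μ)
      rough = *-cancelʳ-≤ _ _ (D * (μ * μ * μ)) (begin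
        24 * (ν * ρ) * (D * (μ * μ * μ))
          ≡⟨ lem₁ ν ρ D (μ * μ * μ) ⟩
        2 * ρ * (3 * (D * (4 * (ν * (μ * μ * μ)))))
          ≤⟨ *-monoʳ-≤ (2 * ρ) (imaginary-below 3 4 (≤-trans (+-monoʳ-≤ (3 * (μ * μ)) (ratio-squared 2 2ν≤μ)) (≤-reflexive (lem₂ (μ * μ))))) ⟩
        2 * ρ * (4 * (s * (b * (ρ + ρ′))))
          ≤⟨ *-monoʳ-≤ (2 * ρ) (*-monoʳ-≤ 4 (*-monoʳ-≤ s (*-monoʳ-≤ b (+-monoˡ-≤ ρ′ (≤-trans (m≤m+n ρ (999 * ρ)) 1000ρ≤ρ′))))) ⟩
        2 * ρ * (4 * (s * (b * (ρ′ + ρ′))))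
          ≡⟨ lem₃ ρ s b ρ′ ⟩
        b * (4 * 4 * (s * (ρ * ρ′)))
          ≤⟨ *-monoʳ-≤ b (norm-above 5 4 (≤-trans (≤-reflexive (*-distribˡ-+ 4 (μ * μ) (ν * ν)))
               (≤-trans (+-monoʳ-≤ (4 * (μ * μ)) (ratio-squared 2 2ν≤μ)) (≤-reflexive (lem₄ (μ * μ)))))) ⟩
        b * (5 * 5 * (D * (μ * μ * μ) * μ))
          ≡⟨ lem₅ b (D * (μ * μ * μ)) μ ⟩
        25 * (b * μ) * (D * (μ * μ * μ)) ∎)
        where
        lem₁ : ∀ v p D x → 24 * (v * p) * (D * x) ≡ 2 * p * (3 * (D * (4 * (v * x))))
        lem₁ = solve-∀
        lem₂ : ∀ x → 3 * x + x ≡ 4 * x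
        lem₂ = solve-∀
        lem₃ : ∀ p s b q → 2 * p * (4 * (s * (b * (q + q)))) ≡ b * (4 * 4 * (s * (p * q)))
        lem₃ = solve-∀
        lem₄ : ∀ x → 4 * x + x ≡ 5 * x
        lem₄ = solve-∀
        lem₅ : ∀ b x u → b * (5 * 5 * (x * u)) ≡ 25 * (b * u) * x
        lem₅ = solve-∀

      1000ν≤μ : 1000 * ν ≤ μ
      1000ν≤μ = *-cancelˡ-≤ (25 * b) {{m*n≢0 25 b}} (begin
        25 * b * (1000 * ν)      ≡⟨ lem 25 1000 b ν ⟩
        25 * 1000 * (b * ν)      ≤⟨ *-monoˡ-≤ (b * ν) (≤ᵇ⇒≤ (25 * 1000) (24 * 1100) _) ⟩
        24 * 1100 * (b * ν)      ≡⟨ lem′ 24 1100 b ν ⟩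
        24 * (ν * (1100 * b))    ≤⟨ *-monoʳ-≤ 24 (*-monoʳ-≤ ν 1100b≤ρ) ⟩
        24 * (ν * ρ)             ≤⟨ rough ⟩
        25 * (b * μ)             ≡⟨ *-assoc 25 b μ ⟨
        25 * b * μ               ∎)
        where
        lem : ∀ k l b v → k * b * (l * v) ≡ k * l * (b * v)
        lem = solve-∀
        lem′ : ∀ k l b v → k * l * (b * v) ≡ k * (v * (l * b))
        lem′ = solve-∀

      1000νν≤μμ : 1000 * (ν * ν) ≤ μ * μ
      1000νν≤μμ = ≤-trans (*-monoˡ-≤ (ν * ν) (≤ᵇ⇒≤ 1000 (1000 * 1000) _)) (ratio-squared 1000 1000ν≤μ)

      imaginary-sharp : 999 * 4 * (D * (ν * (μ * μ * μ))) ≤ 1001 * (s * (b * ρ′))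
      imaginary-sharp = begin
        999 * 4 * (D * (ν * (μ * μ * μ)))
          ≡⟨ lem₁ 999 D ν (μ * μ * μ) ⟩
        999 * (D * (4 * (ν * (μ * μ * μ))))
          ≤⟨ imaginary-below 999 1000 (≤-trans (+-monoʳ-≤ (999 * (μ * μ)) 1000νν≤μμ) (≤-reflexive (+-comm (999 * (μ * μ)) (μ * μ)))) ⟩
        1000 * (s * (b * (ρ + ρ′)))
          ≡⟨ lem₃ 1000 s b ρ ρ′ ⟩
        s * (b * (1000 * ρ + 1000 * ρ′))
          ≤⟨ *-monoʳ-≤ s (*-monoʳ-≤ b (+-monoˡ-≤ (1000 * ρ′) 1000ρ≤ρ′)) ⟩
        s * (b * (ρ′ + 1000 * ρ′))
          ≡⟨ lem₄ 1000 s b ρ′ ⟩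
        1001 * (s * (b * ρ′)) ∎
        where
        lem₁ : ∀ k D v x → k * 4 * (D * (v * x)) ≡ k * (D * (4 * (v * x)))
        lem₁ = solve-∀
        lem₃ : ∀ k s b p q → k * (s * (b * (p + q))) ≡ s * (b * (k * p + k * q))
        lem₃ = solve-∀
        lem₄ : ∀ k s b q → s * (b * (q + k * q)) ≡ suc k * (s * (b * q))
        lem₄ = solve-∀

      1000N≤1001μμ : 1000 * (μ * μ + ν * ν) ≤ 1001 * (μ * μ)
      1000N≤1001μμ = begin
        1000 * (μ * μ + ν * ν)             ≡⟨ *-distribˡ-+ 1000 (μ * μ) (ν * ν) ⟩
        1000 * (μ * μ) + 1000 * (ν * ν)    ≤⟨ +-monoʳ-≤ (1000 * (μ * μ)) 1000νν≤μμ ⟩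
        1000 * (μ * μ) + μ * μ             ≡⟨ +-comm (1000 * (μ * μ)) (μ * μ) ⟩
        1001 * (μ * μ)                     ∎

      combine : ∀ p q c d u v .{{_ : NonZero q}} .{{_ : NonZero d}} →
        p * (D * (ν * (μ * μ * μ))) ≤ q * (s * (b * ρ′)) → c * (s * (ρ * ρ′)) ≤ d * (D * (μ * μ * μ) * μ) →
        u * (q * d) ≤ v * (p * c) → u * (ν * ρ) ≤ v * (b * μ)
      combine p q c d u v h₁ h₂ num = *-cancelʳ-≤ _ _ (q * d * (D * (μ * μ * μ))) {{m*n≢0 (q * d) (D * (μ * μ * μ)) {{m*n≢0 q d}}}} (begin
        u * (ν * ρ) * (q * d * (D * (μ * μ * μ)))
          ≡⟨ lem₁ u (ν * ρ) (q * d) (D * (μ * μ * μ)) ⟩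
        u * (q * d) * (ν * ρ * (D * (μ * μ * μ)))
          ≤⟨ *-monoˡ-≤ (ν * ρ * (D * (μ * μ * μ))) num ⟩
        v * (p * c) * (ν * ρ * (D * (μ * μ * μ)))
          ≡⟨ lem₂ v p c ν ρ D (μ * μ * μ) ⟩
        v * c * ρ * (p * (D * (ν * (μ * μ * μ))))
          ≤⟨ *-monoʳ-≤ (v * c * ρ) h₁ ⟩
        v * c * ρ * (q * (s * (b * ρ′)))
          ≡⟨ lem₃ v c ρ q s b ρ′ ⟩
        v * q * b * (c * (s * (ρ * ρ′)))
          ≤⟨ *-monoʳ-≤ (v * q * b) h₂ ⟩
        v * q * b * (d * (D * (μ * μ * μ) * μ))
          ≡⟨ lem₄ v q b d (D * (μ * μ * μ)) μ ⟩
        v * (b * μ) * (q * d * (D * (μ * μ * μ))) ∎)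
        where
        lem₁ : ∀ u x y z → u * x * (y * z) ≡ u * y * (x * z)
        lem₁ = solve-∀
        lem₂ : ∀ v p c n r D x → v * (p * c) * (n * r * (D * x)) ≡ v * c * r * (p * (D * (n * x)))
        lem₂ = solve-∀
        lem₃ : ∀ v c r q s b r′ → v * c * r * (q * (s * (b * r′))) ≡ v * q * b * (c * (s * (r * r′)))
        lem₃ = solve-∀
        lem₄ : ∀ v q b d x u → v * q * b * (d * (x * u)) ≡ v * (b * u) * (q * d * x)
        lem₄ = solve-∀

      -- The product of the estimate for νμ³ with the one for νρ, divided by the common factor μ.
      combine′ : ∀ p q u v w .{{_ : NonZero q}} .{{_ : NonZero v}} →
        p * (D * (ν * (μ * μ * μ))) ≤ q * (s * (b * ρ′)) → u * (ν * ρ) ≤ v * (b * μ) → w * (q * v) ≤ p * u →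
        w * (D * (ν * ν) * ρ * (μ * μ)) ≤ s * (b * b) * ρ′
      combine′ p q u v w h₁ h₂ num = *-cancelʳ-≤ _ _ (q * v * μ) {{m*n≢0 (q * v) μ {{m*n≢0 q v}}}} (begin
        w * (D * (ν * ν) * ρ * (μ * μ)) * (q * v * μ)
          ≡⟨ lem₁ w (D * (ν * ν) * ρ * (μ * μ)) (q * v) μ ⟩
        w * (q * v) * (D * (ν * ν) * ρ * (μ * μ) * μ)
          ≤⟨ *-monoˡ-≤ (D * (ν * ν) * ρ * (μ * μ) * μ) num ⟩
        p * u * (D * (ν * ν) * ρ * (μ * μ) * μ)
          ≡⟨ lem₂ p u D ν ρ μ ⟩
        p * (D * (ν * (μ * μ * μ))) * (u * (ν * ρ))
          ≤⟨ *-mono-≤ h₁ h₂ ⟩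
        q * (s * (b * ρ′)) * (v * (b * μ))
          ≡⟨ lem₃ q s b ρ′ v μ ⟩
        s * (b * b) * ρ′ * (q * v * μ) ∎)
        where
        lem₁ : ∀ w x y u → w * x * (y * u) ≡ w * y * (x * u)
        lem₁ = solve-∀
        lem₂ : ∀ p u D n r m → p * u * (D * (n * n) * r * (m * m) * m) ≡ p * (D * (n * (m * m * m))) * (u * (n * r))
        lem₂ = solve-∀
        lem₃ : ∀ q s b r v m → q * (s * (b * r)) * (v * (b * m)) ≡ s * (b * b) * r * (q * v * m)
        lem₃ = solve-∀

    -- The limiting ratio is 4; the losses 999/1000 and 1001/1000 leave room for 3.9.
    39νρ≤10bμ : 39 * (ν * ρ) ≤ 10 * (b * μ)
    39νρ≤10bμ = combine (999 * 4) 1001 (1000 * 1000) (1001 * 1001) 39 10 imaginary-sharp (norm-above 1001 1000 1000N≤1001μμ)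
      (≤ᵇ⇒≤ (39 * (1001 * (1001 * 1001))) (10 * (999 * 4 * (1000 * 1000))) _)

    Dμ⁴≤8ρρ′ : D * (μ * μ * (μ * μ)) ≤ 8 * (ρ * ρ′)
    Dμ⁴≤8ρρ′ = begin
      D * (μ * μ * (μ * μ))
        ≤⟨ *-monoʳ-≤ D (*-mono-≤ (m≤m+n (μ * μ) (ν * ν)) (m≤m+n (μ * μ) (ν * ν))) ⟩
      D * ((μ * μ + ν * ν) * (μ * μ + ν * ν))
        ≡⟨ norm ⟩
      s * H
        ≤⟨ *-mono-≤ s≤4 H≤2ρρ′ ⟩
      4 * (2 * (ρ * ρ′))
        ≡⟨ *-assoc 4 2 (ρ * ρ′) ⟨
      8 * (ρ * ρ′) ∎

    -- By 4Dνμ³ ≈ sbρ′ and 4νρ ≈ bμ the left side is about 4sb²ρ′; the 5 absorbs the losses. It is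
    -- split as 65 = 5 · 13, where 65 pays for replacing 64(μ² + ν²) by a multiple of μ².
    main-term-small : 64 * D * (ν * ν) * (μ * μ + ν * ν) * ρ ≤ 5 * s * (b * b) * ρ′
    main-term-small = begin
      64 * D * (ν * ν) * (μ * μ + ν * ν) * ρ
        ≡⟨ lem₁ D (ν * ν) (μ * μ + ν * ν) ρ ⟩
      D * (ν * ν) * ρ * (64 * (μ * μ + ν * ν))
        ≤⟨ *-monoʳ-≤ (D * (ν * ν) * ρ) 64N≤65μμ ⟩
      D * (ν * ν) * ρ * (65 * (μ * μ))
        ≡⟨ lem₂ (D * (ν * ν) * ρ) (μ * μ) ⟩
      5 * (13 * (D * (ν * ν) * ρ * (μ * μ)))
        ≤⟨ *-monoʳ-≤ 5 (combine′ (999 * 4) 1001 39 10 13 imaginary-sharp 39νρ≤10bμ (≤ᵇ⇒≤ (13 * (1001 * 10)) (999 * 4 * 39) _)) ⟩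
      5 * (s * (b * b) * ρ′)
        ≡⟨ lem₃ s (b * b) ρ′ ⟩
      5 * s * (b * b) * ρ′ ∎
      where
      64N≤65μμ : 64 * (μ * μ + ν * ν) ≤ 65 * (μ * μ)
      64N≤65μμ = begin
        64 * (μ * μ + ν * ν)             ≡⟨ *-distribˡ-+ 64 (μ * μ) (ν * ν) ⟩
        64 * (μ * μ) + 64 * (ν * ν)      ≤⟨ +-monoʳ-≤ (64 * (μ * μ)) (≤-trans (*-monoˡ-≤ (ν * ν) (≤ᵇ⇒≤ 64 1000 _)) 1000νν≤μμ) ⟩
        64 * (μ * μ) + μ * μ             ≡⟨ +-comm (64 * (μ * μ)) (μ * μ) ⟩
        65 * (μ * μ)                     ∎
      lem₁ : ∀ D v N p → 64 * D * v * N * p ≡ D * v * p * (64 * N)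
      lem₁ = solve-∀
      lem₂ : ∀ x u → x * (65 * u) ≡ 5 * (13 * (x * u))
      lem₂ = solve-∀
      lem₃ : ∀ s c q → 5 * (s * c * q) ≡ 5 * s * c * q
      lem₃ = solve-∀

  -- Parity, coprime factors of squares and Pythagorean triples

  even-or-odd : ∀ n → ∃ λ k → n ≡ 2 * k ⊎ n ≡ suc (2 * k)
  even-or-odd zero    = 0 , inj₁ refl
  even-or-odd (suc n) with even-or-odd n
  ... | k , inj₁ e = k , inj₂ (cong suc e)
  ... | k , inj₂ e = suc k , inj₁ (trans (cong suc e) (lem k))
    where
    lem : ∀ k → suc (suc (2 * k)) ≡ 2 * suc k
    lem = solve-∀

  odd≢even : ∀ x y → suc (2 * x) ≢ 2 * y
  odd≢even x       zero    ()
  odd≢even zero    (suc y) e = 0≢1+n (trans (suc-injective e) (+-suc y (y + 0)))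
  odd≢even (suc x) (suc y) e = odd≢even x y (suc-injective (suc-injective (trans (lem x) (trans e (lem′ y)))))
    where
    lem : ∀ x → suc (suc (suc (2 * x))) ≡ suc (2 * suc x)
    lem = solve-∀
    lem′ : ∀ y → 2 * suc y ≡ suc (suc (2 * y))
    lem′ = solve-∀

  square-injective : ∀ {x y} → x * x ≡ y * y → x ≡ y
  square-injective {x} {y} e with <-cmp x y
  ... | tri< x<y _ _ = ⊥-elim (<⇒≢ (*-mono-< x<y x<y) e)
  ... | tri≈ _ x≡y _ = x≡y
  ... | tri> _ _ y<x = ⊥-elim (<⇒≢ (*-mono-< y<x y<x) (sym e))

  coprime-squareˡ : ∀ {m n} → Coprime m n → Coprime (m * m) n
  coprime-squareˡ {m} {n} c {d} (d∣mm , d∣n) = c (coprime-divisor {d} {m} d⊥m d∣mm , d∣n)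
    where
    d⊥m : Coprime d m
    d⊥m (e∣d , e∣m) = c (e∣m , ∣-trans e∣d d∣n)

  coprime-square : ∀ {m n} → Coprime m n → Coprime m (n * n)
  coprime-square c = Coprimality.sym (coprime-squareˡ (Coprimality.sym c))

  -- With g the gcd of u and w: u divides both gu and gw, hence g², because it divides w² = uv and
  -- so wg. Conversely g² divides u² and uv, hence u · gcd u v = u.
  coprime-factor-of-square : ∀ {u v w} → Coprime u v → u * v ≡ w * w → u ≡ gcd u w * gcd u w
  coprime-factor-of-square {u} {v} {w} c uv≡ww = ∣-antisym u∣gg gg∣u
    where
    g : ℕ
    g = gcd u w
    u∣gg : u ∣ g * g
    u∣gg = subst (u ∣_) (sym (c*gcd[m,n]≡gcd[cm,cn] g u w)) (gcd-greatest (n∣m*n g)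
      (subst (u ∣_) (trans (sym (c*gcd[m,n]≡gcd[cm,cn] w u w)) (*-comm w g)) (gcd-greatest (n∣m*n w) (divides v (trans (sym uv≡ww) (*-comm u v))))))
    gg∣u : g * g ∣ u
    gg∣u = subst (g * g ∣_) (trans (sym (c*gcd[m,n]≡gcd[cm,cn] u u v)) (trans (cong (u *_) (coprime⇒gcd≡1 c)) (*-identityʳ u)))
      (gcd-greatest (*-pres-∣ (gcd[m,n]∣m u w) (gcd[m,n]∣m u w))
        (subst (g * g ∣_) (sym uv≡ww) (*-pres-∣ (gcd[m,n]∣n u w) (gcd[m,n]∣n u w))))

  -- The classical parametrisation. Since (z - x)(z + x) = 4w², the difference is even, say 2v; then
  -- x + v and v are coprime with product w², so each is a square. Writing p² = x + q² avoids
  -- subtraction.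
  pythagorean : ∀ x w z → x * x + 2 * w * (2 * w) ≡ z * z → Coprime x (2 * w) →
    ∃₂ λ p q → p * p ≡ x + q * q × p * q ≡ w × p * p + q * q ≡ z
  pythagorean x w z xx+yy≡zz c = solution (even-or-odd (z ∸ x)) (m+[n∸m]≡n x≤z)
    where
    x≤z : x ≤ z
    x≤z = ≮⇒≥ λ z<x → <⇒≱ (*-mono-< z<x z<x) (≤-trans (m≤m+n (x * x) _) (≤-reflexive xx+yy≡zz))
    difference : ∀ g → x + g ≡ z → g * (2 * x + g) ≡ 4 * (w * w)
    difference g refl = +-cancelˡ-≡ (x * x) _ _ (trans (lem₁ x g) (trans (sym xx+yy≡zz) (lem₂ x w)))
      where
      lem₁ : ∀ x g → x * x + g * (2 * x + g) ≡ (x + g) * (x + g)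
      lem₁ = solve-∀
      lem₂ : ∀ x w → x * x + 2 * w * (2 * w) ≡ x * x + 4 * (w * w)
      lem₂ = solve-∀
    solution : ∀ {g} → (∃ λ k → g ≡ 2 * k ⊎ g ≡ suc (2 * k)) → x + g ≡ z →
      ∃₂ λ p q → p * p ≡ x + q * q × p * q ≡ w × p * p + q * q ≡ z
    -- An odd difference g would make g (2x + g) odd, while it equals 4w².
    solution (k , inj₂ refl) x+g≡z = ⊥-elim (odd≢even (2 * k * x + 2 * k * k + 2 * k + x) (2 * (w * w))
      (trans (lem₁ k x) (trans (difference (suc (2 * k)) x+g≡z) (lem₂ (w * w)))))
      where
      lem₁ : ∀ k x → suc (2 * (2 * k * x + 2 * k * k + 2 * k + x)) ≡ suc (2 * k) * (2 * x + suc (2 * k))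
      lem₁ = solve-∀
      lem₂ : ∀ x → 4 * x ≡ 2 * (2 * x)
      lem₂ = solve-∀
    solution (v , inj₁ refl) x+g≡z = gcd u w , gcd v w ,
      trans (sym u≡) (cong (x +_) v≡) ,
      square-injective (trans (lem₁ (gcd u w) (gcd v w)) (trans (sym (cong₂ _*_ u≡ v≡)) uv≡ww)) ,
      trans (sym (cong₂ _+_ u≡ v≡)) (trans (lem₂ x v) x+g≡z)
      where
      u : ℕ
      u = x + v
      uv≡ww : u * v ≡ w * w
      uv≡ww = *-cancelˡ-≡ (u * v) (w * w) 4 (trans (lem x v) (difference (2 * v) x+g≡z))
        where
        lem : ∀ x v → 4 * ((x + v) * v) ≡ 2 * v * (2 * x + 2 * v)
        lem = solve-∀
      u⊥v : Coprime u v
      u⊥v {d} (d∣u , d∣v) = coprime-square {x} {w} (λ { (e∣x , e∣w) → c (e∣x , ∣n⇒∣m*n 2 e∣w) })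
        (∣m+n∣m⇒∣n (subst (d ∣_) (+-comm x v) d∣u) d∣v , subst (d ∣_) uv≡ww (∣n⇒∣m*n u d∣v))
      u≡ : u ≡ gcd u w * gcd u w
      u≡ = coprime-factor-of-square u⊥v uv≡ww
      v≡ : v ≡ gcd v w * gcd v w
      v≡ = coprime-factor-of-square (Coprimality.sym u⊥v) (trans (*-comm v u) uv≡ww)
      lem₁ : ∀ p q → p * q * (p * q) ≡ p * p * (q * q)
      lem₁ = solve-∀
      lem₂ : ∀ x v → x + v + v ≡ x + 2 * v
      lem₂ = solve-∀

  -- Squares are 0 or 1 modulo 4.
  even-of-sum-divisible-by-4 : ∀ x y z → x * x + y * y ≡ 4 * z → (∃ λ k → x ≡ 2 * k) × (∃ λ k → y ≡ 2 * k)
  even-of-sum-divisible-by-4 x y z e with even-or-odd x | even-or-odd y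
  ... | k , inj₁ p | l , inj₁ q = (k , p) , (l , q)
  ... | k , inj₁ refl | l , inj₂ refl = ⊥-elim (odd≢even (2 * (k * k) + 2 * (l * l) + 2 * l) (2 * z) (trans (lem k l) (trans e (lem′ z))))
    where
    lem : ∀ k l → suc (2 * (2 * (k * k) + 2 * (l * l) + 2 * l)) ≡ 2 * k * (2 * k) + suc (2 * l) * suc (2 * l)
    lem = solve-∀
    lem′ : ∀ z → 4 * z ≡ 2 * (2 * z)
    lem′ = solve-∀
  ... | k , inj₂ refl | l , inj₁ refl = ⊥-elim (odd≢even (2 * (k * k) + 2 * (l * l) + 2 * k) (2 * z) (trans (lem k l) (trans e (lem′ z))))
    where
    lem : ∀ k l → suc (2 * (2 * (k * k) + 2 * (l * l) + 2 * k)) ≡ suc (2 * k) * suc (2 * k) + 2 * l * (2 * l)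
    lem = solve-∀
    lem′ : ∀ z → 4 * z ≡ 2 * (2 * z)
    lem′ = solve-∀
  ... | k , inj₂ refl | l , inj₂ refl = ⊥-elim (odd≢even (k * k + l * l + k + l) z (*-cancelˡ-≡ (suc (2 * (k * k + l * l + k + l))) (2 * z) 2 (trans (lem k l) (trans e (lem′ z)))))
    where
    lem : ∀ k l → 2 * suc (2 * (k * k + l * l + k + l)) ≡ suc (2 * k) * suc (2 * k) + suc (2 * l) * suc (2 * l)
    lem = solve-∀
    lem′ : ∀ z → 4 * z ≡ 2 * (2 * z)
    lem′ = solve-∀

  -- Two odd squares sum to 2 modulo 4, which is not a square.
  one-even : ∀ x y z → x * x + y * y ≡ z * z → (∃ λ k → x ≡ 2 * k) ⊎ (∃ λ k → y ≡ 2 * k)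
  one-even x y z e with even-or-odd x | even-or-odd y
  ... | k , inj₁ p    | _             = inj₁ (k , p)
  ... | k , inj₂ _    | l , inj₁ q    = inj₂ (l , q)
  ... | k , inj₂ refl | l , inj₂ refl with even-or-odd z
  ... | h , inj₁ refl = ⊥-elim (odd≢even (k * k + l * l + k + l) (h * h) (*-cancelˡ-≡ _ _ 2 (trans (lem k l) (trans e (lem′ h)))))
    where
    lem : ∀ k l → 2 * suc (2 * (k * k + l * l + k + l)) ≡ suc (2 * k) * suc (2 * k) + suc (2 * l) * suc (2 * l)
    lem = solve-∀
    lem′ : ∀ h → 2 * h * (2 * h) ≡ 2 * (2 * (h * h))
    lem′ = solve-∀
  ... | h , inj₂ refl = ⊥-elim (odd≢even (2 * (h * h) + 2 * h) (suc (2 * (k * k + l * l + k + l))) (trans (lem′ h) (trans (sym e) (sym (lem k l)))))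
    where
    lem : ∀ k l → 2 * suc (2 * (k * k + l * l + k + l)) ≡ suc (2 * k) * suc (2 * k) + suc (2 * l) * suc (2 * l)
    lem = solve-∀
    lem′ : ∀ h → suc (2 * (2 * (h * h) + 2 * h)) ≡ suc (2 * h) * suc (2 * h)
    lem′ = solve-∀

open import Defs
open import Data.Nat as ℕ using (ℕ; zero; suc; _!)
import Data.Nat.Properties as ℕ
import Data.Nat.Divisibility as ℕ
open import Data.Integer hiding (suc; pred; positive)
open import Data.Integer.Properties
import Data.Integer.Divisibility.Signed as ℤ
open import Data.Integer.Tactic.RingSolver using (solve-∀)
open import Data.Nat.Tactic.RingSolver using () renaming (solve-∀ to ℕ-solve-∀)
open import Data.Product using (∃; ∃₂; ∃-syntax; _×_; _,_; proj₁; proj₂)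
open import Data.Sum using (_⊎_; inj₁; inj₂; [_,_]′)
open import Data.Empty using (⊥; ⊥-elim)
open import Data.List using (List; []; _∷_; length)
open import Data.List.Relation.Unary.All using (All; []; _∷_)
open import Data.List.Relation.Unary.AllPairs using ([]; _∷_)
open import Data.List.Relation.Unary.Unique.Propositional using (Unique)
open import Data.Nat.Coprimality as Coprimality using (Coprime; coprime-divisor)
open import Relation.Binary.Definitions using (tri<; tri≈; tri>)
open import Relation.Binary.PropositionalEquality hiding (J)
open import Relation.Nullary using (¬_; yes; no)
open Naturals

-- Padé approximants of the fourth root

diagonalSum : ℕ → (ℕ → ℕ → ℤ) → ℤ
diagonalSum zero    g = g 0 0
diagonalSum (suc r) g = g 0 (suc r) + diagonalSum r (λ i k → g (suc i) k)

-- The definition peels off the end i = 0; multiplication by the second variable needs the end k =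
-- 0.
diagonalSum-last : ∀ r g → diagonalSum (suc r) g ≡ g (suc r) 0 + diagonalSum r (λ i k → g i (suc k))
diagonalSum-last zero    g = +-comm (g 0 1) (g 1 0)
diagonalSum-last (suc r) g =
  trans (cong (λ x → g 0 (suc (suc r)) + x) (diagonalSum-last r (λ i k → g (suc i) k)))
        (lem (g 0 (suc (suc r))) (g (suc (suc r)) 0) (diagonalSum r (λ i k → g (suc i) (suc k))))
  where
  lem : ∀ x y z → x + (y + z) ≡ y + (x + z)
  lem = solve-∀

diagonalSum-cong : ∀ r {f g} → (∀ i k → i ℕ.+ k ≡ r → f i k ≡ g i k) → diagonalSum r f ≡ diagonalSum r g
diagonalSum-cong zero    h = h 0 0 refl
diagonalSum-cong (suc r) h =
  cong₂ _+_ (h 0 (suc r) refl) (diagonalSum-cong r (λ i k e → h (suc i) k (cong suc e)))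

diagonalSum-+ : ∀ r f g → diagonalSum r (λ i k → f i k + g i k) ≡ diagonalSum r f + diagonalSum r g
diagonalSum-+ zero    f g = refl
diagonalSum-+ (suc r) f g =
  trans (cong (λ x → f 0 (suc r) + g 0 (suc r) + x) (diagonalSum-+ r (λ i k → f (suc i) k) (λ i k → g (suc i) k)))
        (lem (f 0 (suc r)) (g 0 (suc r)) _ _)
  where
  lem : ∀ x y z w → x + y + (z + w) ≡ x + z + (y + w)
  lem = solve-∀

diagonalSum-* : ∀ r c f → diagonalSum r (λ i k → c * f i k) ≡ c * diagonalSum r f
diagonalSum-* zero    c f = refl
diagonalSum-* (suc r) c f =
  trans (cong (λ x → c * f 0 (suc r) + x) (diagonalSum-* r c (λ i k → f (suc i) k)))
        (sym (*-distribˡ-+ c _ _))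

-- Multiplication by the first and by the second variable, on coefficient arrays extended by zero.
shiftˡ shiftʳ : (ℕ → ℕ → ℤ) → ℕ → ℕ → ℤ
shiftˡ f zero    k = + 0
shiftˡ f (suc i) k = f i k
shiftʳ f i zero    = + 0
shiftʳ f i (suc k) = f i k

diagonalSum-shiftˡ : ∀ r (f v : ℕ → ℕ → ℤ) → diagonalSum r (λ i k → f i k * v (suc i) k) ≡ diagonalSum (suc r) (λ i k → shiftˡ f i k * v i k)
diagonalSum-shiftˡ r f v = sym (+-identityˡ (diagonalSum r (λ i k → f i k * v (suc i) k)))

diagonalSum-shiftʳ : ∀ r (f v : ℕ → ℕ → ℤ) → diagonalSum r (λ i k → f i k * v i (suc k)) ≡ diagonalSum (suc r) (λ i k → shiftʳ f i k * v i k)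
diagonalSum-shiftʳ r f v = trans (sym (+-identityˡ (diagonalSum r (λ i k → f i k * v i (suc k))))) (sym (diagonalSum-last r (λ i k → shiftʳ f i k * v i k)))

-- With η = R + iB and x = m + in, this is Im (x Pᵣ(η , η̄)), where Pᵣ(X , Y) is
-- 4ʳ r! times the numerator of the r-th Padé approximant of (Y/X)^(1/4).
L : (R B n m : ℤ) → ℕ → ℤ
L R B n m zero          = n
L R B n m (suc zero)    = + 8 * R * n - + 2 * B * m
L R B n m (suc (suc r)) =
  -- For η = X and η̄ = Y one has R = (X + Y)/2 and B² = - ((X - Y)/2)²; the formula is the
  -- three-term recurrence of the Padé numerators in these terms.
  + 8 * (+ 2 * + r + + 3) * R * L R B n m (suc r)
    + + 4 * (+ 16 * (+ r + + 1) * (+ r + + 1) - + 1) * (B * B) * L R B n m r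

-- Pᵣ is homogeneous of degree r. This is what lets the scalars D and σ be moved in and out of L.
L-homogeneous : ∀ c R B n m r → L (c * R) (c * B) n m r ≡ c ^ r * L R B n m r
L-homogeneous c R B n m zero          = sym (*-identityˡ n)
L-homogeneous c R B n m (suc zero)    = lem c R B n m
  where
  lem : ∀ c R B n m → + 8 * (c * R) * n - + 2 * (c * B) * m ≡ c * + 1 * (+ 8 * R * n - + 2 * B * m)
  lem = solve-∀
L-homogeneous c R B n m (suc (suc r)) =
  trans (cong₂ (λ x y → α * (c * R) * x + β * (c * B * (c * B)) * y)
               (L-homogeneous c R B n m (suc r)) (L-homogeneous c R B n m r))
        (lem α β c R B (c ^ r) (L R B n m (suc r)) (L R B n m r))
  where
  α β : ℤ
  α = + 8 * (+ 2 * + r + + 3)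
  β = + 4 * (+ 16 * (+ r + + 1) * (+ r + + 1) - + 1)
  lem : ∀ α β c R B p x y → α * (c * R) * (c * p * x) + β * (c * B * (c * B)) * (p * y)
    ≡ c * (c * p) * (α * R * x + β * (B * B) * y)
  lem = solve-∀

fact : ℕ → ℤ
fact r = + (r !)

fact-suc : ∀ r → fact (suc r) ≡ (+ 1 + + r) * fact r
fact-suc r = pos-* (suc r) (r !)

fact-nonZero : ∀ {r} → NonZero (fact r)
fact-nonZero {r} = ℕ.≢-nonZero (ℕ.≢-nonZero⁻¹ (r !) {{r ℕ.!≢0}})

-- padé i j is the coefficient of Yⁱ ((X - Y)/2)ʲ in Pᵣ / r!, r = i + j.
padéQuotient : ℕ → ℕ → ℕ
padéQuotient i j = ℕ.quotient (j!∣2^j*progression-4 (2 ℕ.+ 4 ℕ.* i) j)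

padé : ℕ → ℕ → ℤ
padé i j = (+ 4) ^ i * + choose i (i ℕ.+ j) * + padéQuotient i j

progression₃ : ℕ → ℕ → ℤ
progression₃ i j = + progression 4 (3 ℕ.+ 4 ℕ.* i) j

pos-+* : ∀ a b c → + (a ℕ.+ b ℕ.* c) ≡ + a + + b * + c
pos-+* a b c = cong (λ x → + a + x) (pos-* b c)

progression₃-sucʳ : ∀ i j →
  progression₃ i (suc j) ≡ progression₃ i j * (+ 4 * + i + + 4 * + j + + 3)
progression₃-sucʳ i j = trans (pos-* (progression 4 (3 ℕ.+ 4 ℕ.* i) j) (3 ℕ.+ 4 ℕ.* i ℕ.+ 4 ℕ.* j)) (cong (progression₃ i j *_) (begin
  + (3 ℕ.+ 4 ℕ.* i ℕ.+ 4 ℕ.* j)    ≡⟨ pos-+* (3 ℕ.+ 4 ℕ.* i) 4 j ⟩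
  + (3 ℕ.+ 4 ℕ.* i) + + 4 * + j    ≡⟨ cong (_+ + 4 * + j) (pos-+* 3 4 i) ⟩
  + 3 + + 4 * + i + + 4 * + j      ≡⟨ lem (+ i) (+ j) ⟩
  + 4 * + i + + 4 * + j + + 3      ∎))
  where
  open ≡-Reasoning
  lem : ∀ i j → + 3 + + 4 * i + + 4 * j ≡ + 4 * i + + 4 * j + + 3
  lem = solve-∀

progression₃-sucˡ : ∀ i j →
  progression₃ (suc i) j * (+ 4 * + i + + 3) ≡ progression₃ i j * (+ 4 * + i + + 4 * + j + + 3)
progression₃-sucˡ i j = begin
  progression₃ (suc i) j * (+ 4 * + i + + 3)
    ≡⟨ cong₂ _*_ (cong (λ c → + progression 4 c j) (shift i)) (trans (+-comm (+ 4 * + i) (+ 3)) (sym (pos-+* 3 4 i))) ⟩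
  + progression 4 (3 ℕ.+ 4 ℕ.* i ℕ.+ 4) j * + (3 ℕ.+ 4 ℕ.* i)
    ≡⟨ trans (*-comm (+ q) (+ (3 ℕ.+ 4 ℕ.* i))) (sym (pos-* (3 ℕ.+ 4 ℕ.* i) q)) ⟩
  + ((3 ℕ.+ 4 ℕ.* i) ℕ.* progression 4 (3 ℕ.+ 4 ℕ.* i ℕ.+ 4) j)
    ≡⟨ cong +_ (sym (progression-suc 4 (3 ℕ.+ 4 ℕ.* i) j)) ⟩
  progression₃ i (suc j)
    ≡⟨ progression₃-sucʳ i j ⟩
  progression₃ i j * (+ 4 * + i + + 4 * + j + + 3) ∎
  where
  open ≡-Reasoning
  q : ℕ
  q = progression 4 (3 ℕ.+ 4 ℕ.* i ℕ.+ 4) j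
  shift : ∀ i → 3 ℕ.+ 4 ℕ.* suc i ≡ 3 ℕ.+ 4 ℕ.* i ℕ.+ 4
  shift i = trans (cong (3 ℕ.+_) (trans (ℕ.*-suc 4 i) (ℕ.+-comm 4 (4 ℕ.* i)))) (sym (ℕ.+-assoc 3 (4 ℕ.* i) 4))

-- The coefficients are hypergeometric. With all denominators cleared, both integral quotients
-- inside `padé` disappear and neighbouring coefficients can be compared factor by factor.
padé-closed : ∀ i j → padé i j * (fact i * fact j * fact (i ℕ.+ j))
  ≡ (+ 4) ^ i * + (2 ℕ.^ j) * fact (i ℕ.+ (i ℕ.+ j)) * progression₃ i j
padé-closed i j = begin
  p * ch * q * (fact i * fact j * fact (i ℕ.+ j))
    ≡⟨ lem₁ p ch q (fact i) (fact j) (fact (i ℕ.+ j)) ⟩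
  p * (ch * (fact i * fact (i ℕ.+ j))) * (q * fact j)
    ≡⟨ cong₂ (λ x y → p * x * y) choose-eq quotient-eq ⟩
  p * fact (i ℕ.+ (i ℕ.+ j)) * (+ (2 ℕ.^ j) * progression₃ i j)
    ≡⟨ lem₂ p _ _ _ ⟩
  p * + (2 ℕ.^ j) * fact (i ℕ.+ (i ℕ.+ j)) * progression₃ i j ∎
  where
  open ≡-Reasoning
  p ch q : ℤ
  p  = (+ 4) ^ i
  ch = + choose i (i ℕ.+ j)
  q  = + padéQuotient i j
  choose-eq : ch * (fact i * fact (i ℕ.+ j)) ≡ fact (i ℕ.+ (i ℕ.+ j))
  choose-eq = trans (cong (ch *_) (sym (pos-* (i !) _)))
             (trans (sym (pos-* (choose i (i ℕ.+ j)) _)) (cong +_ (choose-! i (i ℕ.+ j))))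
  quotient-eq : q * fact j ≡ + (2 ℕ.^ j) * progression₃ i j
  quotient-eq = trans (sym (pos-* (padéQuotient i j) (j !)))
               (trans (cong +_ (sym (ℕ._∣_.equality (j!∣2^j*progression-4 (2 ℕ.+ 4 ℕ.* i) j))))
                      (pos-* (2 ℕ.^ j) _))
  lem₁ : ∀ p c q x y z → p * c * q * (x * y * z) ≡ p * (c * (x * z)) * (q * y)
  lem₁ = solve-∀
  lem₂ : ∀ p a b c → p * a * (b * c) ≡ p * b * a * c
  lem₂ = solve-∀

fact³-nonZero : ∀ i j → NonZero (fact i * fact j * fact (i ℕ.+ j))
fact³-nonZero i j = i*j≢0 (fact i * fact j) (fact (i ℕ.+ j))
  {{i*j≢0 (fact i) (fact j) {{fact-nonZero {i}}} {{fact-nonZero {j}}}}} {{fact-nonZero {i ℕ.+ j}}}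

padé-sucʳ : ∀ i j → (+ 1 + + j) * (+ 1 + + i + + j) * padé i (suc j)
  ≡ + 2 * (+ 2 * + i + + j + + 1) * (+ 4 * + i + + 4 * + j + + 3) * padé i j
padé-sucʳ i j = *-cancelʳ-≡ _ _ (fact i * fact j * fact (i ℕ.+ j))
  {{fact³-nonZero i j}} (begin
  (+ 1 + + j) * (+ 1 + + i + + j) * padé i (suc j) * (fact i * fact j * fact (i ℕ.+ j))
    ≡⟨ lem₁ (+ i) (+ j) (padé i (suc j)) (fact i) (fact j) (fact (i ℕ.+ j)) ⟩
  padé i (suc j) * (fact i * ((+ 1 + + j) * fact j) * ((+ 1 + + i + + j) * fact (i ℕ.+ j)))
    ≡⟨ cong₂ (λ x y → padé i (suc j) * (fact i * x * y)) (fact-suc j) fact-i+sj ⟨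
  padé i (suc j) * (fact i * fact (suc j) * fact (i ℕ.+ suc j))
    ≡⟨ padé-closed i (suc j) ⟩
  (+ 4) ^ i * + (2 ℕ.^ suc j) * fact (i ℕ.+ (i ℕ.+ suc j)) * progression₃ i (suc j)
    ≡⟨ cong₂ _*_ (cong₂ (λ x y → (+ 4) ^ i * x * y) (pos-* 2 (2 ℕ.^ j)) fact-2i+sj) (progression₃-sucʳ i j) ⟩
  (+ 4) ^ i * (+ 2 * + (2 ℕ.^ j)) * ((+ 1 + (+ i + (+ i + + j))) * fact (i ℕ.+ (i ℕ.+ j)))
    * (progression₃ i j * (+ 4 * + i + + 4 * + j + + 3))
    ≡⟨ lem₂ (+ i) (+ j) ((+ 4) ^ i) (+ (2 ℕ.^ j)) (fact (i ℕ.+ (i ℕ.+ j))) (progression₃ i j) ⟩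
  + 2 * (+ 2 * + i + + j + + 1) * (+ 4 * + i + + 4 * + j + + 3)
    * ((+ 4) ^ i * + (2 ℕ.^ j) * fact (i ℕ.+ (i ℕ.+ j)) * progression₃ i j)
    ≡⟨ cong (+ 2 * (+ 2 * + i + + j + + 1) * (+ 4 * + i + + 4 * + j + + 3) *_) (padé-closed i j) ⟨
  + 2 * (+ 2 * + i + + j + + 1) * (+ 4 * + i + + 4 * + j + + 3)
    * (padé i j * (fact i * fact j * fact (i ℕ.+ j)))
    ≡⟨ *-assoc (+ 2 * (+ 2 * + i + + j + + 1) * (+ 4 * + i + + 4 * + j + + 3)) (padé i j) (fact i * fact j * fact (i ℕ.+ j)) ⟨
  + 2 * (+ 2 * + i + + j + + 1) * (+ 4 * + i + + 4 * + j + + 3) * padé i j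
    * (fact i * fact j * fact (i ℕ.+ j)) ∎)
  where
  open ≡-Reasoning
  fact-i+sj : fact (i ℕ.+ suc j) ≡ (+ 1 + + i + + j) * fact (i ℕ.+ j)
  fact-i+sj = trans (cong fact (ℕ.+-suc i j)) (fact-suc (i ℕ.+ j))
  fact-2i+sj : fact (i ℕ.+ (i ℕ.+ suc j)) ≡ (+ 1 + (+ i + (+ i + + j))) * fact (i ℕ.+ (i ℕ.+ j))
  fact-2i+sj = trans (cong fact (trans (cong (i ℕ.+_) (ℕ.+-suc i j)) (ℕ.+-suc i (i ℕ.+ j))))
                     (fact-suc (i ℕ.+ (i ℕ.+ j)))
  lem₁ : ∀ i j p x y z → (+ 1 + j) * (+ 1 + i + j) * p * (x * y * z)
    ≡ p * (x * ((+ 1 + j) * y) * ((+ 1 + i + j) * z))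
  lem₁ = solve-∀
  lem₂ : ∀ i j p t f g → p * (+ 2 * t) * ((+ 1 + (i + (i + j))) * f) * (g * (+ 4 * i + + 4 * j + + 3))
    ≡ + 2 * (+ 2 * i + j + + 1) * (+ 4 * i + + 4 * j + + 3) * (p * t * f * g)
  lem₂ = solve-∀

padé-sucˡ : ∀ i j → (+ 1 + + i) * (+ 1 + + i + + j) * (+ 4 * + i + + 3) * padé (suc i) j
  ≡ + 4 * (+ 2 * + i + + j + + 2) * (+ 2 * + i + + j + + 1) * (+ 4 * + i + + 4 * + j + + 3) * padé i j
padé-sucˡ i j = *-cancelʳ-≡ _ _ (fact i * fact j * fact (i ℕ.+ j))
  {{fact³-nonZero i j}} (begin
  (+ 1 + + i) * (+ 1 + + i + + j) * c * padé (suc i) j * (fact i * fact j * fact (i ℕ.+ j))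
    ≡⟨ lem₁ (+ i) (+ j) c (padé (suc i) j) (fact i) (fact j) (fact (i ℕ.+ j)) ⟩
  padé (suc i) j * ((+ 1 + + i) * fact i * fact j * ((+ 1 + + i + + j) * fact (i ℕ.+ j))) * c
    ≡⟨ cong₂ (λ x y → padé (suc i) j * (x * fact j * y) * c) (fact-suc i) (fact-suc (i ℕ.+ j)) ⟨
  padé (suc i) j * (fact (suc i) * fact j * fact (suc i ℕ.+ j)) * c
    ≡⟨ cong (_* c) (padé-closed (suc i) j) ⟩
  (+ 4) * (+ 4) ^ i * + (2 ℕ.^ j) * fact (suc i ℕ.+ (suc i ℕ.+ j)) * progression₃ (suc i) j * c
    ≡⟨ *-assoc ((+ 4) * (+ 4) ^ i * + (2 ℕ.^ j) * fact (suc i ℕ.+ (suc i ℕ.+ j))) (progression₃ (suc i) j) c ⟩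
  (+ 4) * (+ 4) ^ i * + (2 ℕ.^ j) * fact (suc i ℕ.+ (suc i ℕ.+ j)) * (progression₃ (suc i) j * c)
    ≡⟨ cong₂ (λ x y → (+ 4) * (+ 4) ^ i * + (2 ℕ.^ j) * x * y) fact-2si+j (progression₃-sucˡ i j) ⟩
  (+ 4) * (+ 4) ^ i * + (2 ℕ.^ j) * ((+ 2 + (+ i + (+ i + + j))) * ((+ 1 + (+ i + (+ i + + j))) * fact (i ℕ.+ (i ℕ.+ j))))
    * (progression₃ i j * (+ 4 * + i + + 4 * + j + + 3))
    ≡⟨ lem₂ (+ i) (+ j) ((+ 4) ^ i) (+ (2 ℕ.^ j)) (fact (i ℕ.+ (i ℕ.+ j))) (progression₃ i j) ⟩
  C * ((+ 4) ^ i * + (2 ℕ.^ j) * fact (i ℕ.+ (i ℕ.+ j)) * progression₃ i j)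
    ≡⟨ cong (C *_) (padé-closed i j) ⟨
  C * (padé i j * (fact i * fact j * fact (i ℕ.+ j)))
    ≡⟨ *-assoc C (padé i j) (fact i * fact j * fact (i ℕ.+ j)) ⟨
  C * padé i j * (fact i * fact j * fact (i ℕ.+ j)) ∎)
  where
  open ≡-Reasoning
  c C : ℤ
  c = + 4 * + i + + 3
  C = + 4 * (+ 2 * + i + + j + + 2) * (+ 2 * + i + + j + + 1) * (+ 4 * + i + + 4 * + j + + 3)
  fact-2si+j : fact (suc i ℕ.+ (suc i ℕ.+ j))
    ≡ (+ 2 + (+ i + (+ i + + j))) * ((+ 1 + (+ i + (+ i + + j))) * fact (i ℕ.+ (i ℕ.+ j)))
  fact-2si+j = trans (cong (λ x → fact (suc x)) (ℕ.+-suc i (i ℕ.+ j)))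
              (trans (fact-suc (suc (i ℕ.+ (i ℕ.+ j)))) (cong ((+ 2 + (+ i + (+ i + + j))) *_) (fact-suc (i ℕ.+ (i ℕ.+ j)))))
  lem₁ : ∀ i j c p x y z → (+ 1 + i) * (+ 1 + i + j) * c * p * (x * y * z)
    ≡ p * ((+ 1 + i) * x * y * ((+ 1 + i + j) * z)) * c
  lem₁ = solve-∀
  lem₂ : ∀ i j p t f g →
    + 4 * p * t * ((+ 2 + (i + (i + j))) * ((+ 1 + (i + (i + j))) * f)) * (g * (+ 4 * i + + 4 * j + + 3))
    ≡ + 4 * (+ 2 * i + j + + 2) * (+ 2 * i + j + + 1) * (+ 4 * i + + 4 * j + + 3) * (p * t * f * g)
  lem₂ = solve-∀

-- `padé-sucˡ` read backwards. On the boundary i = 0 it persists, since the shifted coefficient and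
-- the factor `I` vanish together.
padé-shiftˡ : ∀ i j → let I = + i ; J = + j in
  + 4 * (+ 2 * I + J) * (+ 2 * I + J - + 1) * (+ 4 * (I + J) - + 1) * shiftˡ padé i j
  ≡ I * (I + J) * (+ 4 * I - + 1) * padé i j
padé-shiftˡ zero    j = *-zeroʳ (+ 4 * (+ 2 * + 0 + + j) * (+ 2 * + 0 + + j - + 1) * (+ 4 * (+ 0 + + j) - + 1))
padé-shiftˡ (suc i) j =
  trans (lem₁ (+ i) (+ j) (padé i j)) (trans (sym (padé-sucˡ i j)) (lem₂ (+ i) (+ j) (padé (suc i) j)))
  where
  lem₁ : ∀ i j c → + 4 * (+ 2 * (+ 1 + i) + j) * (+ 2 * (+ 1 + i) + j - + 1) * (+ 4 * ((+ 1 + i) + j) - + 1) * c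
    ≡ + 4 * (+ 2 * i + j + + 2) * (+ 2 * i + j + + 1) * (+ 4 * i + + 4 * j + + 3) * c
  lem₁ = solve-∀
  lem₂ : ∀ i j c → (+ 1 + i) * (+ 1 + i + j) * (+ 4 * i + + 3) * c
    ≡ (+ 1 + i) * ((+ 1 + i) + j) * (+ 4 * (+ 1 + i) - + 1) * c
  lem₂ = solve-∀

padé-shiftʳ : ∀ i j → let I = + i ; J = + j in
  + 2 * (+ 2 * I + J) * (+ 4 * (I + J) - + 1) * shiftʳ padé i j ≡ J * (I + J) * padé i j
padé-shiftʳ i zero    = *-zeroʳ (+ 2 * (+ 2 * + i + + 0) * (+ 4 * (+ i + + 0) - + 1))
padé-shiftʳ i (suc j) =
  trans (lem₁ (+ i) (+ j) (padé i j)) (trans (sym (padé-sucʳ i j)) (lem₂ (+ i) (+ j) (padé i (suc j))))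
  where
  lem₁ : ∀ i j c → + 2 * (+ 2 * i + (+ 1 + j)) * (+ 4 * (i + (+ 1 + j)) - + 1) * c
    ≡ + 2 * (+ 2 * i + j + + 1) * (+ 4 * i + + 4 * j + + 3) * c
  lem₁ = solve-∀
  lem₂ : ∀ i j c → (+ 1 + j) * (+ 1 + i + j) * c ≡ (+ 1 + j) * (i + (+ 1 + j)) * c
  lem₂ = solve-∀

padé-shiftʳʳ : ∀ i j → let I = + i ; J = + j in
  + 2 * (+ 2 * I + J - + 1) * (+ 4 * (I + J) - + 5) * shiftʳ (shiftʳ padé) i j
  ≡ (J - + 1) * (I + J - + 1) * shiftʳ padé i j
padé-shiftʳʳ i zero    = trans (*-zeroʳ (+ 2 * (+ 2 * + i + + 0 - + 1) * (+ 4 * (+ i + + 0) - + 5)))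
  (sym (*-zeroʳ ((+ 0 - + 1) * (+ i + + 0 - + 1))))
padé-shiftʳʳ i (suc j) =
  trans (lem₁ (+ i) (+ j) (shiftʳ padé i j)) (trans (padé-shiftʳ i j) (lem₂ (+ i) (+ j) (padé i j)))
  where
  lem₁ : ∀ i j c → + 2 * (+ 2 * i + (+ 1 + j) - + 1) * (+ 4 * (i + (+ 1 + j)) - + 5) * c
    ≡ + 2 * (+ 2 * i + j) * (+ 4 * (i + j) - + 1) * c
  lem₁ = solve-∀
  lem₂ : ∀ i j c → j * (i + j) * c ≡ (+ 1 + j - + 1) * (i + (+ 1 + j) - + 1) * c
  lem₂ = solve-∀

≡+suc⇒nonZero : ∀ {x k} → x ≡ + suc k → NonZero x
≡+suc⇒nonZero refl = _

-- The recurrence of Pᵣ / r! in the variables Y and Z = (X - Y)/2: multiplication by R = Y + Z is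
-- the sum of the two shifts, and B² = - Z² is a double shift. Multiplied by `N`, which is nonzero
-- as i + j ≥ 2, every neighbour becomes a polynomial multiple of `padé i j`, and the claim reduces
-- to the identity `cubic` in I and J.
padé-recurrence : ∀ r i j → i ℕ.+ j ≡ suc (suc r) →
  (+ r + + 2) * (+ r + + 1) * padé i j
  ≡ + 8 * (+ 2 * + r + + 3) * (+ r + + 1) * (shiftˡ padé i j + shiftʳ padé i j)
    + + 4 * (+ 1 - + 16 * (+ r + + 1) * (+ r + + 1)) * shiftʳ (shiftʳ padé) i j
padé-recurrence r i j i+j≡2+r = *-cancelˡ-≡ N _ _ {{N≢0}} (begin
  N * ((R + + 2) * (R + + 1) * c)
    ≡⟨ cong (N *_) left ⟩
  N * ((I + J) * s₁ * c)
    ≡⟨ forward ⟨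
  N * (α * (a + b) + - + 4 * t * f * bb)
    ≡⟨ cong (N *_) right ⟨
  N * (+ 8 * (+ 2 * R + + 3) * (R + + 1) * (a + b) + + 4 * (+ 1 - + 16 * (R + + 1) * (R + + 1)) * bb) ∎)
  where
  open ≡-Reasoning
  I J R N a b bb c : ℤ
  I = + i
  J = + j
  R = + r
  a = shiftˡ padé i j
  b = shiftʳ padé i j
  bb = shiftʳ (shiftʳ padé) i j
  c = padé i j
  N = + 4 * (+ 2 * I + J) * (+ 2 * I + J - + 1) * (+ 4 * (I + J) - + 1)
  R≡ : R ≡ I + J - + 2
  R≡ = sym (cong (λ s → + s - + 2) i+j≡2+r)
  2i+j : + 2 * I + J ≡ + suc (suc (i ℕ.+ r))
  2i+j = trans (lem₁ I J) (trans (cong (λ s → I + + s) i+j≡2+r) (lem₂ I R))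
    where
    lem₁ : ∀ x y → + 2 * x + y ≡ x + (x + y)
    lem₁ = solve-∀
    lem₂ : ∀ x y → x + (+ 2 + y) ≡ + 2 + (x + y)
    lem₂ = solve-∀
  4s-1 : + 4 * (I + J) - + 1 ≡ + suc (6 ℕ.+ (r ℕ.+ (r ℕ.+ (r ℕ.+ r))))
  4s-1 = trans (cong (λ s → + 4 * + s - + 1) i+j≡2+r) (lem R)
    where
    lem : ∀ x → + 4 * (+ 2 + x) - + 1 ≡ + 7 + (x + (x + (x + x)))
    lem = solve-∀
  N≢0 : NonZero N
  N≢0 = i*j≢0 (+ 4 * (+ 2 * I + J) * (+ 2 * I + J - + 1)) (+ 4 * (I + J) - + 1)
    {{i*j≢0 (+ 4 * (+ 2 * I + J)) (+ 2 * I + J - + 1)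
       {{i*j≢0 (+ 4) (+ 2 * I + J) {{_}} {{≡+suc⇒nonZero 2i+j}}}} {{≡+suc⇒nonZero (cong (_- + 1) 2i+j)}}}}
    {{≡+suc⇒nonZero 4s-1}}
  s₁ u u₁ q t f α : ℤ
  s₁ = I + J - + 1
  u  = + 2 * I + J
  u₁ = + 2 * I + J - + 1
  q  = + 4 * (I + J) - + 1
  t  = + 4 * (I + J) - + 3
  f  = + 4 * (I + J) - + 5
  α  = + 8 * (+ 2 * (I + J) - + 1) * s₁
  α≡ : ∀ s → + 8 * (+ 2 * (s - + 2) + + 3) * (s - + 2 + + 1) ≡ + 8 * (+ 2 * s - + 1) * (s - + 1)
  α≡ = solve-∀
  β≡ : ∀ s → + 4 * (+ 1 - + 16 * (s - + 2 + + 1) * (s - + 2 + + 1)) ≡ - + 4 * (+ 4 * s - + 3) * (+ 4 * s - + 5)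
  β≡ = solve-∀
  κ≡ : ∀ s → (s - + 2 + + 2) * (s - + 2 + + 1) ≡ s * (s - + 1)
  κ≡ = solve-∀
  combine : ∀ α u u₁ q t f a b bb →
    + 4 * u * u₁ * q * (α * (a + b) + - + 4 * t * f * bb)
    ≡ α * (+ 4 * u * u₁ * q * a + + 2 * u₁ * (+ 2 * u * q * b)) - + 8 * t * u * q * (+ 2 * u₁ * f * bb)
  combine = solve-∀
  regroup : ∀ α t u q x j₁ s₁ b →
    α * x - + 8 * t * u * q * (j₁ * s₁ * b) ≡ α * x - + 4 * t * j₁ * s₁ * (+ 2 * u * q * b)
  regroup = solve-∀
  factor : ∀ s s₁ γ i i₄ u₁ j t j₁ c →
    + 8 * γ * s₁ * (i * s * i₄ * c + + 2 * u₁ * (j * s * c)) - + 4 * t * j₁ * s₁ * (j * s * c)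
    ≡ (+ 2 * γ * (i * i₄ + + 2 * u₁ * j) - t * j₁ * j) * (+ 4 * s * s₁ * c)
  factor = solve-∀
  cubic : ∀ I J → + 2 * (+ 2 * (I + J) - + 1) * (I * (+ 4 * I - + 1) + + 2 * (+ 2 * I + J - + 1) * J)
      - (+ 4 * (I + J) - + 3) * (J - + 1) * J
    ≡ (+ 2 * I + J) * (+ 2 * I + J - + 1) * (+ 4 * (I + J) - + 1)
  cubic = solve-∀
  unfactor : ∀ u u₁ q s s₁ c → u * u₁ * q * (+ 4 * s * s₁ * c) ≡ + 4 * u * u₁ * q * (s * s₁ * c)
  unfactor = solve-∀
  x : ℤ
  x = I * (I + J) * (+ 4 * I - + 1) * c + + 2 * u₁ * (J * (I + J) * c)
  right : + 8 * (+ 2 * R + + 3) * (R + + 1) * (a + b) + + 4 * (+ 1 - + 16 * (R + + 1) * (R + + 1)) * bb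
    ≡ α * (a + b) + - + 4 * t * f * bb
  right = cong₂ (λ x y → x * (a + b) + y * bb)
    (trans (cong (λ z → + 8 * (+ 2 * z + + 3) * (z + + 1)) R≡) (α≡ (I + J)))
    (trans (cong (λ z → + 4 * (+ 1 - + 16 * (z + + 1) * (z + + 1))) R≡) (β≡ (I + J)))
  left : (R + + 2) * (R + + 1) * c ≡ (I + J) * s₁ * c
  left = cong (_* c) (trans (cong (λ z → (z + + 2) * (z + + 1)) R≡) (κ≡ (I + J)))
  forward : N * (α * (a + b) + - + 4 * t * f * bb) ≡ N * ((I + J) * s₁ * c)
  forward = begin
    N * (α * (a + b) + - + 4 * t * f * bb)
      ≡⟨ combine α u u₁ q t f a b bb ⟩
    α * (+ 4 * u * u₁ * q * a + + 2 * u₁ * (+ 2 * u * q * b)) - + 8 * t * u * q * (+ 2 * u₁ * f * bb)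
      ≡⟨ cong₂ (λ x y → α * x - + 8 * t * u * q * y)
          (cong₂ (λ x y → x + + 2 * u₁ * y) (padé-shiftˡ i j) (padé-shiftʳ i j))
          (padé-shiftʳʳ i j) ⟩
    α * x - + 8 * t * u * q * ((J - + 1) * s₁ * b)
      ≡⟨ regroup α t u q x (J - + 1) s₁ b ⟩
    α * x - + 4 * t * (J - + 1) * s₁ * (+ 2 * u * q * b)
      ≡⟨ cong (λ y → α * x - + 4 * t * (J - + 1) * s₁ * y) (padé-shiftʳ i j) ⟩
    α * x - + 4 * t * (J - + 1) * s₁ * (J * (I + J) * c)
      ≡⟨ factor (I + J) s₁ (+ 2 * (I + J) - + 1) I (+ 4 * I - + 1) u₁ J t (J - + 1) c ⟩
    (+ 2 * (+ 2 * (I + J) - + 1) * (I * (+ 4 * I - + 1) + + 2 * u₁ * J) - t * (J - + 1) * J)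
      * (+ 4 * (I + J) * s₁ * c)
      ≡⟨ cong (_* (+ 4 * (I + J) * s₁ * c)) (cubic I J) ⟩
    u * u₁ * q * (+ 4 * (I + J) * s₁ * c)
      ≡⟨ unfactor u u₁ q (I + J) s₁ c ⟩
    N * ((I + J) * s₁ * c) ∎

-- Divisibility of L by r! and its zeros

module _ (R B n m : ℤ) where

  -- moment i j = Im (x (R - iB)ⁱ (iB)ʲ)
  moment : ℕ → ℕ → ℤ
  moment zero    zero          = n
  moment zero    (suc zero)    = B * m
  moment zero    (suc (suc j)) = - (B * B) * moment zero j
  moment (suc i) j             = R * moment i j - moment i (suc j)

  -- From (R - iB) + iB = R.
  moment-step : ∀ i j → moment (suc i) j + moment i (suc j) ≡ R * moment i j
  moment-step i j = lem (R * moment i j) (moment i (suc j))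
    where
    lem : ∀ x y → x - y + y ≡ x
    lem = solve-∀

  -- From (iB)² = - B².
  moment-square : ∀ i j → moment i (suc (suc j)) ≡ - (B * B) * moment i j
  moment-square zero    j = refl
  moment-square (suc i) j =
    trans (cong₂ (λ x y → R * x - y) (moment-square i j) (moment-square i (suc j)))
          (lem R (B * B) (moment i j) (moment i (suc j)))
    where
    lem : ∀ R b x y → R * (- b * x) - - b * y ≡ - b * (R * x - y)
    lem = solve-∀

  ℓ : ℕ → ℤ
  ℓ r = diagonalSum r (λ i j → padé i j * moment i j)

  ℓ-recurrence : ∀ r → (+ r + + 2) * (+ r + + 1) * ℓ (suc (suc r))
    ≡ + 8 * (+ 2 * + r + + 3) * (+ r + + 1) * (R * ℓ (suc r))
      + + 4 * (+ 1 - + 16 * (+ r + + 1) * (+ r + + 1)) * (- (B * B) * ℓ r)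
  ℓ-recurrence r = begin
    κ * ℓ (suc (suc r))
      ≡⟨ diagonalSum-* (suc (suc r)) κ (λ i j → padé i j * moment i j) ⟨
    diagonalSum (suc (suc r)) (λ i j → κ * (padé i j * moment i j))
      ≡⟨ diagonalSum-cong (suc (suc r)) pointwise ⟩
    diagonalSum (suc (suc r)) (λ i j → α * (pˡ i j + pʳ i j) + β * pʳʳ i j)
      ≡⟨ diagonalSum-+ (suc (suc r)) (λ i j → α * (pˡ i j + pʳ i j)) (λ i j → β * pʳʳ i j) ⟩
    diagonalSum (suc (suc r)) (λ i j → α * (pˡ i j + pʳ i j)) + diagonalSum (suc (suc r)) (λ i j → β * pʳʳ i j)
      ≡⟨ cong₂ _+_ (trans (diagonalSum-* (suc (suc r)) α (λ i j → pˡ i j + pʳ i j)) (cong (α *_) first))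
                   (trans (diagonalSum-* (suc (suc r)) β pʳʳ) (cong (β *_) second)) ⟩
    α * (R * ℓ (suc r)) + β * (- (B * B) * ℓ r) ∎
    where
    open ≡-Reasoning
    κ α β : ℤ
    κ = (+ r + + 2) * (+ r + + 1)
    α = + 8 * (+ 2 * + r + + 3) * (+ r + + 1)
    β = + 4 * (+ 1 - + 16 * (+ r + + 1) * (+ r + + 1))
    pˡ pʳ pʳʳ : ℕ → ℕ → ℤ
    pˡ i j = shiftˡ padé i j * moment i j
    pʳ i j = shiftʳ padé i j * moment i j
    pʳʳ i j = shiftʳ (shiftʳ padé) i j * moment i j
    pointwise : ∀ i j → i ℕ.+ j ≡ suc (suc r) → κ * (padé i j * moment i j) ≡ α * (pˡ i j + pʳ i j) + β * pʳʳ i j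
    pointwise i j e = trans (sym (*-assoc κ (padé i j) (moment i j)))
      (trans (cong (_* moment i j) (padé-recurrence r i j e))
             (lem α β (shiftˡ padé i j) (shiftʳ padé i j) (shiftʳ (shiftʳ padé) i j) (moment i j)))
      where
      lem : ∀ α β a b c v → (α * (a + b) + β * c) * v ≡ α * (a * v + b * v) + β * (c * v)
      lem = solve-∀
    first : diagonalSum (suc (suc r)) (λ i j → pˡ i j + pʳ i j) ≡ R * ℓ (suc r)
    first = begin
      diagonalSum (suc (suc r)) (λ i j → pˡ i j + pʳ i j)
        ≡⟨ diagonalSum-+ (suc (suc r)) pˡ pʳ ⟩
      diagonalSum (suc (suc r)) pˡ + diagonalSum (suc (suc r)) pʳ
        ≡⟨ cong₂ _+_ (diagonalSum-shiftˡ (suc r) padé moment) (diagonalSum-shiftʳ (suc r) padé moment) ⟨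
      diagonalSum (suc r) (λ i j → padé i j * moment (suc i) j) + diagonalSum (suc r) (λ i j → padé i j * moment i (suc j))
        ≡⟨ diagonalSum-+ (suc r) (λ i j → padé i j * moment (suc i) j) (λ i j → padé i j * moment i (suc j)) ⟨
      diagonalSum (suc r) (λ i j → padé i j * moment (suc i) j + padé i j * moment i (suc j))
        ≡⟨ diagonalSum-cong (suc r) (λ i j _ → trans (sym (*-distribˡ-+ (padé i j) (moment (suc i) j) (moment i (suc j))))
             (trans (cong (padé i j *_) (moment-step i j)) (lem (padé i j) R (moment i j)))) ⟩
      diagonalSum (suc r) (λ i j → R * (padé i j * moment i j))
        ≡⟨ diagonalSum-* (suc r) R (λ i j → padé i j * moment i j) ⟩
      R * ℓ (suc r) ∎
      where
      lem : ∀ p q v → p * (q * v) ≡ q * (p * v)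
      lem = solve-∀
    second : diagonalSum (suc (suc r)) pʳʳ ≡ - (B * B) * ℓ r
    second = begin
      diagonalSum (suc (suc r)) pʳʳ
        ≡⟨ diagonalSum-shiftʳ (suc r) (shiftʳ padé) moment ⟨
      diagonalSum (suc r) (λ i j → shiftʳ padé i j * moment i (suc j))
        ≡⟨ diagonalSum-shiftʳ r padé (λ i j → moment i (suc j)) ⟨
      diagonalSum r (λ i j → padé i j * moment i (suc (suc j)))
        ≡⟨ diagonalSum-cong r (λ i j _ → trans (cong (padé i j *_) (moment-square i j)) (lem (padé i j) (- (B * B)) (moment i j))) ⟩
      diagonalSum r (λ i j → - (B * B) * (padé i j * moment i j))
        ≡⟨ diagonalSum-* r (- (B * B)) (λ i j → padé i j * moment i j) ⟩
      - (B * B) * ℓ r ∎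
      where
      lem : ∀ p q v → p * (q * v) ≡ q * (p * v)
      lem = solve-∀

  -- `L` is defined by its recurrence, `ℓ` by integral coefficients; multiplied by r!, the
  -- recurrence of `ℓ` becomes that of `L`. Hence r! divides L.
  L≡r!ℓ : ∀ r → L R B n m r ≡ fact r * ℓ r
  L≡r!ℓ zero          = lem n
    where
    lem : ∀ n → n ≡ + 1 * (+ 1 * n)
    lem = solve-∀
  L≡r!ℓ (suc zero)    = lem R B n m
    where
    lem : ∀ R B n m → + 8 * R * n - + 2 * B * m ≡ + 1 * (+ 6 * (B * m) + + 8 * (R * n - B * m))
    lem = solve-∀
  L≡r!ℓ (suc (suc r)) = begin
    α * R * L R B n m (suc r) + β * (B * B) * L R B n m r
      ≡⟨ cong₂ (λ x y → α * R * x + β * (B * B) * y)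
           (trans (L≡r!ℓ (suc r)) (cong (_* ℓ (suc r)) (fact-suc r))) (L≡r!ℓ r) ⟩
    α * R * ((+ 1 + + r) * fact r * ℓ (suc r)) + β * (B * B) * (fact r * ℓ r)
      ≡⟨ lem₁ (+ r) R (B * B) (fact r) (ℓ (suc r)) (ℓ r) ⟩
    fact r * (+ 8 * (+ 2 * + r + + 3) * (+ r + + 1) * (R * ℓ (suc r))
      + + 4 * (+ 1 - + 16 * (+ r + + 1) * (+ r + + 1)) * (- (B * B) * ℓ r))
      ≡⟨ cong (fact r *_) (ℓ-recurrence r) ⟨
    fact r * ((+ r + + 2) * (+ r + + 1) * ℓ (suc (suc r)))
      ≡⟨ lem₂ (+ r) (fact r) (ℓ (suc (suc r))) ⟩
    (+ 2 + + r) * ((+ 1 + + r) * fact r) * ℓ (suc (suc r))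
      ≡⟨ cong (_* ℓ (suc (suc r))) (trans (fact-suc (suc r)) (cong ((+ 2 + + r) *_) (fact-suc r))) ⟨
    fact (suc (suc r)) * ℓ (suc (suc r)) ∎
    where
    open ≡-Reasoning
    α β : ℤ
    α = + 8 * (+ 2 * + r + + 3)
    β = + 4 * (+ 16 * (+ r + + 1) * (+ r + + 1) - + 1)
    lem₁ : ∀ r R b f x y →
      + 8 * (+ 2 * r + + 3) * R * ((+ 1 + r) * f * x) + + 4 * (+ 16 * (r + + 1) * (r + + 1) - + 1) * b * (f * y)
      ≡ f * (+ 8 * (+ 2 * r + + 3) * (r + + 1) * (R * x) + + 4 * (+ 1 - + 16 * (r + + 1) * (r + + 1)) * (- b * y))
    lem₁ = solve-∀
    lem₂ : ∀ r f x → f * ((r + + 2) * (r + + 1) * x) ≡ (+ 2 + r) * ((+ 1 + r) * f) * x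
    lem₂ = solve-∀

  -- A nonzero integer `ℓ r` has absolute value at least 1. The r! gained here cancels the one in
  -- every upper bound.
  r!≤∣L∣ : ∀ r → L R B n m r ≢ + 0 → r ! ℕ.≤ ∣ L R B n m r ∣
  r!≤∣L∣ r L≢0 = ℕ.∣⇒≤ {{ℕ.≢-nonZero (λ e → L≢0 (∣i∣≡0⇒i≡0 e))}}
    (ℕ.divides ∣ ℓ r ∣ (trans (cong ∣_∣ (L≡r!ℓ r)) (trans (abs-* (fact r) (ℓ r)) (ℕ.*-comm (r !) ∣ ℓ r ∣))))

  -- The recurrence can be run backwards down to L₀ = n, because the coefficient of the older term
  -- contains (4r + 3)(4r + 5)B² and does not vanish.
  L-consecutive-zeros : B ≢ + 0 → ∀ r → L R B n m r ≡ + 0 → L R B n m (suc r) ≡ + 0 → n ≡ + 0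
  L-consecutive-zeros B≢0 zero    e₀ e₁ = e₀
  L-consecutive-zeros B≢0 (suc r) e₀ e₁ = L-consecutive-zeros B≢0 r previous e₀
    where
    β : ℤ
    β = + 4 * (+ 16 * (+ r + + 1) * (+ r + + 1) - + 1) * (B * B)
    factor : ∀ r → + 16 * (r + + 1) * (r + + 1) - + 1 ≡ (+ 3 + + 4 * r) * (+ 5 + + 4 * r)
    factor = solve-∀
    β≢0 : NonZero β
    β≢0 = i*j≢0 (+ 4 * (+ 16 * (+ r + + 1) * (+ r + + 1) - + 1)) (B * B)
      {{i*j≢0 (+ 4) (+ 16 * (+ r + + 1) * (+ r + + 1) - + 1) {{_}}
         {{subst NonZero (sym (factor (+ r)))
             (i*j≢0 (+ 3 + + 4 * + r) (+ 5 + + 4 * + r)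
               {{≡+suc⇒nonZero (sym (pos-+* 3 4 r))}} {{≡+suc⇒nonZero (sym (pos-+* 5 4 r))}})}}}}
      {{i*j≢0 B B {{≢-nonZero B≢0}} {{≢-nonZero B≢0}}}}
    previous : L R B n m r ≡ + 0
    previous = *-cancelˡ-≡ β _ _ {{β≢0}}
      (trans (sym (+-identityˡ (β * L R B n m r)))
      (trans (cong (_+ β * L R B n m r) (trans (sym (*-zeroʳ α)) (cong (α *_) (sym e₀))))
      (trans e₁ (sym (*-zeroʳ β)))))
      where
      α : ℤ
      α = + 8 * (+ 2 * + r + + 3) * R

-- The remainder of the approximation

oddZ : ℕ → ℤ
oddZ n = + oddProduct n

oddZ-suc : ∀ n → oddZ (suc n) ≡ oddZ n * (+ 2 * + n + + 1)
oddZ-suc n = trans (pos-* (oddProduct n) (2 ℕ.* n ℕ.+ 1))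
  (cong (λ x → oddZ n * (x + + 1)) (pos-* 2 n))

oddRange : ℕ → ℕ → ℕ
oddRange n zero    = 1
oddRange n (suc i) = oddRange n i ℕ.* (2 ℕ.* (n ℕ.+ i) ℕ.+ 1)

oddProduct-oddRange : ∀ n i → oddProduct n ℕ.* oddRange n i ≡ oddProduct (n ℕ.+ i)
oddProduct-oddRange n zero    = trans (ℕ.*-identityʳ (oddProduct n)) (cong oddProduct (sym (ℕ.+-identityʳ n)))
oddProduct-oddRange n (suc i) = trans (sym (ℕ.*-assoc (oddProduct n) (oddRange n i) _))
  (trans (cong (ℕ._* (2 ℕ.* (n ℕ.+ i) ℕ.+ 1)) (oddProduct-oddRange n i))
         (cong oddProduct (sym (ℕ.+-suc n i))))

oddProduct≢0 : ∀ n → ℕ.NonZero (oddProduct n)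
oddProduct≢0 n = ℕ.≢-nonZero (λ e → ℕ.1+n≢0 (trans (trans (ℕ.+-comm 1 _) (sym (proj₂ (oddProduct-odd n)))) e))

-- Chosen so that `oddProduct (middle i k)` is (2i + 4k + 1)!!. Likewise `top` below yields (4r +
-- 1)!! for r = i + k.
middle : ℕ → ℕ → ℕ
middle i k = i ℕ.+ (k ℕ.+ k) ℕ.+ 1

-- This is (2k - 1)!! (4r + 1)!! / (2i + 4k + 1)!! with r = i + k; as a final segment of a double
-- factorial the quotient is visibly an integer.
remainderCoeff : ℕ → ℕ → ℕ
remainderCoeff i k = oddProduct k ℕ.* oddRange (middle i k) i

-- remainder i k is the coefficient of pⁱ qᵏ in Wᵣ, r = i + k, where
-- Im (x Pᵣ(x⁴ , x̄⁴)) = (-8)ʳ n²ʳ⁺¹ Wᵣ(m² , -n²) for x = m + in.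
remainder : ℕ → ℕ → ℤ
remainder i k = + (choose i k ℕ.* remainderCoeff i k)

scale₃ : ℕ → ℕ → ℤ
scale₃ i k = fact i * fact k * oddZ (middle i k)

scale₃-nonZero : ∀ i k → NonZero (scale₃ i k)
scale₃-nonZero i k = i*j≢0 (fact i * fact k) (oddZ (middle i k))
  {{i*j≢0 (fact i) (fact k) {{fact-nonZero {i}}} {{fact-nonZero {k}}}}} {{oddProduct≢0 (middle i k)}}

top : ℕ → ℕ → ℕ
top i k = i ℕ.+ k ℕ.+ (i ℕ.+ k) ℕ.+ 1

middle+i : ∀ i k → middle i k ℕ.+ i ≡ top i k
middle+i = lem
  where
  lem : ∀ i k → i ℕ.+ (k ℕ.+ k) ℕ.+ 1 ℕ.+ i ≡ i ℕ.+ k ℕ.+ (i ℕ.+ k) ℕ.+ 1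
  lem = ℕ-solve-∀

remainder-closed : ∀ i k → remainder i k * scale₃ i k ≡ fact (i ℕ.+ k) * (oddZ k * oddZ (top i k))
remainder-closed i k = begin
  remainder i k * (fact i * fact k * oddZ (middle i k))
    ≡⟨ cong₂ (λ x y → x * (y * oddZ (middle i k))) (pos-* (choose i k) (remainderCoeff i k)) (sym (pos-* (i !) (k !))) ⟩
  + choose i k * + remainderCoeff i k * (+ (i ! ℕ.* k !) * oddZ (middle i k))
    ≡⟨ cong (λ x → + choose i k * x * (+ (i ! ℕ.* k !) * oddZ (middle i k))) (pos-* (oddProduct k) (oddRange (middle i k) i)) ⟩
  + choose i k * (oddZ k * + oddRange (middle i k) i) * (+ (i ! ℕ.* k !) * oddZ (middle i k))
    ≡⟨ lem (+ choose i k) (oddZ k) (+ oddRange (middle i k) i) (+ (i ! ℕ.* k !)) (oddZ (middle i k)) ⟩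
  + choose i k * + (i ! ℕ.* k !) * (oddZ k * (oddZ (middle i k) * + oddRange (middle i k) i))
    ≡⟨ cong₂ (λ x y → x * (oddZ k * y))
         (trans (sym (pos-* (choose i k) (i ! ℕ.* k !))) (cong +_ (choose-! i k)))
         (trans (sym (pos-* (oddProduct (middle i k)) (oddRange (middle i k) i)))
                (cong +_ (trans (oddProduct-oddRange (middle i k) i) (cong oddProduct (middle+i i k))))) ⟩
  fact (i ℕ.+ k) * (oddZ k * oddZ (top i k)) ∎
  where
  open ≡-Reasoning
  lem : ∀ c o g f e → c * (o * g) * (f * e) ≡ c * f * (o * (e * g))
  lem = solve-∀

-- Passing from degree s - 1 to s multiplies r! by s and (4r + 1)!! by (4s - 1)(4s + 1).
shiftFactor : ℤ → ℤ
shiftFactor s = s * (+ 16 * (s * s) - + 1)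

oddZ-top : ∀ i k → let s = + i + + k in
  (+ 1 + s) * oddZ (suc (suc (top i k))) ≡ shiftFactor (+ 1 + s) * oddZ (top i k)
oddZ-top i k = trans (cong ((+ 1 + (+ i + + k)) *_)
    (trans (oddZ-suc (suc (top i k))) (cong (_* (+ 2 * + suc (top i k) + + 1)) (oddZ-suc (top i k)))))
  (lem (+ i + + k) (oddZ (top i k)))
  where
  lem : ∀ s o → (+ 1 + s) * (o * (+ 2 * (s + s + + 1) + + 1) * (+ 2 * (+ 1 + (s + s + + 1)) + + 1))
    ≡ (+ 1 + s) * (+ 16 * ((+ 1 + s) * (+ 1 + s)) - + 1) * o
  lem = solve-∀

remainder-sucˡ : ∀ i k → shiftFactor (+ 1 + (+ i + + k)) * remainder i k
  ≡ (+ 1 + + i) * (+ 2 * + i + + 4 * + k + + 3) * remainder (suc i) k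
remainder-sucˡ i k = *-cancelʳ-≡ _ _ (scale₃ i k) {{scale₃-nonZero i k}} (begin
  P * remainder i k * scale₃ i k
    ≡⟨ *-assoc P (remainder i k) (scale₃ i k) ⟩
  P * (remainder i k * scale₃ i k)
    ≡⟨ cong (P *_) (remainder-closed i k) ⟩
  P * (fact (i ℕ.+ k) * (oddZ k * oddZ (top i k)))
    ≡⟨ lem₁ P (fact (i ℕ.+ k)) (oddZ k) (oddZ (top i k)) ⟩
  fact (i ℕ.+ k) * (oddZ k * (P * oddZ (top i k)))
    ≡⟨ cong (λ x → fact (i ℕ.+ k) * (oddZ k * x)) (oddZ-top i k) ⟨
  fact (i ℕ.+ k) * (oddZ k * ((+ 1 + (+ i + + k)) * oddZ (suc (suc (top i k)))))
    ≡⟨ lem₂ (+ 1 + (+ i + + k)) (fact (i ℕ.+ k)) (oddZ k) (oddZ (suc (suc (top i k)))) ⟩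
  (+ 1 + (+ i + + k)) * fact (i ℕ.+ k) * (oddZ k * oddZ (suc (suc (top i k))))
    ≡⟨ cong₂ (λ x y → x * (oddZ k * oddZ y)) (fact-suc (i ℕ.+ k)) (top-suc i k) ⟨
  fact (suc i ℕ.+ k) * (oddZ k * oddZ (top (suc i) k))
    ≡⟨ remainder-closed (suc i) k ⟨
  remainder (suc i) k * (fact (suc i) * fact k * oddZ (suc (middle i k)))
    ≡⟨ cong₂ (λ x y → remainder (suc i) k * (x * fact k * y)) (fact-suc i) (oddZ-suc (middle i k)) ⟩
  remainder (suc i) k * ((+ 1 + + i) * fact i * fact k * (oddZ (middle i k) * (+ 2 * (+ i + (+ k + + k) + + 1) + + 1)))
    ≡⟨ lem₃ (+ i) (+ k) (remainder (suc i) k) (fact i) (fact k) (oddZ (middle i k)) ⟩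
  (+ 1 + + i) * (+ 2 * + i + + 4 * + k + + 3) * remainder (suc i) k * scale₃ i k ∎)
  where
  open ≡-Reasoning
  P : ℤ
  P = shiftFactor (+ 1 + (+ i + + k))
  top-suc : ∀ i k → top (suc i) k ≡ suc (suc (top i k))
  top-suc i k = cong (λ x → suc (x ℕ.+ 1)) (ℕ.+-suc (i ℕ.+ k) (i ℕ.+ k))
  lem₁ : ∀ p f o t → p * (f * (o * t)) ≡ f * (o * (p * t))
  lem₁ = solve-∀
  lem₂ : ∀ p f o t → f * (o * (p * t)) ≡ p * f * (o * t)
  lem₂ = solve-∀
  lem₃ : ∀ i k w f g o → w * ((+ 1 + i) * f * g * (o * (+ 2 * (i + (k + k) + + 1) + + 1)))
    ≡ (+ 1 + i) * (+ 2 * i + + 4 * k + + 3) * w * (f * g * o)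
  lem₃ = solve-∀

remainder-sucʳ : ∀ i k → shiftFactor (+ 1 + (+ i + + k)) * (+ 2 * + k + + 1) * remainder i k
  ≡ (+ 1 + + k) * (+ 2 * + i + + 4 * + k + + 5) * (+ 2 * + i + + 4 * + k + + 3) * remainder i (suc k)
remainder-sucʳ i k = *-cancelʳ-≡ _ _ (scale₃ i k) {{scale₃-nonZero i k}} (begin
  P * o * remainder i k * scale₃ i k
    ≡⟨ *-assoc (P * o) (remainder i k) (scale₃ i k) ⟩
  P * o * (remainder i k * scale₃ i k)
    ≡⟨ cong (P * o *_) (remainder-closed i k) ⟩
  P * o * (fact (i ℕ.+ k) * (oddZ k * oddZ (top i k)))
    ≡⟨ lem₁ P o (fact (i ℕ.+ k)) (oddZ k) (oddZ (top i k)) ⟩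
  fact (i ℕ.+ k) * (oddZ k * o * (P * oddZ (top i k)))
    ≡⟨ cong₂ (λ x y → fact (i ℕ.+ k) * (x * y)) (oddZ-suc k) (oddZ-top i k) ⟨
  fact (i ℕ.+ k) * (oddZ (suc k) * ((+ 1 + (+ i + + k)) * oddZ (suc (suc (top i k)))))
    ≡⟨ lem₂ (+ 1 + (+ i + + k)) (fact (i ℕ.+ k)) (oddZ (suc k)) (oddZ (suc (suc (top i k)))) ⟩
  (+ 1 + (+ i + + k)) * fact (i ℕ.+ k) * (oddZ (suc k) * oddZ (suc (suc (top i k))))
    ≡⟨ cong₂ (λ x y → x * (oddZ (suc k) * oddZ y))
         (trans (cong fact (ℕ.+-suc i k)) (fact-suc (i ℕ.+ k))) (top-suc i k) ⟨
  fact (i ℕ.+ suc k) * (oddZ (suc k) * oddZ (top i (suc k)))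
    ≡⟨ remainder-closed i (suc k) ⟨
  remainder i (suc k) * (fact i * fact (suc k) * oddZ (middle i (suc k)))
    ≡⟨ cong₂ (λ x y → remainder i (suc k) * (fact i * x * y)) (fact-suc k)
         (trans (cong oddZ (middle-suc i k)) (trans (oddZ-suc (suc (middle i k)))
           (cong (_* (+ 2 * (+ 1 + (+ i + (+ k + + k) + + 1)) + + 1)) (oddZ-suc (middle i k))))) ⟩
  remainder i (suc k) * (fact i * ((+ 1 + + k) * fact k)
    * (oddZ (middle i k) * (+ 2 * (+ i + (+ k + + k) + + 1) + + 1) * (+ 2 * (+ 1 + (+ i + (+ k + + k) + + 1)) + + 1)))
    ≡⟨ lem₃ (+ i) (+ k) (remainder i (suc k)) (fact i) (fact k) (oddZ (middle i k)) ⟩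
  (+ 1 + + k) * (+ 2 * + i + + 4 * + k + + 5) * (+ 2 * + i + + 4 * + k + + 3) * remainder i (suc k) * scale₃ i k ∎)
  where
  open ≡-Reasoning
  P o : ℤ
  P = shiftFactor (+ 1 + (+ i + + k))
  o = + 2 * + k + + 1
  top-suc : ∀ i k → top i (suc k) ≡ suc (suc (top i k))
  top-suc = lem
    where
    lem : ∀ i k → i ℕ.+ suc k ℕ.+ (i ℕ.+ suc k) ℕ.+ 1 ≡ suc (suc (i ℕ.+ k ℕ.+ (i ℕ.+ k) ℕ.+ 1))
    lem = ℕ-solve-∀
  middle-suc : ∀ i k → middle i (suc k) ≡ suc (suc (middle i k))
  middle-suc = lem
    where
    lem : ∀ i k → i ℕ.+ (suc k ℕ.+ suc k) ℕ.+ 1 ≡ suc (suc (i ℕ.+ (k ℕ.+ k) ℕ.+ 1))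
    lem = ℕ-solve-∀
  lem₁ : ∀ p o f q t → p * o * (f * (q * t)) ≡ f * (q * o * (p * t))
  lem₁ = solve-∀
  lem₂ : ∀ p f o t → f * (o * (p * t)) ≡ p * f * (o * t)
  lem₂ = solve-∀
  lem₃ : ∀ i k w f g o → w * (f * ((+ 1 + k) * g) * (o * (+ 2 * (i + (k + k) + + 1) + + 1) * (+ 2 * (+ 1 + (i + (k + k) + + 1)) + + 1)))
    ≡ (+ 1 + k) * (+ 2 * i + + 4 * k + + 5) * (+ 2 * i + + 4 * k + + 3) * w * (f * g * o)
  lem₃ = solve-∀

cofactor : ℤ → ℤ → ℤ
cofactor I K = K * (+ 2 * I + + 4 * K + + 1) * (+ 2 * I + + 4 * K - + 1)

both-zero : ∀ x y → x * + 0 ≡ y * + 0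
both-zero x y = trans (*-zeroʳ x) (sym (*-zeroʳ y))

rem-shiftˡ : ∀ i k → shiftFactor (+ i + + k) * shiftˡ remainder i k
  ≡ + i * (+ 2 * + i + + 4 * + k + + 1) * remainder i k
rem-shiftˡ zero    k = *-zeroʳ (shiftFactor (+ 0 + + k))
rem-shiftˡ (suc i) k = trans (remainder-sucˡ i k) (lem (+ i) (+ k) (remainder (suc i) k))
  where
  lem : ∀ i k w → (+ 1 + i) * (+ 2 * i + + 4 * k + + 3) * w ≡ (+ 1 + i) * (+ 2 * (+ 1 + i) + + 4 * k + + 1) * w
  lem = solve-∀

rem-shiftʳ : ∀ i k → shiftFactor (+ i + + k) * (+ 2 * + k - + 1) * shiftʳ remainder i k
  ≡ cofactor (+ i) (+ k) * remainder i k
rem-shiftʳ i zero    = *-zeroʳ (shiftFactor (+ i + + 0) * (+ 2 * + 0 - + 1))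
rem-shiftʳ i (suc k) = trans (lem₁ (+ i) (+ k) (remainder i k))
  (trans (remainder-sucʳ i k) (lem₂ (+ i) (+ k) (remainder i (suc k))))
  where
  lem₁ : ∀ i k w → (i + (+ 1 + k)) * (+ 16 * ((i + (+ 1 + k)) * (i + (+ 1 + k))) - + 1) * (+ 2 * (+ 1 + k) - + 1) * w
    ≡ (+ 1 + (i + k)) * (+ 16 * ((+ 1 + (i + k)) * (+ 1 + (i + k))) - + 1) * (+ 2 * k + + 1) * w
  lem₁ = solve-∀
  lem₂ : ∀ i k w → (+ 1 + k) * (+ 2 * i + + 4 * k + + 5) * (+ 2 * i + + 4 * k + + 3) * w
    ≡ (+ 1 + k) * (+ 2 * i + + 4 * (+ 1 + k) + + 1) * (+ 2 * i + + 4 * (+ 1 + k) - + 1) * w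
  lem₂ = solve-∀

-- Stated with i - 1 in the integers so that no case split is left for later; at i = 0 both
-- coefficients are zero. The further shifts below follow the same pattern.
rem-shiftˡˡ : ∀ i k → let I = + i - + 1 ; K = + k in
  shiftFactor (I + K) * shiftˡ (shiftˡ remainder) i k ≡ I * (+ 2 * I + + 4 * K + + 1) * shiftˡ remainder i k
rem-shiftˡˡ zero    k = both-zero (shiftFactor (- + 1 + + k)) (- + 1 * (+ 2 * - + 1 + + 4 * + k + + 1))
rem-shiftˡˡ (suc i) k = rem-shiftˡ i k

rem-shiftˡˡˡ : ∀ i k → let I = + i - + 1 - + 1 ; K = + k in
  shiftFactor (I + K) * shiftˡ (shiftˡ (shiftˡ remainder)) i k
  ≡ I * (+ 2 * I + + 4 * K + + 1) * shiftˡ (shiftˡ remainder) i k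
rem-shiftˡˡˡ zero    k = both-zero (shiftFactor (- + 2 + + k)) (- + 2 * (+ 2 * - + 2 + + 4 * + k + + 1))
rem-shiftˡˡˡ (suc i) k = rem-shiftˡˡ i k

shiftʳ-shiftˡ-suc : ∀ f i k → shiftʳ (shiftˡ f) (suc i) k ≡ shiftʳ f i k
shiftʳ-shiftˡ-suc f i zero    = refl
shiftʳ-shiftˡ-suc f i (suc k) = refl

shiftʳ-shiftˡ-zero : ∀ f k → shiftʳ (shiftˡ f) zero k ≡ + 0
shiftʳ-shiftˡ-zero f zero    = refl
shiftʳ-shiftˡ-zero f (suc k) = refl

rem-shiftʳˡ : ∀ i k → let I = + i - + 1 ; K = + k in
  shiftFactor (I + K) * (+ 2 * K - + 1) * shiftʳ (shiftˡ remainder) i k ≡ cofactor I K * shiftˡ remainder i k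
rem-shiftʳˡ zero    k = trans (cong (shiftFactor (- + 1 + + k) * (+ 2 * + k - + 1) *_) (shiftʳ-shiftˡ-zero remainder k))
  (both-zero (shiftFactor (- + 1 + + k) * (+ 2 * + k - + 1)) (cofactor (- + 1) (+ k)))
rem-shiftʳˡ (suc i) k =
  trans (cong (shiftFactor (+ i + + k) * (+ 2 * + k - + 1) *_) (shiftʳ-shiftˡ-suc remainder i k)) (rem-shiftʳ i k)

rem-shiftʳˡˡ : ∀ i k → let I = + i - + 1 - + 1 ; K = + k in
  shiftFactor (I + K) * (+ 2 * K - + 1) * shiftʳ (shiftˡ (shiftˡ remainder)) i k
  ≡ cofactor I K * shiftˡ (shiftˡ remainder) i k
rem-shiftʳˡˡ zero    k = trans (cong (shiftFactor (- + 2 + + k) * (+ 2 * + k - + 1) *_) (shiftʳ-shiftˡ-zero (shiftˡ remainder) k))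
  (both-zero (shiftFactor (- + 2 + + k) * (+ 2 * + k - + 1)) (cofactor (- + 2) (+ k)))
rem-shiftʳˡˡ (suc i) k =
  trans (cong (shiftFactor (+ i - + 1 + + k) * (+ 2 * + k - + 1) *_) (shiftʳ-shiftˡ-suc (shiftˡ remainder) i k)) (rem-shiftʳˡ i k)

rem-shiftʳʳ : ∀ i k → let I = + i ; K = + k - + 1 in
  shiftFactor (I + K) * (+ 2 * K - + 1) * shiftʳ (shiftʳ remainder) i k ≡ cofactor I K * shiftʳ remainder i k
rem-shiftʳʳ i zero    = both-zero (shiftFactor (+ i + - + 1) * (+ 2 * - + 1 - + 1)) (cofactor (+ i) (- + 1))
rem-shiftʳʳ i (suc k) = rem-shiftʳ i k

rem-shiftʳʳˡ : ∀ i k → let I = + i - + 1 ; K = + k - + 1 in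
  shiftFactor (I + K) * (+ 2 * K - + 1) * shiftʳ (shiftʳ (shiftˡ remainder)) i k
  ≡ cofactor I K * shiftʳ (shiftˡ remainder) i k
rem-shiftʳʳˡ i zero    = both-zero (shiftFactor (+ i - + 1 + - + 1) * (+ 2 * - + 1 - + 1)) (cofactor (+ i - + 1) (- + 1))
rem-shiftʳʳˡ i (suc k) = rem-shiftʳˡ i k

2k-1≢0 : ∀ k → NonZero (+ 2 * + k - + 1)
2k-1≢0 zero    = _
2k-1≢0 (suc k) = ≡+suc⇒nonZero {k = k ℕ.+ k} (lem (+ k))
  where
  lem : ∀ k → + 2 * (+ 1 + k) - + 1 ≡ + 1 + (k + k)
  lem = solve-∀

2k-3≢0 : ∀ k → NonZero (+ 2 * (+ k - + 1) - + 1)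
2k-3≢0 zero    = _
2k-3≢0 (suc k) = 2k-1≢0 k

shiftFactor≢0 : ∀ t → NonZero (shiftFactor (+ suc t))
shiftFactor≢0 t = i*j≢0 (+ suc t) (+ 16 * (+ suc t * + suc t) - + 1) {{_}}
  {{subst NonZero (sym (factor (+ t)))
     (i*j≢0 (+ 3 + + 4 * + t) (+ 5 + + 4 * + t)
       {{≡+suc⇒nonZero (sym (pos-+* 3 4 t))}} {{≡+suc⇒nonZero (sym (pos-+* 5 4 t))}})}}
  where
  factor : ∀ t → + 16 * ((+ 1 + t) * (+ 1 + t)) - + 1 ≡ (+ 3 + + 4 * t) * (+ 5 + + 4 * t)
  factor = solve-∀

-- The coefficients of the recurrence `W-recurrence`, in degree t + 3. As for `padé-recurrence`,
-- multiplication by the nonzero `M` makes every neighbour a polynomial multiple of the one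
-- coefficient `w`, and a polynomial identity in i and k remains.
remainder-recurrence : ∀ t i k → i ℕ.+ k ≡ suc (suc (suc t)) → let r = + suc t in
  shiftʳ remainder i k
  ≡ (+ 2 * r + + 1) * (shiftˡ (shiftˡ remainder) i k + + 6 * shiftʳ (shiftˡ remainder) i k
        + shiftʳ (shiftʳ remainder) i k)
    - (+ 16 * (r * r) - + 1) * (shiftˡ (shiftˡ (shiftˡ remainder)) i k
        + + 2 * shiftʳ (shiftˡ (shiftˡ remainder)) i k + shiftʳ (shiftʳ (shiftˡ remainder)) i k)
remainder-recurrence t i k i+k≡3+t = *-cancelˡ-≡ M _ _ {{M≢0}} (begin
  M * k₁
    ≡⟨ lem₁ (shiftFactor s) ρ₁ r d₁ d₃ k₁ ⟩
  ρ₁ * r * d₃ * (shiftFactor s * d₁ * k₁)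
    ≡⟨ cong (ρ₁ * r * d₃ *_) (rem-shiftʳ i k) ⟩
  ρ₁ * r * d₃ * (K * u₀ * u₁ * w)
    ≡⟨ lem₂ ρ₁ r d₃ K u₀ u₁ w ⟩
  ρ₁ * r * d₃ * K * (u₀ * u₁ * w)
    -- The only step with content; the others move factors between the two sides.
    ≡⟨ cong (_* (u₀ * u₁ * w)) polynomial ⟩
  ((+ 2 * r + + 1) * r * (d₁ * d₃ * (I * I₁) + + 6 * (d₃ * K * I * u₂) + K₁ * K * u₂ * u₃)
    - (d₁ * d₃ * (I * I₁ * I₂) * u₂ + + 2 * (d₃ * K * (I * I₁) * u₂ * u₃) + K₁ * K * I * u₂ * u₃ * u₄))
    * (u₀ * u₁ * w)
    ≡⟨ lem₃ (+ 2 * r + + 1) r d₁ d₃ I I₁ I₂ K K₁ u₀ u₁ u₂ u₃ u₄ w ⟩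
  (+ 2 * r + + 1) * (r * d₁ * d₃ * (I₁ * u₁ * (I * u₀ * w)) + + 6 * (r * d₃ * (K * u₁ * u₂ * (I * u₀ * w)))
      + r * (K₁ * u₂ * u₃ * (K * u₀ * u₁ * w)))
    - (d₁ * d₃ * (I₂ * u₂ * (I₁ * u₁ * (I * u₀ * w))) + + 2 * (d₃ * (K * u₂ * u₃ * (I₁ * u₁ * (I * u₀ * w))))
      + K₁ * u₃ * u₄ * (K * u₁ * u₂ * (I * u₀ * w)))
    ≡⟨ cong₂ (λ x y → (+ 2 * r + + 1) * x - y)
         (cong₂ _+_ (cong₂ (λ x y → r * d₁ * d₃ * x + + 6 * (r * d₃ * y)) ea₂ eik) (cong (r *_) ek₂))
         (cong₂ _+_ (cong₂ (λ x y → d₁ * d₃ * x + + 2 * (d₃ * y)) ea₃ eiik) eikk) ⟨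
  (+ 2 * r + + 1) * (r * d₁ * d₃ * (shiftFactor s * ρ₁ * a₂) + + 6 * (r * d₃ * (shiftFactor s * ρ₁ * d₁ * ik))
      + r * (shiftFactor s * ρ₁ * d₁ * d₃ * k₂))
    - (d₁ * d₃ * (shiftFactor s * ρ₁ * ρ₂ * a₃) + + 2 * (d₃ * (shiftFactor s * ρ₁ * ρ₂ * d₁ * iik)) + shiftFactor s * ρ₁ * ρ₂ * d₁ * d₃ * ikk)
    ≡⟨ lem₄ (+ 2 * r + + 1) r (+ 16 * (r * r) - + 1) d₁ d₃ (shiftFactor s) ρ₁ a₂ ik k₂ a₃ iik ikk ⟩
  M * ((+ 2 * r + + 1) * (a₂ + + 6 * ik + k₂) - (+ 16 * (r * r) - + 1) * (a₃ + + 2 * iik + ikk)) ∎)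
  where
  open ≡-Reasoning
  I I₁ I₂ K K₁ s r ρ₁ ρ₂ d₁ d₃ u₀ u₁ u₂ u₃ u₄ M a₁ a₂ a₃ k₁ k₂ ik iik ikk w : ℤ
  I = + i
  I₁ = + i - + 1
  I₂ = + i - + 1 - + 1
  K = + k
  K₁ = + k - + 1
  s = I + K
  r = + suc t
  ρ₁ = shiftFactor (+ suc (suc t))
  ρ₂ = shiftFactor r
  d₁ = + 2 * K - + 1
  d₃ = + 2 * K₁ - + 1
  u₀ = + 2 * I + + 4 * K + + 1
  u₁ = + 2 * I + + 4 * K - + 1
  u₂ = + 2 * I + + 4 * K - + 3
  u₃ = + 2 * I + + 4 * K - + 5
  u₄ = + 2 * I + + 4 * K - + 7
  M = shiftFactor s * ρ₁ * r * d₁ * d₃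
  a₁ = shiftˡ remainder i k
  a₂ = shiftˡ (shiftˡ remainder) i k
  a₃ = shiftˡ (shiftˡ (shiftˡ remainder)) i k
  k₁ = shiftʳ remainder i k
  k₂ = shiftʳ (shiftʳ remainder) i k
  ik = shiftʳ (shiftˡ remainder) i k
  iik = shiftʳ (shiftˡ (shiftˡ remainder)) i k
  ikk = shiftʳ (shiftʳ (shiftˡ remainder)) i k
  w = remainder i k
  s≡ : s ≡ + suc (suc (suc t))
  s≡ = cong +_ i+k≡3+t
  s₁≡ : I + K - + 1 ≡ + suc (suc t)
  s₁≡ = cong (_- + 1) s≡
  r≡ : r ≡ I + K - + 2
  r≡ = sym (cong (_- + 2) s≡)
  M≢0 : NonZero M
  M≢0 = i*j≢0 (shiftFactor s * ρ₁ * r * d₁) d₃ {{i*j≢0 (shiftFactor s * ρ₁ * r) d₁ {{i*j≢0 (shiftFactor s * ρ₁) r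
    {{i*j≢0 (shiftFactor s) ρ₁ {{subst (λ x → NonZero (shiftFactor x)) (sym s≡) (shiftFactor≢0 (suc (suc t)))}} {{shiftFactor≢0 (suc t)}}}}}} {{2k-1≢0 k}}}} {{2k-3≢0 k}}
  shiftFactor-I₁ : shiftFactor (I₁ + K) ≡ ρ₁
  shiftFactor-I₁ = cong shiftFactor (trans (lem I K) s₁≡)
    where
    lem : ∀ i k → i - + 1 + k ≡ i + k - + 1
    lem = solve-∀
  shiftFactor-K₁ : shiftFactor (I + K₁) ≡ ρ₁
  shiftFactor-K₁ = cong shiftFactor (trans (lem I K) s₁≡)
    where
    lem : ∀ i k → i + (k - + 1) ≡ i + k - + 1
    lem = solve-∀
  shiftFactor-I₂ : shiftFactor (I₂ + K) ≡ ρ₂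
  shiftFactor-I₂ = cong shiftFactor (trans (lem I K) (sym r≡))
    where
    lem : ∀ i k → i - + 1 - + 1 + k ≡ i + k - + 2
    lem = solve-∀
  shiftFactor-I₁K₁ : shiftFactor (I₁ + K₁) ≡ ρ₂
  shiftFactor-I₁K₁ = cong shiftFactor (trans (lem I K) (sym r≡))
    where
    lem : ∀ i k → i - + 1 + (k - + 1) ≡ i + k - + 2
    lem = solve-∀
  ea₂ : shiftFactor s * ρ₁ * a₂ ≡ I₁ * u₁ * (I * u₀ * w)
  ea₂ = trans (lem (shiftFactor s) ρ₁ a₂) (trans (cong (shiftFactor s *_) (trans (cong (_* a₂) (sym shiftFactor-I₁)) (rem-shiftˡˡ i k)))
    (trans (lem′ (shiftFactor s) I K a₁) (cong (I₁ * u₁ *_) (rem-shiftˡ i k))))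
    where
    lem : ∀ x y z → x * y * z ≡ x * (y * z)
    lem = solve-∀
    lem′ : ∀ x i k a → x * ((i - + 1) * (+ 2 * (i - + 1) + + 4 * k + + 1) * a)
      ≡ (i - + 1) * (+ 2 * i + + 4 * k - + 1) * (x * a)
    lem′ = solve-∀
  eik : shiftFactor s * ρ₁ * d₁ * ik ≡ K * u₁ * u₂ * (I * u₀ * w)
  eik = trans (lem (shiftFactor s) ρ₁ d₁ ik) (trans (cong (shiftFactor s *_) (trans (cong (λ x → x * d₁ * ik) (sym shiftFactor-I₁)) (rem-shiftʳˡ i k)))
    (trans (lem′ (shiftFactor s) I K a₁) (cong (K * u₁ * u₂ *_) (rem-shiftˡ i k))))
    where
    lem : ∀ x y d z → x * y * d * z ≡ x * (y * d * z)
    lem = solve-∀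
    lem′ : ∀ x i k a → x * (k * (+ 2 * (i - + 1) + + 4 * k + + 1) * (+ 2 * (i - + 1) + + 4 * k - + 1) * a)
      ≡ k * (+ 2 * i + + 4 * k - + 1) * (+ 2 * i + + 4 * k - + 3) * (x * a)
    lem′ = solve-∀
  ek₂ : shiftFactor s * ρ₁ * d₁ * d₃ * k₂ ≡ K₁ * u₂ * u₃ * (K * u₀ * u₁ * w)
  ek₂ = trans (lem (shiftFactor s) ρ₁ d₁ d₃ k₂) (trans (cong (shiftFactor s * d₁ *_) (trans (cong (λ x → x * d₃ * k₂) (sym shiftFactor-K₁)) (rem-shiftʳʳ i k)))
    (trans (lem′ (shiftFactor s * d₁) I K k₁) (cong (K₁ * u₂ * u₃ *_) (rem-shiftʳ i k))))
    where
    lem : ∀ x y d e z → x * y * d * e * z ≡ x * d * (y * e * z)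
    lem = solve-∀
    lem′ : ∀ x i k a → x * ((k - + 1) * (+ 2 * i + + 4 * (k - + 1) + + 1) * (+ 2 * i + + 4 * (k - + 1) - + 1) * a)
      ≡ (k - + 1) * (+ 2 * i + + 4 * k - + 3) * (+ 2 * i + + 4 * k - + 5) * (x * a)
    lem′ = solve-∀
  ea₃ : shiftFactor s * ρ₁ * ρ₂ * a₃ ≡ I₂ * u₂ * (I₁ * u₁ * (I * u₀ * w))
  ea₃ = trans (lem (shiftFactor s) ρ₁ ρ₂ a₃) (trans (cong (shiftFactor s * ρ₁ *_) (trans (cong (_* a₃) (sym shiftFactor-I₂)) (rem-shiftˡˡˡ i k)))
    (trans (lem′ (shiftFactor s * ρ₁) I K a₂) (cong (I₂ * u₂ *_) ea₂)))
    where
    lem : ∀ x y z a → x * y * z * a ≡ x * y * (z * a)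
    lem = solve-∀
    lem′ : ∀ x i k a → x * ((i - + 1 - + 1) * (+ 2 * (i - + 1 - + 1) + + 4 * k + + 1) * a)
      ≡ (i - + 1 - + 1) * (+ 2 * i + + 4 * k - + 3) * (x * a)
    lem′ = solve-∀
  eiik : shiftFactor s * ρ₁ * ρ₂ * d₁ * iik ≡ K * u₂ * u₃ * (I₁ * u₁ * (I * u₀ * w))
  eiik = trans (lem (shiftFactor s) ρ₁ ρ₂ d₁ iik) (trans (cong (shiftFactor s * ρ₁ *_) (trans (cong (λ x → x * d₁ * iik) (sym shiftFactor-I₂)) (rem-shiftʳˡˡ i k)))
    (trans (lem′ (shiftFactor s * ρ₁) I K a₂) (cong (K * u₂ * u₃ *_) ea₂)))
    where
    lem : ∀ x y z d a → x * y * z * d * a ≡ x * y * (z * d * a)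
    lem = solve-∀
    lem′ : ∀ x i k a → x * (k * (+ 2 * (i - + 1 - + 1) + + 4 * k + + 1) * (+ 2 * (i - + 1 - + 1) + + 4 * k - + 1) * a)
      ≡ k * (+ 2 * i + + 4 * k - + 3) * (+ 2 * i + + 4 * k - + 5) * (x * a)
    lem′ = solve-∀
  eikk : shiftFactor s * ρ₁ * ρ₂ * d₁ * d₃ * ikk ≡ K₁ * u₃ * u₄ * (K * u₁ * u₂ * (I * u₀ * w))
  eikk = trans (lem (shiftFactor s) ρ₁ ρ₂ d₁ d₃ ikk) (trans (cong (shiftFactor s * ρ₁ * d₁ *_) (trans (cong (λ x → x * d₃ * ikk) (sym shiftFactor-I₁K₁)) (rem-shiftʳʳˡ i k)))
    (trans (lem′ (shiftFactor s * ρ₁ * d₁) I K ik) (cong (K₁ * u₃ * u₄ *_) eik)))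
    where
    lem : ∀ x y z d e a → x * y * z * d * e * a ≡ x * y * d * (z * e * a)
    lem = solve-∀
    lem′ : ∀ x i k a → x * ((k - + 1) * (+ 2 * (i - + 1) + + 4 * (k - + 1) + + 1) * (+ 2 * (i - + 1) + + 4 * (k - + 1) - + 1) * a)
      ≡ (k - + 1) * (+ 2 * i + + 4 * k - + 5) * (+ 2 * i + + 4 * k - + 7) * (x * a)
    lem′ = solve-∀
  lem₁ : ∀ x y r d e a → x * y * r * d * e * a ≡ y * r * e * (x * d * a)
  lem₁ = solve-∀
  lem₂ : ∀ y r e k u v w → y * r * e * (k * u * v * w) ≡ y * r * e * k * (u * v * w)
  lem₂ = solve-∀
  lem₃ : ∀ γ r d₁ d₃ I I₁ I₂ K K₁ u₀ u₁ u₂ u₃ u₄ w →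
    (γ * r * (d₁ * d₃ * (I * I₁) + + 6 * (d₃ * K * I * u₂) + K₁ * K * u₂ * u₃)
      - (d₁ * d₃ * (I * I₁ * I₂) * u₂ + + 2 * (d₃ * K * (I * I₁) * u₂ * u₃) + K₁ * K * I * u₂ * u₃ * u₄))
      * (u₀ * u₁ * w)
    ≡ γ * (r * d₁ * d₃ * (I₁ * u₁ * (I * u₀ * w)) + + 6 * (r * d₃ * (K * u₁ * u₂ * (I * u₀ * w)))
        + r * (K₁ * u₂ * u₃ * (K * u₀ * u₁ * w)))
      - (d₁ * d₃ * (I₂ * u₂ * (I₁ * u₁ * (I * u₀ * w))) + + 2 * (d₃ * (K * u₂ * u₃ * (I₁ * u₁ * (I * u₀ * w))))
        + K₁ * u₃ * u₄ * (K * u₁ * u₂ * (I * u₀ * w)))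
  lem₃ = solve-∀
  lem₄ : ∀ γ r η d₁ d₃ ρ₀ ρ₁ a₂ ik k₂ a₃ iik ikk →
    γ * (r * d₁ * d₃ * (ρ₀ * ρ₁ * a₂) + + 6 * (r * d₃ * (ρ₀ * ρ₁ * d₁ * ik)) + r * (ρ₀ * ρ₁ * d₁ * d₃ * k₂))
      - (d₁ * d₃ * (ρ₀ * ρ₁ * (r * η) * a₃) + + 2 * (d₃ * (ρ₀ * ρ₁ * (r * η) * d₁ * iik)) + ρ₀ * ρ₁ * (r * η) * d₁ * d₃ * ikk)
    ≡ ρ₀ * ρ₁ * r * d₁ * d₃ * (γ * (a₂ + + 6 * ik + k₂) - η * (a₃ + + 2 * iik + ikk))
  lem₄ = solve-∀
  Q : ℤ → ℤ
  Q r = (+ 2 * r + + 1) * r * (d₁ * d₃ * (I * I₁) + + 6 * (d₃ * K * I * u₂) + K₁ * K * u₂ * u₃)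
    - (d₁ * d₃ * (I * I₁ * I₂) * u₂ + + 2 * (d₃ * K * (I * I₁) * u₂ * u₃) + K₁ * K * I * u₂ * u₃ * u₄)
  polynomial : ρ₁ * r * d₃ * K ≡ Q r
  polynomial = trans (cong₂ (λ x y → shiftFactor x * y * d₃ * K) (sym s₁≡) r≡) (trans (lem I K) (cong Q (sym r≡)))
    where
    lem : ∀ i k → let u = + 2 * i + + 4 * k ; d₁ = + 2 * k - + 1 ; d₃ = + 2 * (k - + 1) - + 1
                      s = i + k - + 1 ; r = i + k - + 2 in
      s * (+ 16 * (s * s) - + 1) * r * d₃ * k
      ≡ (+ 2 * r + + 1) * r * (d₁ * d₃ * (i * (i - + 1)) + + 6 * (d₃ * k * i * (u - + 3)) + (k - + 1) * k * (u - + 3) * (u - + 5))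
        - (d₁ * d₃ * (i * (i - + 1) * (i - + 1 - + 1)) * (u - + 3) + + 2 * (d₃ * k * (i * (i - + 1)) * (u - + 3) * (u - + 5))
          + (k - + 1) * k * i * (u - + 3) * (u - + 5) * (u - + 7))
    lem = solve-∀

-- The forms Wᵣ and the order of vanishing

module _ (p q : ℤ) where

  monomial : ℕ → ℕ → ℤ
  monomial i k = p ^ i * q ^ k

  form : ℕ → (ℕ → ℕ → ℤ) → ℤ
  form r f = diagonalSum r (λ i k → f i k * monomial i k)

  form-shiftˡ : ∀ r f → p * form r f ≡ form (suc r) (shiftˡ f)
  form-shiftˡ r f = trans (sym (diagonalSum-* r p (λ i k → f i k * monomial i k)))
    (trans (diagonalSum-cong r (λ i k _ → lem p (f i k) (p ^ i) (q ^ k))) (diagonalSum-shiftˡ r f monomial))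
    where
    lem : ∀ p f x y → p * (f * (x * y)) ≡ f * (p * x * y)
    lem = solve-∀

  form-shiftʳ : ∀ r f → q * form r f ≡ form (suc r) (shiftʳ f)
  form-shiftʳ r f = trans (sym (diagonalSum-* r q (λ i k → f i k * monomial i k)))
    (trans (diagonalSum-cong r (λ i k _ → lem q (f i k) (p ^ i) (q ^ k))) (diagonalSum-shiftʳ r f monomial))
    where
    lem : ∀ q f x y → q * (f * (x * y)) ≡ f * (x * (q * y))
    lem = solve-∀

  form-+ : ∀ r f g → form r (λ i k → f i k + g i k) ≡ form r f + form r g
  form-+ r f g = trans (diagonalSum-cong r (λ i k _ → *-distribʳ-+ (monomial i k) (f i k) (g i k)))
    (diagonalSum-+ r (λ i k → f i k * monomial i k) (λ i k → g i k * monomial i k))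

  form-* : ∀ r c f → form r (λ i k → c * f i k) ≡ c * form r f
  form-* r c f = trans (diagonalSum-cong r (λ i k _ → *-assoc c (f i k) (monomial i k)))
    (diagonalSum-* r c (λ i k → f i k * monomial i k))

  W : ℕ → ℤ
  W r = form r remainder

  -- The recurrence of L at η = x⁴, with p = m² and q = - n²: there Re x⁴ = p² + 6pq + q² and (Im
  -- x⁴)² = - 16pq(p + q)². The factor q on the left expresses that the right side is divisible by
  -- n², so each order gains two more factors n.
  W-recurrence : ∀ t → let r = + suc t in
    q * W (suc (suc t)) ≡ (+ 2 * r + + 1) * (p * p + + 6 * (p * q) + q * q) * W (suc t)
      - (+ 16 * (r * r) - + 1) * (p * ((p + q) * (p + q))) * W t
  W-recurrence t = begin
    q * W (suc (suc t))
      ≡⟨ form-shiftʳ (suc (suc t)) remainder ⟩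
    form R (shiftʳ remainder)
      ≡⟨ diagonalSum-cong R (λ i k e → cong (_* monomial i k) (trans (remainder-recurrence t i k e)
           (cong (λ x → γ * (a₂ i k + + 6 * ik i k + k₂ i k) + x) (neg-distribˡ-* η (a₃ i k + + 2 * iik i k + ikk i k))))) ⟩
    form R (λ i k → γ * (a₂ i k + + 6 * ik i k + k₂ i k) + - η * (a₃ i k + + 2 * iik i k + ikk i k))
      ≡⟨ form-+ R (λ i k → γ * (a₂ i k + + 6 * ik i k + k₂ i k)) (λ i k → - η * (a₃ i k + + 2 * iik i k + ikk i k)) ⟩
    form R (λ i k → γ * (a₂ i k + + 6 * ik i k + k₂ i k)) + form R (λ i k → - η * (a₃ i k + + 2 * iik i k + ikk i k))
      ≡⟨ cong₂ _+_ (trans (form-* R γ (λ i k → a₂ i k + + 6 * ik i k + k₂ i k)) (cong (γ *_) (three (+ 6) a₂ ik k₂)))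
                   (trans (form-* R (- η) (λ i k → a₃ i k + + 2 * iik i k + ikk i k)) (cong (- η *_) (three (+ 2) a₃ iik ikk))) ⟩
    γ * (form R a₂ + + 6 * form R ik + form R k₂) + - η * (form R a₃ + + 2 * form R iik + form R ikk)
      ≡⟨ cong₂ (λ x y → γ * x + - η * y)
           (cong₂ _+_ (cong₂ (λ x y → x + + 6 * y) fa₂ fik) fk₂)
           (cong₂ _+_ (cong₂ (λ x y → x + + 2 * y) fa₃ fiik) fikk) ⟩
    γ * (p * (p * W (suc t)) + + 6 * (q * (p * W (suc t))) + q * (q * W (suc t)))
      + - η * (p * (p * (p * W t)) + + 2 * (q * (p * (p * W t))) + q * (q * (p * W t)))
      ≡⟨ lem γ η p q (W (suc t)) (W t) ⟩
    γ * (p * p + + 6 * (p * q) + q * q) * W (suc t) - η * (p * ((p + q) * (p + q))) * W t ∎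
    where
    open ≡-Reasoning
    R : ℕ
    R = suc (suc (suc t))
    γ η : ℤ
    γ = + 2 * + suc t + + 1
    η = + 16 * (+ suc t * + suc t) - + 1
    a₂ a₃ ik k₂ iik ikk : ℕ → ℕ → ℤ
    a₂ = shiftˡ (shiftˡ remainder)
    a₃ = shiftˡ a₂
    ik = shiftʳ (shiftˡ remainder)
    k₂ = shiftʳ (shiftʳ remainder)
    iik = shiftʳ a₂
    ikk = shiftʳ ik
    three : ∀ c f g h → form R (λ i k → f i k + c * g i k + h i k) ≡ form R f + c * form R g + form R h
    three c f g h = trans (form-+ R (λ i k → f i k + c * g i k) h) (cong (_+ form R h)
      (trans (form-+ R f (λ i k → c * g i k)) (cong (λ x → form R f + x) (form-* R c g))))
    fa₂ : form R a₂ ≡ p * (p * W (suc t))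
    fa₂ = sym (trans (cong (p *_) (form-shiftˡ (suc t) remainder)) (form-shiftˡ (suc (suc t)) (shiftˡ remainder)))
    fik : form R ik ≡ q * (p * W (suc t))
    fik = sym (trans (cong (q *_) (form-shiftˡ (suc t) remainder)) (form-shiftʳ (suc (suc t)) (shiftˡ remainder)))
    fk₂ : form R k₂ ≡ q * (q * W (suc t))
    fk₂ = sym (trans (cong (q *_) (form-shiftʳ (suc t) remainder)) (form-shiftʳ (suc (suc t)) (shiftʳ remainder)))
    fpp : p * (p * W t) ≡ form (suc (suc t)) a₂
    fpp = trans (cong (p *_) (form-shiftˡ t remainder)) (form-shiftˡ (suc t) (shiftˡ remainder))
    fa₃ : form R a₃ ≡ p * (p * (p * W t))
    fa₃ = sym (trans (cong (p *_) fpp) (form-shiftˡ (suc (suc t)) a₂))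
    fiik : form R iik ≡ q * (p * (p * W t))
    fiik = sym (trans (cong (q *_) fpp) (form-shiftʳ (suc (suc t)) a₂))
    fikk : form R ikk ≡ q * (q * (p * W t))
    fikk = sym (trans (cong (q *_) (trans (cong (q *_) (form-shiftˡ t remainder)) (form-shiftʳ (suc t) (shiftˡ remainder))))
                      (form-shiftʳ (suc (suc t)) ik))
    lem : ∀ γ η p q x y →
      γ * (p * (p * x) + + 6 * (q * (p * x)) + q * (q * x)) + - η * (p * (p * (p * y)) + + 2 * (q * (p * (p * y))) + q * (q * (p * y)))
      ≡ γ * (p * p + + 6 * (p * q) + q * q) * x - η * (p * ((p + q) * (p + q))) * y
    lem = solve-∀

Re⁴ Im⁴ : ℤ → ℤ → ℤ
Re⁴ m n = m * m * (m * m) - + 6 * (m * m * (n * n)) + n * n * (n * n)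
Im⁴ m n = + 4 * (m * n * (m * m - n * n))

-- The evaluation at η = x⁴: since x Pᵣ(x⁴ , x̄⁴) vanishes to order 2r + 1 at x = x̄,
-- the power n²ʳ⁺¹ splits off.
L-at-fourth-power : ∀ m n r → L (Re⁴ m n) (Im⁴ m n) n m r
  ≡ (- + 8) ^ r * (n * (n * n) ^ r) * W (m * m) (- (n * n)) r
L-at-fourth-power m n zero       = lem n
  where
  lem : ∀ n → n ≡ + 1 * (n * + 1) * (+ 1 * (+ 1 * + 1))
  lem = solve-∀
L-at-fourth-power m n (suc zero) = lem m n
  where
  lem : ∀ m n → + 8 * (m * m * (m * m) - + 6 * (m * m * (n * n)) + n * n * (n * n)) * n
      - + 2 * (+ 4 * (m * n * (m * m - n * n))) * m
    ≡ - + 8 * + 1 * (n * (n * n * + 1)) * (+ 1 * (+ 1 * (- (n * n) * + 1)) + + 5 * (m * m * + 1 * + 1))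
  lem = solve-∀
L-at-fourth-power m n (suc (suc r)) = begin
  + 8 * (+ 2 * + r + + 3) * X * L X Y n m (suc r) + + 4 * (+ 16 * (+ r + + 1) * (+ r + + 1) - + 1) * (Y * Y) * L X Y n m r
    ≡⟨ cong₂ (λ x y → + 8 * (+ 2 * + r + + 3) * X * x + + 4 * (+ 16 * (+ r + + 1) * (+ r + + 1) - + 1) * (Y * Y) * y)
         (L-at-fourth-power m n (suc r)) (L-at-fourth-power m n r) ⟩
  + 8 * (+ 2 * + r + + 3) * X * (- + 8 * e * (n * (n * n * h)) * W₁)
    + + 4 * (+ 16 * (+ r + + 1) * (+ r + + 1) - + 1) * (Y * Y) * (e * (n * h) * W₀)
    ≡⟨ lem₁ (+ r) m n e h W₁ W₀ ⟩
  - (+ 64) * e * (n * (n * n * h))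
    * ((+ 2 * (+ 1 + + r) + + 1) * (p * p + + 6 * (p * q) + q * q) * W₁
       - (+ 16 * ((+ 1 + + r) * (+ 1 + + r)) - + 1) * (p * ((p + q) * (p + q))) * W₀)
    ≡⟨ cong (- (+ 64) * e * (n * (n * n * h)) *_) (W-recurrence p q r) ⟨
  - (+ 64) * e * (n * (n * n * h)) * (q * W₂)
    ≡⟨ lem₂ e n h W₂ ⟩
  - + 8 * (- + 8 * e) * (n * (n * n * (n * n * h))) * W₂ ∎
  where
  open ≡-Reasoning
  X Y p q e h W₀ W₁ W₂ : ℤ
  X = Re⁴ m n
  Y = Im⁴ m n
  p = m * m
  q = - (n * n)
  e = (- + 8) ^ r
  h = (n * n) ^ r
  W₀ = W p q r
  W₁ = W p q (suc r)
  W₂ = W p q (suc (suc r))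
  lem₁ : ∀ r m n e h x y → let p = m * m ; q = - (n * n) ; Y = + 4 * (m * n * (m * m - n * n)) in
    + 8 * (+ 2 * r + + 3) * (m * m * (m * m) - + 6 * (m * m * (n * n)) + n * n * (n * n)) * (- + 8 * e * (n * (n * n * h)) * x)
      + + 4 * (+ 16 * (r + + 1) * (r + + 1) - + 1) * (Y * Y) * (e * (n * h) * y)
    ≡ - + 64 * e * (n * (n * n * h))
      * ((+ 2 * (+ 1 + r) + + 1) * (p * p + + 6 * (p * q) + q * q) * x
         - (+ 16 * ((+ 1 + r) * (+ 1 + r)) - + 1) * (p * ((p + q) * (p + q))) * y)
  lem₁ = solve-∀
  lem₂ : ∀ e n h w → - + 64 * e * (n * (n * n * h)) * (- (n * n) * w) ≡ - + 8 * (- + 8 * e) * (n * (n * n * (n * n * h))) * w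
  lem₂ = solve-∀

-- Upper bounds for the remainder

remainderCoeff-closed : ∀ i k →
  remainderCoeff i k ℕ.* oddProduct (middle i k) ≡ oddProduct k ℕ.* oddProduct (top i k)
remainderCoeff-closed i k = begin
  oddProduct k ℕ.* oddRange (middle i k) i ℕ.* oddProduct (middle i k)
    ≡⟨ lem (oddProduct k) (oddRange (middle i k) i) (oddProduct (middle i k)) ⟩
  oddProduct k ℕ.* (oddProduct (middle i k) ℕ.* oddRange (middle i k) i)
    ≡⟨ cong (oddProduct k ℕ.*_) (trans (oddProduct-oddRange (middle i k) i) (cong oddProduct (middle+i i k))) ⟩
  oddProduct k ℕ.* oddProduct (top i k) ∎
  where
  open ≡-Reasoning
  lem : ∀ x y z → x ℕ.* y ℕ.* z ≡ x ℕ.* (z ℕ.* y)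
  lem = ℕ-solve-∀

-- Moving one unit from k to i multiplies the coefficient by (2μ + 1)/(2k + 1), where μ is
-- `middle (suc i) k`; this is at least 1 because k ≤ μ. So the largest coefficient of a given
-- degree is the one with k = 0.
remainderCoeff-exchange : ∀ i k → remainderCoeff i (suc k) ℕ.≤ remainderCoeff (suc i) k
remainderCoeff-exchange i k = ℕ.*-cancelʳ-≤ _ _ (2 ℕ.* μ ℕ.+ 1) {{ℕ.≢-nonZero (λ e → ℕ.1+n≢0 (trans (ℕ.+-comm 1 (2 ℕ.* μ)) e))}} (begin
  remainderCoeff i (suc k) ℕ.* (2 ℕ.* μ ℕ.+ 1)
    ≡⟨ exchange ⟩
  remainderCoeff (suc i) k ℕ.* (2 ℕ.* k ℕ.+ 1)
    ≤⟨ ℕ.*-monoʳ-≤ (remainderCoeff (suc i) k) (ℕ.+-monoˡ-≤ 1 (ℕ.*-monoʳ-≤ 2 k≤μ)) ⟩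
  remainderCoeff (suc i) k ℕ.* (2 ℕ.* μ ℕ.+ 1) ∎)
  where
  open ℕ.≤-Reasoning
  μ : ℕ
  μ = middle (suc i) k
  k≤μ : k ℕ.≤ μ
  k≤μ = subst (k ℕ.≤_) (lem i k) (ℕ.m≤m+n k (suc i ℕ.+ k ℕ.+ 1))
    where
    lem : ∀ i k → k ℕ.+ (suc i ℕ.+ k ℕ.+ 1) ≡ suc i ℕ.+ (k ℕ.+ k) ℕ.+ 1
    lem = ℕ-solve-∀
  middle≡ : ∀ i k → i ℕ.+ (suc k ℕ.+ suc k) ℕ.+ 1 ≡ suc (suc i ℕ.+ (k ℕ.+ k) ℕ.+ 1)
  middle≡ = ℕ-solve-∀
  top≡ : ∀ i k → i ℕ.+ suc k ℕ.+ (i ℕ.+ suc k) ℕ.+ 1 ≡ suc i ℕ.+ k ℕ.+ (suc i ℕ.+ k) ℕ.+ 1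
  top≡ = ℕ-solve-∀
  exchange : remainderCoeff i (suc k) ℕ.* (2 ℕ.* μ ℕ.+ 1) ≡ remainderCoeff (suc i) k ℕ.* (2 ℕ.* k ℕ.+ 1)
  exchange = ℕ.*-cancelʳ-≡ _ _ (oddProduct μ) {{oddProduct≢0 μ}} (begin-equality
    remainderCoeff i (suc k) ℕ.* (2 ℕ.* μ ℕ.+ 1) ℕ.* oddProduct μ
      ≡⟨ lem₁ (remainderCoeff i (suc k)) (2 ℕ.* μ ℕ.+ 1) (oddProduct μ) ⟩
    remainderCoeff i (suc k) ℕ.* oddProduct (suc μ)
      ≡⟨ cong (λ x → remainderCoeff i (suc k) ℕ.* oddProduct x) (middle≡ i k) ⟨
    remainderCoeff i (suc k) ℕ.* oddProduct (middle i (suc k))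
      ≡⟨ remainderCoeff-closed i (suc k) ⟩
    oddProduct k ℕ.* (2 ℕ.* k ℕ.+ 1) ℕ.* oddProduct (top i (suc k))
      ≡⟨ cong (λ x → oddProduct k ℕ.* (2 ℕ.* k ℕ.+ 1) ℕ.* oddProduct x) (top≡ i k) ⟩
    oddProduct k ℕ.* (2 ℕ.* k ℕ.+ 1) ℕ.* oddProduct (top (suc i) k)
      ≡⟨ lem₂ (oddProduct k) (2 ℕ.* k ℕ.+ 1) (oddProduct (top (suc i) k)) ⟩
    oddProduct k ℕ.* oddProduct (top (suc i) k) ℕ.* (2 ℕ.* k ℕ.+ 1)
      ≡⟨ cong (ℕ._* (2 ℕ.* k ℕ.+ 1)) (remainderCoeff-closed (suc i) k) ⟨
    remainderCoeff (suc i) k ℕ.* oddProduct μ ℕ.* (2 ℕ.* k ℕ.+ 1)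
      ≡⟨ lem₂ (remainderCoeff (suc i) k) (oddProduct μ) (2 ℕ.* k ℕ.+ 1) ⟩
    remainderCoeff (suc i) k ℕ.* (2 ℕ.* k ℕ.+ 1) ℕ.* oddProduct μ ∎)
    where
    lem₁ : ∀ x y z → x ℕ.* y ℕ.* z ≡ x ℕ.* (z ℕ.* y)
    lem₁ = ℕ-solve-∀
    lem₂ : ∀ x y z → x ℕ.* y ℕ.* z ≡ x ℕ.* z ℕ.* y
    lem₂ = ℕ-solve-∀

remainderCoeff-≤ : ∀ i k → remainderCoeff i k ℕ.≤ remainderCoeff (i ℕ.+ k) 0
remainderCoeff-≤ i zero    = ℕ.≤-reflexive (cong (λ x → remainderCoeff x 0) (sym (ℕ.+-identityʳ i)))
remainderCoeff-≤ i (suc k) = ℕ.≤-trans (remainderCoeff-exchange i k)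
  (ℕ.≤-trans (remainderCoeff-≤ (suc i) k) (ℕ.≤-reflexive (cong (λ x → remainderCoeff x 0) (sym (ℕ.+-suc i k)))))

-- The value is (4r + 1)!! / (2r + 1)!!, and the next step multiplies it by (4r + 3)(4r + 5)/(2r +
-- 3), at most 8(r + 1).
remainderCoeff-0 : ∀ r → remainderCoeff r 0 ℕ.≤ 8 ℕ.^ r ℕ.* r !
remainderCoeff-0 zero    = ℕ.≤-refl
remainderCoeff-0 (suc r) = ℕ.*-cancelʳ-≤ _ _ (oddProduct (middle (suc r) 0)) {{oddProduct≢0 (middle (suc r) 0)}} (begin
  remainderCoeff (suc r) 0 ℕ.* oddProduct (suc μ)
    ≡⟨ remainderCoeff-closed (suc r) 0 ⟩
  1 ℕ.* oddProduct (top (suc r) 0)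
    ≡⟨ cong (λ x → 1 ℕ.* oddProduct x) (top≡ r) ⟩
  1 ℕ.* (oddProduct (top r 0) ℕ.* (2 ℕ.* top r 0 ℕ.+ 1) ℕ.* (2 ℕ.* suc (top r 0) ℕ.+ 1))
    ≡⟨ lem₁ (oddProduct (top r 0)) (2 ℕ.* top r 0 ℕ.+ 1) (2 ℕ.* suc (top r 0) ℕ.+ 1) ⟩
  1 ℕ.* oddProduct (top r 0) ℕ.* ((2 ℕ.* top r 0 ℕ.+ 1) ℕ.* (2 ℕ.* suc (top r 0) ℕ.+ 1))
    ≡⟨ cong (ℕ._* ((2 ℕ.* top r 0 ℕ.+ 1) ℕ.* (2 ℕ.* suc (top r 0) ℕ.+ 1))) (remainderCoeff-closed r 0) ⟨
  remainderCoeff r 0 ℕ.* oddProduct μ ℕ.* ((2 ℕ.* top r 0 ℕ.+ 1) ℕ.* (2 ℕ.* suc (top r 0) ℕ.+ 1))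
    ≤⟨ ℕ.*-mono-≤ (ℕ.*-monoˡ-≤ (oddProduct μ) (remainderCoeff-0 r)) quadratic ⟩
  8 ℕ.^ r ℕ.* r ! ℕ.* oddProduct μ ℕ.* (8 ℕ.* suc r ℕ.* (2 ℕ.* μ ℕ.+ 1))
    ≡⟨ lem₂ (8 ℕ.^ r) (r !) (oddProduct μ) (suc r) (2 ℕ.* μ ℕ.+ 1) ⟩
  8 ℕ.^ suc r ℕ.* suc r ! ℕ.* oddProduct (suc μ) ∎)
  where
  open ℕ.≤-Reasoning
  μ : ℕ
  μ = middle r 0
  top≡ : ∀ r → suc r ℕ.+ 0 ℕ.+ (suc r ℕ.+ 0) ℕ.+ 1 ≡ suc (suc (r ℕ.+ 0 ℕ.+ (r ℕ.+ 0) ℕ.+ 1))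
  top≡ = ℕ-solve-∀
  lem₁ : ∀ x y z → 1 ℕ.* (x ℕ.* y ℕ.* z) ≡ 1 ℕ.* x ℕ.* (y ℕ.* z)
  lem₁ = ℕ-solve-∀
  lem₂ : ∀ e f o s t → e ℕ.* f ℕ.* o ℕ.* (8 ℕ.* s ℕ.* t) ≡ 8 ℕ.* e ℕ.* (s ℕ.* f) ℕ.* (o ℕ.* t)
  lem₂ = ℕ-solve-∀
  quadratic : (2 ℕ.* top r 0 ℕ.+ 1) ℕ.* (2 ℕ.* suc (top r 0) ℕ.+ 1) ℕ.≤ 8 ℕ.* suc r ℕ.* (2 ℕ.* μ ℕ.+ 1)
  quadratic = subst₂ ℕ._≤_ (sym (left r)) (sym (right r)) (ℕ.m≤m+n (16 ℕ.* (r ℕ.* r) ℕ.+ 32 ℕ.* r ℕ.+ 15) (8 ℕ.* r ℕ.+ 9))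
    where
    left : ∀ r → (2 ℕ.* (r ℕ.+ 0 ℕ.+ (r ℕ.+ 0) ℕ.+ 1) ℕ.+ 1) ℕ.* (2 ℕ.* suc (r ℕ.+ 0 ℕ.+ (r ℕ.+ 0) ℕ.+ 1) ℕ.+ 1)
      ≡ 16 ℕ.* (r ℕ.* r) ℕ.+ 32 ℕ.* r ℕ.+ 15
    left = ℕ-solve-∀
    right : ∀ r → 8 ℕ.* suc r ℕ.* (2 ℕ.* (r ℕ.+ (0 ℕ.+ 0) ℕ.+ 1) ℕ.+ 1)
      ≡ 16 ℕ.* (r ℕ.* r) ℕ.+ 32 ℕ.* r ℕ.+ 15 ℕ.+ (8 ℕ.* r ℕ.+ 9)
    right = ℕ-solve-∀

diagonalSum-bound : ∀ r {f g} → (∀ i k → i ℕ.+ k ≡ r → + ∣ f i k ∣ ≤ g i k) → + ∣ diagonalSum r f ∣ ≤ diagonalSum r g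
diagonalSum-bound zero            h = h 0 0 refl
diagonalSum-bound (suc r) {f} {g} h = ≤-trans (+≤+ (∣i+j∣≤∣i∣+∣j∣ (f 0 (suc r)) (diagonalSum r (λ i k → f (suc i) k))))
  (+-mono-≤ (h 0 (suc r) refl) (diagonalSum-bound r (λ i k e → h (suc i) k (cong suc e))))

abs-^ : ∀ x n → ∣ x ^ n ∣ ≡ ∣ x ∣ ℕ.^ n
abs-^ x zero    = refl
abs-^ x (suc n) = trans (abs-* x (x ^ n)) (cong (∣ x ∣ ℕ.*_) (abs-^ x n))

pos-^ : ∀ x n → + (x ℕ.^ n) ≡ (+ x) ^ n
pos-^ x zero    = refl
pos-^ x (suc n) = trans (pos-* x (x ℕ.^ n)) (cong (+ x *_) (pos-^ x n))

chooseZ : ℕ → ℕ → ℤ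
chooseZ i k = + choose i k

choose-pascal : ∀ i k r → i ℕ.+ k ≡ suc r → chooseZ i k ≡ shiftˡ chooseZ i k + shiftʳ chooseZ i k
choose-pascal zero    (suc k)       r e = refl
choose-pascal (suc zero)    zero    r e = refl
choose-pascal (suc (suc i)) zero    r e = refl
choose-pascal (suc i) (suc k)       r e = refl

binomial : ∀ p q r → form p q r chooseZ ≡ (p + q) ^ r
binomial p q zero    = refl
binomial p q (suc r) = begin
  form p q (suc r) chooseZ
    ≡⟨ diagonalSum-cong (suc r) (λ i k e → cong (_* monomial p q i k) (choose-pascal i k r e)) ⟩
  form p q (suc r) (λ i k → shiftˡ chooseZ i k + shiftʳ chooseZ i k)
    ≡⟨ form-+ p q (suc r) (shiftˡ chooseZ) (shiftʳ chooseZ) ⟩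
  form p q (suc r) (shiftˡ chooseZ) + form p q (suc r) (shiftʳ chooseZ)
    ≡⟨ cong₂ _+_ (form-shiftˡ p q r chooseZ) (form-shiftʳ p q r chooseZ) ⟨
  p * form p q r chooseZ + q * form p q r chooseZ
    ≡⟨ *-distribʳ-+ (form p q r chooseZ) p q ⟨
  (p + q) * form p q r chooseZ
    ≡⟨ cong ((p + q) *_) (binomial p q r) ⟩
  (p + q) ^ suc r ∎
  where open ≡-Reasoning

-- Apart from the binomial coefficient every coefficient is at most 8ʳ r!, so the sum is dominated
-- by a binomial expansion.
W-bound : ∀ p q r → ∣ W p q r ∣ ℕ.≤ 8 ℕ.^ r ℕ.* r ! ℕ.* (∣ p ∣ ℕ.+ ∣ q ∣) ℕ.^ r
W-bound p q r = drop‿+≤+ (subst (+ ∣ W p q r ∣ ≤_) total (diagonalSum-bound r pointwise))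
  where
  P Q C : ℤ
  P = + ∣ p ∣
  Q = + ∣ q ∣
  C = + (8 ℕ.^ r ℕ.* r !)
  pointwise : ∀ i k → i ℕ.+ k ≡ r → + ∣ remainder i k * monomial p q i k ∣ ≤ C * chooseZ i k * monomial P Q i k
  pointwise i k e = subst₂ _≤_ (cong +_ (sym left)) right (+≤+ (ℕ.*-monoˡ-≤ (∣ p ∣ ℕ.^ i ℕ.* ∣ q ∣ ℕ.^ k)
    (ℕ.*-monoʳ-≤ (choose i k) (subst (λ s → remainderCoeff i k ℕ.≤ 8 ℕ.^ s ℕ.* s !) e
      (ℕ.≤-trans (remainderCoeff-≤ i k) (remainderCoeff-0 (i ℕ.+ k)))))))
    where
    left : ∣ remainder i k * monomial p q i k ∣
      ≡ choose i k ℕ.* remainderCoeff i k ℕ.* (∣ p ∣ ℕ.^ i ℕ.* ∣ q ∣ ℕ.^ k)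
    left = trans (abs-* (remainder i k) (monomial p q i k))
      (cong (choose i k ℕ.* remainderCoeff i k ℕ.*_)
        (trans (abs-* (p ^ i) (q ^ k)) (cong₂ ℕ._*_ (abs-^ p i) (abs-^ q k))))
    right : + (choose i k ℕ.* (8 ℕ.^ r ℕ.* r !) ℕ.* (∣ p ∣ ℕ.^ i ℕ.* ∣ q ∣ ℕ.^ k)) ≡ C * chooseZ i k * monomial P Q i k
    right = trans (pos-* (choose i k ℕ.* (8 ℕ.^ r ℕ.* r !)) (∣ p ∣ ℕ.^ i ℕ.* ∣ q ∣ ℕ.^ k))
      (cong₂ _*_ (trans (cong +_ (ℕ.*-comm (choose i k) (8 ℕ.^ r ℕ.* r !))) (pos-* (8 ℕ.^ r ℕ.* r !) (choose i k)))
        (trans (pos-* (∣ p ∣ ℕ.^ i) (∣ q ∣ ℕ.^ k)) (cong₂ _*_ (pos-^ ∣ p ∣ i) (pos-^ ∣ q ∣ k))))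
  total : diagonalSum r (λ i k → C * chooseZ i k * monomial P Q i k) ≡ + (8 ℕ.^ r ℕ.* r ! ℕ.* (∣ p ∣ ℕ.+ ∣ q ∣) ℕ.^ r)
  total = trans (form-* P Q r C chooseZ) (trans (cong (C *_) (trans (binomial P Q r) (sym (pos-^ (∣ p ∣ ℕ.+ ∣ q ∣) r))))
    (sym (pos-* (8 ℕ.^ r ℕ.* r !) ((∣ p ∣ ℕ.+ ∣ q ∣) ℕ.^ r))))

-- The 64 combines the 8ʳ of `L-at-fourth-power` with that of `W-bound`.
L-at-fourth-power-bound : ∀ m n r → let μ = ∣ m ∣ ; ν = ∣ n ∣ in
  ∣ L (Re⁴ m n) (Im⁴ m n) n m r ∣ ℕ.≤ r ! ℕ.* ν ℕ.* (64 ℕ.* (ν ℕ.* ν) ℕ.* (μ ℕ.* μ ℕ.+ ν ℕ.* ν)) ℕ.^ r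
L-at-fourth-power-bound m n r = begin
  ∣ L (Re⁴ m n) (Im⁴ m n) n m r ∣
    ≡⟨ cong ∣_∣ (L-at-fourth-power m n r) ⟩
  ∣ (- + 8) ^ r * (n * (n * n) ^ r) * W (m * m) (- (n * n)) r ∣
    ≡⟨ trans (abs-* ((- + 8) ^ r * (n * (n * n) ^ r)) (W (m * m) (- (n * n)) r)) (cong (ℕ._* w) (trans (abs-* ((- + 8) ^ r) (n * (n * n) ^ r))
         (cong₂ ℕ._*_ (abs-^ (- + 8) r) (trans (abs-* n ((n * n) ^ r)) (cong (ν ℕ.*_) (trans (abs-^ (n * n) r) (cong (ℕ._^ r) (abs-* n n)))))))) ⟩
  8 ℕ.^ r ℕ.* (ν ℕ.* (ν ℕ.* ν) ℕ.^ r) ℕ.* w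
    ≤⟨ ℕ.*-monoʳ-≤ (8 ℕ.^ r ℕ.* (ν ℕ.* (ν ℕ.* ν) ℕ.^ r)) (W-bound (m * m) (- (n * n)) r) ⟩
  8 ℕ.^ r ℕ.* (ν ℕ.* (ν ℕ.* ν) ℕ.^ r) ℕ.* (8 ℕ.^ r ℕ.* r ! ℕ.* (∣ m * m ∣ ℕ.+ ∣ - (n * n) ∣) ℕ.^ r)
    ≡⟨ cong (λ x → 8 ℕ.^ r ℕ.* (ν ℕ.* (ν ℕ.* ν) ℕ.^ r) ℕ.* (8 ℕ.^ r ℕ.* r ! ℕ.* x ℕ.^ r))
         (cong₂ ℕ._+_ (abs-* m m) (trans (∣-i∣≡∣i∣ (n * n)) (abs-* n n))) ⟩
  8 ℕ.^ r ℕ.* (ν ℕ.* (ν ℕ.* ν) ℕ.^ r) ℕ.* (8 ℕ.^ r ℕ.* r ! ℕ.* (μ ℕ.* μ ℕ.+ ν ℕ.* ν) ℕ.^ r)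
    ≡⟨ lem (8 ℕ.^ r) ν ((ν ℕ.* ν) ℕ.^ r) (r !) ((μ ℕ.* μ ℕ.+ ν ℕ.* ν) ℕ.^ r) ⟩
  r ! ℕ.* ν ℕ.* (8 ℕ.^ r ℕ.* 8 ℕ.^ r ℕ.* (ν ℕ.* ν) ℕ.^ r ℕ.* (μ ℕ.* μ ℕ.+ ν ℕ.* ν) ℕ.^ r)
    ≡⟨ cong (r ! ℕ.* ν ℕ.*_) (powers (ν ℕ.* ν) (μ ℕ.* μ ℕ.+ ν ℕ.* ν) r) ⟩
  r ! ℕ.* ν ℕ.* (64 ℕ.* (ν ℕ.* ν) ℕ.* (μ ℕ.* μ ℕ.+ ν ℕ.* ν)) ℕ.^ r ∎
  where
  open ℕ.≤-Reasoning
  μ ν w : ℕ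
  μ = ∣ m ∣
  ν = ∣ n ∣
  w = ∣ W (m * m) (- (n * n)) r ∣
  lem : ∀ e v x f y → e ℕ.* (v ℕ.* x) ℕ.* (e ℕ.* f ℕ.* y) ≡ f ℕ.* v ℕ.* (e ℕ.* e ℕ.* x ℕ.* y)
  lem = ℕ-solve-∀
  powers : ∀ x y r → 8 ℕ.^ r ℕ.* 8 ℕ.^ r ℕ.* x ℕ.^ r ℕ.* y ℕ.^ r ≡ (64 ℕ.* x ℕ.* y) ℕ.^ r
  powers x y r = sym (trans (^-distribʳ-* r (64 ℕ.* x) y) (cong (ℕ._* y ℕ.^ r)
    (trans (^-distribʳ-* r 64 x) (cong (ℕ._* x ℕ.^ r) (^-distribʳ-* r 8 8)))))

-- Comparison of two solutions of the Thue equation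

coeff₁ coeff₀ : ℕ → ℤ
coeff₁ r = + 8 * (+ 2 * + r + + 3)
coeff₀ r = + 4 * (+ 16 * (+ r + + 1) * (+ r + + 1) - + 1)

coeff₀≡ : ∀ r → coeff₀ r ≡ + (4 ℕ.* ((3 ℕ.+ 4 ℕ.* r) ℕ.* (5 ℕ.+ 4 ℕ.* r)))
coeff₀≡ r = sym (trans (pos-* 4 ((3 ℕ.+ 4 ℕ.* r) ℕ.* (5 ℕ.+ 4 ℕ.* r)))
  (trans (cong (+ 4 *_) (trans (pos-* (3 ℕ.+ 4 ℕ.* r) (5 ℕ.+ 4 ℕ.* r)) (cong₂ _*_ (pos-+* 3 4 r) (pos-+* 5 4 r)))) (lem (+ r))))
  where
  lem : ∀ r → + 4 * ((+ 3 + + 4 * r) * (+ 5 + + 4 * r)) ≡ + 4 * (+ 16 * (r + + 1) * (r + + 1) - + 1)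
  lem = solve-∀

-- Both upper bounds have the shape that turns (r + 1)! and r! into multiples of (r + 2)!, as
-- `step-bound` needs.
∣coeff₁∣≤ : ∀ r → ∣ coeff₁ r ∣ ℕ.≤ 16 ℕ.* suc (suc r)
∣coeff₁∣≤ r = subst (ℕ._≤ 16 ℕ.* suc (suc r)) (sym (trans (cong ∣_∣ (cong (λ x → + 8 * (x + + 3)) (sym (pos-* 2 r)))) (abs-* (+ 8) (+ (2 ℕ.* r ℕ.+ 3)))))
  (subst (8 ℕ.* (2 ℕ.* r ℕ.+ 3) ℕ.≤_) (lem r) (ℕ.m≤m+n (8 ℕ.* (2 ℕ.* r ℕ.+ 3)) 8))
  where
  lem : ∀ r → 8 ℕ.* (2 ℕ.* r ℕ.+ 3) ℕ.+ 8 ≡ 16 ℕ.* suc (suc r)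
  lem = ℕ-solve-∀

∣coeff₀∣≤ : ∀ r → ∣ coeff₀ r ∣ ℕ.≤ 64 ℕ.* (suc r ℕ.* suc (suc r))
∣coeff₀∣≤ r = subst₂ ℕ._≤_ (sym (cong ∣_∣ (coeff₀≡ r))) (lem r) (ℕ.m≤m+n _ (64 ℕ.* r ℕ.+ 68))
  where
  lem : ∀ r → 4 ℕ.* ((3 ℕ.+ 4 ℕ.* r) ℕ.* (5 ℕ.+ 4 ℕ.* r)) ℕ.+ (64 ℕ.* r ℕ.+ 68) ≡ 64 ℕ.* (suc r ℕ.* suc (suc r))
  lem = ℕ-solve-∀

-- The constant is forced by r = 0, where both sides are 60.
≤∣coeff₀∣ : ∀ r → 30 ℕ.* (suc r ℕ.* suc (suc r)) ℕ.≤ ∣ coeff₀ r ∣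
≤∣coeff₀∣ r = subst₂ ℕ._≤_ refl (trans (lem r) (sym (cong ∣_∣ (coeff₀≡ r)))) (ℕ.m≤m+n _ (34 ℕ.* (r ℕ.* r) ℕ.+ 38 ℕ.* r))
  where
  lem : ∀ r → 30 ℕ.* (suc r ℕ.* suc (suc r)) ℕ.+ (34 ℕ.* (r ℕ.* r) ℕ.+ 38 ℕ.* r) ≡ 4 ℕ.* ((3 ℕ.+ 4 ℕ.* r) ℕ.* (5 ℕ.+ 4 ℕ.* r))
  lem = ℕ-solve-∀

abs-*³ : ∀ x y z → ∣ x * y * z ∣ ≡ ∣ x ∣ ℕ.* ∣ y ∣ ℕ.* ∣ z ∣
abs-*³ x y z = trans (abs-* (x * y) z) (cong (ℕ._* ∣ z ∣) (abs-* x y))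

step-bound : ∀ r {x y e f} → ∣ x ∣ ℕ.≤ suc r ! ℕ.* e → ∣ y ∣ ℕ.≤ r ! ℕ.* f →
  ∣ coeff₁ r * x + coeff₀ r * y ∣ ℕ.≤ suc (suc r) ! ℕ.* (16 ℕ.* e ℕ.+ 64 ℕ.* f)
step-bound r {x} {y} {e} {f} x≤ y≤ = begin
  ∣ coeff₁ r * x + coeff₀ r * y ∣
    ≤⟨ ∣i+j∣≤∣i∣+∣j∣ (coeff₁ r * x) (coeff₀ r * y) ⟩
  ∣ coeff₁ r * x ∣ ℕ.+ ∣ coeff₀ r * y ∣
    ≡⟨ cong₂ ℕ._+_ (abs-* (coeff₁ r) x) (abs-* (coeff₀ r) y) ⟩
  ∣ coeff₁ r ∣ ℕ.* ∣ x ∣ ℕ.+ ∣ coeff₀ r ∣ ℕ.* ∣ y ∣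
    ≤⟨ ℕ.+-mono-≤ (ℕ.*-mono-≤ (∣coeff₁∣≤ r) x≤) (ℕ.*-mono-≤ (∣coeff₀∣≤ r) y≤) ⟩
  16 ℕ.* suc (suc r) ℕ.* (suc r ℕ.* r ! ℕ.* e) ℕ.+ 64 ℕ.* (suc r ℕ.* suc (suc r)) ℕ.* (r ! ℕ.* f)
    ≡⟨ lem r (r !) e f ⟩
  suc (suc r) ! ℕ.* (16 ℕ.* e ℕ.+ 64 ℕ.* f) ∎
  where
  open ℕ.≤-Reasoning
  lem : ∀ r p e f → 16 ℕ.* suc (suc r) ℕ.* (suc r ℕ.* p ℕ.* e) ℕ.+ 64 ℕ.* (suc r ℕ.* suc (suc r)) ℕ.* (p ℕ.* f)
    ≡ suc (suc r) ℕ.* (suc r ℕ.* p) ℕ.* (16 ℕ.* e ℕ.+ 64 ℕ.* f)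
  lem = ℕ-solve-∀

-- Growth of L and its change under a perturbation of η

module _ (R B n m : ℤ) (2ν≤μ : 2 ℕ.* ∣ n ∣ ℕ.≤ ∣ m ∣) (100b≤ρ : 100 ℕ.* ∣ B ∣ ℕ.≤ ∣ R ∣) where
  private
    ρ b ν μ : ℕ
    ρ = ∣ R ∣
    b = ∣ B ∣
    ν = ∣ n ∣
    μ = ∣ m ∣

  -- The induction closes because 64b² ≤ 100b² ≤ ρ² and 16 · 17 + 1 ≤ 17².
  L-bound : ∀ r → ∣ L R B n m r ∣ ℕ.≤ r ! ℕ.* ((17 ℕ.* ρ) ℕ.^ r ℕ.* μ)
  L-bound zero          = subst (ν ℕ.≤_) (lem μ) (ℕ.≤-trans (ℕ.m≤m+n ν (ν ℕ.+ 0)) 2ν≤μ)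
    where
    lem : ∀ μ → μ ≡ 1 ℕ.* (1 ℕ.* μ)
    lem = ℕ-solve-∀
  L-bound (suc zero)    = begin
    ∣ + 8 * R * n - + 2 * B * m ∣
      ≤⟨ ∣i-j∣≤∣i∣+∣j∣ (+ 8 * R * n) (+ 2 * B * m) ⟩
    ∣ + 8 * R * n ∣ ℕ.+ ∣ + 2 * B * m ∣
      ≡⟨ cong₂ ℕ._+_ (abs-*³ (+ 8) R n) (abs-*³ (+ 2) B m) ⟩
    8 ℕ.* ρ ℕ.* ν ℕ.+ 2 ℕ.* b ℕ.* μ
      ≤⟨ ℕ.m≤m+n _ (98 ℕ.* b ℕ.* μ ℕ.+ 12 ℕ.* ρ ℕ.* μ) ⟩
    8 ℕ.* ρ ℕ.* ν ℕ.+ 2 ℕ.* b ℕ.* μ ℕ.+ (98 ℕ.* b ℕ.* μ ℕ.+ 12 ℕ.* ρ ℕ.* μ)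
      ≡⟨ lem₁ ρ b ν μ ⟩
    4 ℕ.* ρ ℕ.* (2 ℕ.* ν) ℕ.+ (100 ℕ.* b ℕ.* μ ℕ.+ 12 ℕ.* ρ ℕ.* μ)
      ≤⟨ ℕ.+-mono-≤ (ℕ.*-monoʳ-≤ (4 ℕ.* ρ) 2ν≤μ) (ℕ.+-monoˡ-≤ (12 ℕ.* ρ ℕ.* μ) (ℕ.*-monoˡ-≤ μ 100b≤ρ)) ⟩
    4 ℕ.* ρ ℕ.* μ ℕ.+ (ρ ℕ.* μ ℕ.+ 12 ℕ.* ρ ℕ.* μ)
      ≡⟨ lem₂ ρ μ ⟩
    1 ℕ.* (17 ℕ.* ρ ℕ.* 1 ℕ.* μ) ∎
    where
    open ℕ.≤-Reasoning
    lem₁ : ∀ ρ b ν μ → 8 ℕ.* ρ ℕ.* ν ℕ.+ 2 ℕ.* b ℕ.* μ ℕ.+ (98 ℕ.* b ℕ.* μ ℕ.+ 12 ℕ.* ρ ℕ.* μ)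
      ≡ 4 ℕ.* ρ ℕ.* (2 ℕ.* ν) ℕ.+ (100 ℕ.* b ℕ.* μ ℕ.+ 12 ℕ.* ρ ℕ.* μ)
    lem₁ = ℕ-solve-∀
    lem₂ : ∀ ρ μ → 4 ℕ.* ρ ℕ.* μ ℕ.+ (ρ ℕ.* μ ℕ.+ 12 ℕ.* ρ ℕ.* μ) ≡ 1 ℕ.* (17 ℕ.* ρ ℕ.* 1 ℕ.* μ)
    lem₂ = ℕ-solve-∀
  L-bound (suc (suc r)) = begin
    ∣ coeff₁ r * R * L R B n m (suc r) + coeff₀ r * (B * B) * L R B n m r ∣
      ≡⟨ cong₂ (λ x y → ∣ x + y ∣) (*-assoc (coeff₁ r) R (L R B n m (suc r))) (*-assoc (coeff₀ r) (B * B) (L R B n m r)) ⟩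
    ∣ coeff₁ r * (R * L R B n m (suc r)) + coeff₀ r * (B * B * L R B n m r) ∣
      ≤⟨ step-bound r (bound R (suc r) (L-bound (suc r)))
           (subst (λ x → ∣ B * B * L R B n m r ∣ ℕ.≤ r ! ℕ.* (x ℕ.* ((17 ℕ.* ρ) ℕ.^ r ℕ.* μ))) (abs-* B B) (bound (B * B) r (L-bound r))) ⟩
    suc (suc r) ! ℕ.* (16 ℕ.* (ρ ℕ.* (17 ℕ.* ρ ℕ.* e ℕ.* μ)) ℕ.+ 64 ℕ.* (b ℕ.* b ℕ.* (e ℕ.* μ)))
      ≤⟨ ℕ.*-monoʳ-≤ (suc (suc r) !) inner ⟩
    suc (suc r) ! ℕ.* (17 ℕ.* ρ ℕ.* (17 ℕ.* ρ ℕ.* e) ℕ.* μ) ∎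
    where
    open ℕ.≤-Reasoning
    e : ℕ
    e = (17 ℕ.* ρ) ℕ.^ r
    bound : ∀ c s {E} → ∣ L R B n m s ∣ ℕ.≤ s ! ℕ.* E → ∣ c * L R B n m s ∣ ℕ.≤ s ! ℕ.* (∣ c ∣ ℕ.* E)
    bound c s {E} h = subst₂ ℕ._≤_ (sym (abs-* c (L R B n m s))) (lem ∣ c ∣ (s !) E) (ℕ.*-monoʳ-≤ ∣ c ∣ h)
      where
      lem : ∀ c f e → c ℕ.* (f ℕ.* e) ≡ f ℕ.* (c ℕ.* e)
      lem = ℕ-solve-∀
    10b≤ρ : 10 ℕ.* b ℕ.≤ ρ
    10b≤ρ = ℕ.≤-trans (ℕ.*-monoˡ-≤ b (ℕ.m≤m+n 10 90)) 100b≤ρ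
    inner : 16 ℕ.* (ρ ℕ.* (17 ℕ.* ρ ℕ.* e ℕ.* μ)) ℕ.+ 64 ℕ.* (b ℕ.* b ℕ.* (e ℕ.* μ)) ℕ.≤ 17 ℕ.* ρ ℕ.* (17 ℕ.* ρ ℕ.* e) ℕ.* μ
    inner = begin
      16 ℕ.* (ρ ℕ.* (17 ℕ.* ρ ℕ.* e ℕ.* μ)) ℕ.+ 64 ℕ.* (b ℕ.* b ℕ.* (e ℕ.* μ))
        ≤⟨ ℕ.m≤m+n _ (36 ℕ.* (b ℕ.* b ℕ.* (e ℕ.* μ))) ⟩
      16 ℕ.* (ρ ℕ.* (17 ℕ.* ρ ℕ.* e ℕ.* μ)) ℕ.+ 64 ℕ.* (b ℕ.* b ℕ.* (e ℕ.* μ)) ℕ.+ 36 ℕ.* (b ℕ.* b ℕ.* (e ℕ.* μ))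
        ≡⟨ lem₁ ρ b e μ ⟩
      272 ℕ.* (ρ ℕ.* ρ) ℕ.* (e ℕ.* μ) ℕ.+ 10 ℕ.* b ℕ.* (10 ℕ.* b) ℕ.* (e ℕ.* μ)
        ≤⟨ ℕ.+-monoʳ-≤ _ (ℕ.*-monoˡ-≤ (e ℕ.* μ) (ℕ.*-mono-≤ 10b≤ρ 10b≤ρ)) ⟩
      272 ℕ.* (ρ ℕ.* ρ) ℕ.* (e ℕ.* μ) ℕ.+ ρ ℕ.* ρ ℕ.* (e ℕ.* μ)
        ≤⟨ ℕ.m≤m+n _ (16 ℕ.* (ρ ℕ.* ρ ℕ.* (e ℕ.* μ))) ⟩
      272 ℕ.* (ρ ℕ.* ρ) ℕ.* (e ℕ.* μ) ℕ.+ ρ ℕ.* ρ ℕ.* (e ℕ.* μ) ℕ.+ 16 ℕ.* (ρ ℕ.* ρ ℕ.* (e ℕ.* μ))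
        ≡⟨ lem₂ ρ e μ ⟩
      17 ℕ.* ρ ℕ.* (17 ℕ.* ρ ℕ.* e) ℕ.* μ ∎
      where
      lem₁ : ∀ ρ b e μ → 16 ℕ.* (ρ ℕ.* (17 ℕ.* ρ ℕ.* e ℕ.* μ)) ℕ.+ 64 ℕ.* (b ℕ.* b ℕ.* (e ℕ.* μ)) ℕ.+ 36 ℕ.* (b ℕ.* b ℕ.* (e ℕ.* μ))
        ≡ 272 ℕ.* (ρ ℕ.* ρ) ℕ.* (e ℕ.* μ) ℕ.+ 10 ℕ.* b ℕ.* (10 ℕ.* b) ℕ.* (e ℕ.* μ)
      lem₁ = ℕ-solve-∀
      lem₂ : ∀ ρ e μ → 272 ℕ.* (ρ ℕ.* ρ) ℕ.* (e ℕ.* μ) ℕ.+ ρ ℕ.* ρ ℕ.* (e ℕ.* μ) ℕ.+ 16 ℕ.* (ρ ℕ.* ρ ℕ.* (e ℕ.* μ))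
        ≡ 17 ℕ.* ρ ℕ.* (17 ℕ.* ρ ℕ.* e) ℕ.* μ
      lem₂ = ℕ-solve-∀

module _ (R B R′ B′ n m : ℤ) (∣B′∣≡∣B∣ : ∣ B′ ∣ ≡ ∣ B ∣) (ρ≤ρ′ : ∣ R ∣ ℕ.≤ ∣ R′ ∣)
         (2ν≤μ : 2 ℕ.* ∣ n ∣ ℕ.≤ ∣ m ∣) (100b≤ρ : 100 ℕ.* ∣ B ∣ ℕ.≤ ∣ R ∣) where
  private
    ρ ρ′ b ν μ Χ : ℕ
    ρ = ∣ R ∣
    ρ′ = ∣ R′ ∣
    b = ∣ B ∣
    ν = ∣ n ∣
    μ = ∣ m ∣
    Χ = 17 ℕ.* (ρ ℕ.* ρ′)

  -- Replacing η by η η̄′ is, up to the factor R′, a small perturbation.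
  A* B* : ℤ
  A* = R * R′ + B * B′
  B* = B * R′ - R * B′

  perturbation unperturbed : ℕ → ℤ
  unperturbed r = R′ ^ r * L R B n m r
  perturbation r = L A* B* n m r - unperturbed r

  unperturbed-bound : ∀ r → ∣ unperturbed r ∣ ℕ.≤ r ! ℕ.* (Χ ℕ.^ r ℕ.* μ)
  unperturbed-bound r = begin
    ∣ R′ ^ r * L R B n m r ∣
      ≡⟨ trans (abs-* (R′ ^ r) (L R B n m r)) (cong (ℕ._* ∣ L R B n m r ∣) (abs-^ R′ r)) ⟩
    ρ′ ℕ.^ r ℕ.* ∣ L R B n m r ∣
      ≤⟨ ℕ.*-monoʳ-≤ (ρ′ ℕ.^ r) (L-bound R B n m 2ν≤μ 100b≤ρ r) ⟩
    ρ′ ℕ.^ r ℕ.* (r ! ℕ.* ((17 ℕ.* ρ) ℕ.^ r ℕ.* μ))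
      ≡⟨ lem (ρ′ ℕ.^ r) (r !) ((17 ℕ.* ρ) ℕ.^ r) μ ⟩
    r ! ℕ.* ((17 ℕ.* ρ) ℕ.^ r ℕ.* ρ′ ℕ.^ r ℕ.* μ)
      ≡⟨ cong (λ x → r ! ℕ.* (x ℕ.* μ)) (trans (sym (^-distribʳ-* r (17 ℕ.* ρ) ρ′)) (cong (ℕ._^ r) (ℕ.*-assoc 17 ρ ρ′))) ⟩
    r ! ℕ.* (Χ ℕ.^ r ℕ.* μ) ∎
    where
    open ℕ.≤-Reasoning
    lem : ∀ p f x u → p ℕ.* (f ℕ.* (x ℕ.* u)) ≡ f ℕ.* (x ℕ.* p ℕ.* u)
    lem = ℕ-solve-∀

  -- What is left of the two terms of the recurrence after subtracting its unperturbed form,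
  -- multiplied by R′: A* differs from RR′ by BB′, and B*² from (BR′)² by RB′(RB′ - 2BR′).
  x-term y-term : ℕ → ℤ
  x-term r = A* * (R′ * perturbation (suc r)) + R′ * (B * B′) * unperturbed (suc r)
  y-term r = B* * B* * (R′ * perturbation r) + R′ * (R * B′ * (R * B′ - + 2 * (B * R′))) * unperturbed r

  perturbation-recurrence : ∀ r → R′ * perturbation (suc (suc r)) ≡ coeff₁ r * x-term r + coeff₀ r * y-term r
  perturbation-recurrence r = lem (coeff₁ r) (coeff₀ r) R B R′ B′ (R′ ^ r) (L A* B* n m (suc r)) (L A* B* n m r) (L R B n m (suc r)) (L R B n m r)
    where
    lem : ∀ coeff₁ coeff₀ R B R′ B′ e a₁ a₀ l₁ l₀ → let A = R * R′ + B * B′ ; B* = B * R′ - R * B′ in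
      R′ * (coeff₁ * A * a₁ + coeff₀ * (B* * B*) * a₀ - R′ * (R′ * e) * (coeff₁ * R * l₁ + coeff₀ * (B * B) * l₀))
      ≡ coeff₁ * (A * (R′ * (a₁ - R′ * e * l₁)) + R′ * (B * B′) * (R′ * e * l₁))
        + coeff₀ * (B* * B* * (R′ * (a₀ - e * l₀)) + R′ * (R * B′ * (R * B′ - + 2 * (B * R′))) * (e * l₀))
    lem = solve-∀

  private
    ∣A*∣≤ : ∣ A* ∣ ℕ.≤ ρ ℕ.* ρ′ ℕ.+ b ℕ.* b
    ∣A*∣≤ = ℕ.≤-trans (∣i+j∣≤∣i∣+∣j∣ (R * R′) (B * B′))
      (ℕ.≤-reflexive (cong₂ ℕ._+_ (abs-* R R′) (trans (abs-* B B′) (cong (b ℕ.*_) ∣B′∣≡∣B∣))))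

    ∣B*∣≤ : ∣ B* ∣ ℕ.≤ b ℕ.* ρ′ ℕ.+ ρ ℕ.* b
    ∣B*∣≤ = ℕ.≤-trans (∣i-j∣≤∣i∣+∣j∣ (B * R′) (R * B′))
      (ℕ.≤-reflexive (cong₂ ℕ._+_ (abs-* B R′) (trans (abs-* R B′) (cong (ρ ℕ.*_) ∣B′∣≡∣B∣))))

    product-sum : ∀ u v w x {U W} f X Y → ∣ u ∣ ℕ.≤ U → ∣ w ∣ ℕ.≤ W → ∣ v ∣ ℕ.≤ f ℕ.* X → ∣ x ∣ ℕ.≤ f ℕ.* Y →
      ∣ u * v + w * x ∣ ℕ.≤ f ℕ.* (U ℕ.* X ℕ.+ W ℕ.* Y)
    product-sum u v w x {U} {W} f X Y hu hw hv hx = begin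
      ∣ u * v + w * x ∣                            ≤⟨ ∣i+j∣≤∣i∣+∣j∣ (u * v) (w * x) ⟩
      ∣ u * v ∣ ℕ.+ ∣ w * x ∣                      ≡⟨ cong₂ ℕ._+_ (abs-* u v) (abs-* w x) ⟩
      ∣ u ∣ ℕ.* ∣ v ∣ ℕ.+ ∣ w ∣ ℕ.* ∣ x ∣          ≤⟨ ℕ.+-mono-≤ (ℕ.*-mono-≤ hu hv) (ℕ.*-mono-≤ hw hx) ⟩
      U ℕ.* (f ℕ.* X) ℕ.+ W ℕ.* (f ℕ.* Y)          ≡⟨ lem U W f X Y ⟩
      f ℕ.* (U ℕ.* X ℕ.+ W ℕ.* Y)                  ∎
      where
      open ℕ.≤-Reasoning
      lem : ∀ U W f X Y → U ℕ.* (f ℕ.* X) ℕ.+ W ℕ.* (f ℕ.* Y) ≡ f ℕ.* (U ℕ.* X ℕ.+ W ℕ.* Y)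
      lem = ℕ-solve-∀

  -- The relative error is about b/ρ′; the extra factor `R′` keeps the statement integral. Order 0
  -- has no error, and every term by which the recurrence feeds new error contains a factor B′,
  -- hence the b on the right.
  perturbation-bound : ∀ r → ∣ R′ * perturbation r ∣ ℕ.≤ r ! ℕ.* (Χ ℕ.^ r ℕ.* (b ℕ.* μ))
  perturbation-bound zero          = subst (λ x → ∣ x ∣ ℕ.≤ 1 ℕ.* (1 ℕ.* (b ℕ.* μ))) (lem R′ n) ℕ.z≤n
    where
    lem : ∀ r n → + 0 ≡ r * (n - + 1 * n)
    lem = solve-∀
  perturbation-bound (suc zero)    = begin
    ∣ R′ * perturbation 1 ∣
      ≡⟨ trans (cong ∣_∣ (lem R B R′ B′ n m)) (abs-* R′ (+ 8 * (B * B′) * n + + 2 * (R * B′) * m)) ⟩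
    ρ′ ℕ.* ∣ + 8 * (B * B′) * n + + 2 * (R * B′) * m ∣
      ≤⟨ ℕ.*-monoʳ-≤ ρ′ (∣i+j∣≤∣i∣+∣j∣ (+ 8 * (B * B′) * n) (+ 2 * (R * B′) * m)) ⟩
    ρ′ ℕ.* (∣ + 8 * (B * B′) * n ∣ ℕ.+ ∣ + 2 * (R * B′) * m ∣)
      ≡⟨ cong₂ (λ x y → ρ′ ℕ.* (x ℕ.+ y))
           (trans (abs-*³ (+ 8) (B * B′) n) (cong (λ x → 8 ℕ.* x ℕ.* ν) (trans (abs-* B B′) (cong (b ℕ.*_) ∣B′∣≡∣B∣))))
           (trans (abs-*³ (+ 2) (R * B′) m) (cong (λ x → 2 ℕ.* x ℕ.* μ) (trans (abs-* R B′) (cong (ρ ℕ.*_) ∣B′∣≡∣B∣)))) ⟩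
    ρ′ ℕ.* (8 ℕ.* (b ℕ.* b) ℕ.* ν ℕ.+ 2 ℕ.* (ρ ℕ.* b) ℕ.* μ)
      ≡⟨ lem₁ ρ′ b ν ρ μ ⟩
    ρ′ ℕ.* (4 ℕ.* (b ℕ.* b) ℕ.* (2 ℕ.* ν) ℕ.+ 2 ℕ.* (ρ ℕ.* b) ℕ.* μ)
      ≤⟨ ℕ.*-monoʳ-≤ ρ′ (ℕ.+-monoˡ-≤ _ (ℕ.*-mono-≤ (ℕ.*-monoʳ-≤ 4 (ℕ.*-monoˡ-≤ b b≤ρ)) 2ν≤μ)) ⟩
    ρ′ ℕ.* (4 ℕ.* (ρ ℕ.* b) ℕ.* μ ℕ.+ 2 ℕ.* (ρ ℕ.* b) ℕ.* μ)
      ≤⟨ ℕ.m≤m+n _ (11 ℕ.* (ρ′ ℕ.* (ρ ℕ.* b) ℕ.* μ)) ⟩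
    ρ′ ℕ.* (4 ℕ.* (ρ ℕ.* b) ℕ.* μ ℕ.+ 2 ℕ.* (ρ ℕ.* b) ℕ.* μ) ℕ.+ 11 ℕ.* (ρ′ ℕ.* (ρ ℕ.* b) ℕ.* μ)
      ≡⟨ lem₂ ρ′ ρ b μ ⟩
    1 ℕ.* (Χ ℕ.* 1 ℕ.* (b ℕ.* μ)) ∎
    where
    open ℕ.≤-Reasoning
    b≤ρ : b ℕ.≤ ρ
    b≤ρ = ℕ.≤-trans (ℕ.m≤m+n b (99 ℕ.* b)) 100b≤ρ
    lem : ∀ R B R′ B′ n m →
      R′ * (+ 8 * (R * R′ + B * B′) * n - + 2 * (B * R′ - R * B′) * m - R′ * + 1 * (+ 8 * R * n - + 2 * B * m))
      ≡ R′ * (+ 8 * (B * B′) * n + + 2 * (R * B′) * m)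
    lem = solve-∀
    lem₁ : ∀ p b v r u → p ℕ.* (8 ℕ.* (b ℕ.* b) ℕ.* v ℕ.+ 2 ℕ.* (r ℕ.* b) ℕ.* u)
      ≡ p ℕ.* (4 ℕ.* (b ℕ.* b) ℕ.* (2 ℕ.* v) ℕ.+ 2 ℕ.* (r ℕ.* b) ℕ.* u)
    lem₁ = ℕ-solve-∀
    lem₂ : ∀ p r b u → p ℕ.* (4 ℕ.* (r ℕ.* b) ℕ.* u ℕ.+ 2 ℕ.* (r ℕ.* b) ℕ.* u) ℕ.+ 11 ℕ.* (p ℕ.* (r ℕ.* b) ℕ.* u)
      ≡ 1 ℕ.* (17 ℕ.* (r ℕ.* p) ℕ.* 1 ℕ.* (b ℕ.* u))
    lem₂ = ℕ-solve-∀
  perturbation-bound (suc (suc r)) = step (perturbation-bound (suc r)) (perturbation-bound r)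
    where
    step : ∣ R′ * perturbation (suc r) ∣ ℕ.≤ suc r ! ℕ.* (Χ ℕ.^ suc r ℕ.* (b ℕ.* μ)) → ∣ R′ * perturbation r ∣ ℕ.≤ r ! ℕ.* (Χ ℕ.^ r ℕ.* (b ℕ.* μ)) →
      ∣ R′ * perturbation (suc (suc r)) ∣ ℕ.≤ suc (suc r) ! ℕ.* (Χ ℕ.^ suc (suc r) ℕ.* (b ℕ.* μ))
    step ih₁ ih₀ = begin
      ∣ R′ * perturbation (suc (suc r)) ∣
        ≡⟨ cong ∣_∣ (perturbation-recurrence r) ⟩
      ∣ coeff₁ r * x-term r + coeff₀ r * y-term r ∣
        ≤⟨ step-bound r x≤ y≤ ⟩
      suc (suc r) ! ℕ.* (16 ℕ.* ((ρ ℕ.* ρ′ ℕ.+ b ℕ.* b) ℕ.* (Χ ℕ.* e ℕ.* (b ℕ.* μ)) ℕ.+ ρ′ ℕ.* (b ℕ.* b) ℕ.* (Χ ℕ.* e ℕ.* μ))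
        ℕ.+ 64 ℕ.* ((b ℕ.* ρ′ ℕ.+ ρ ℕ.* b) ℕ.* (b ℕ.* ρ′ ℕ.+ ρ ℕ.* b) ℕ.* (e ℕ.* (b ℕ.* μ))
                    ℕ.+ ρ′ ℕ.* (ρ ℕ.* b ℕ.* (ρ ℕ.* b ℕ.+ 2 ℕ.* (b ℕ.* ρ′))) ℕ.* (e ℕ.* μ)))
        ≡⟨ cong (suc (suc r) ! ℕ.*_) (lem₁ Χ e b μ ρ ρ′) ⟩
      suc (suc r) ! ℕ.* ((16 ℕ.* Χ ℕ.* (ρ ℕ.* ρ′ ℕ.+ b ℕ.* b ℕ.+ b ℕ.* ρ′)
        ℕ.+ 64 ℕ.* ((b ℕ.* ρ′ ℕ.+ ρ ℕ.* b) ℕ.* (b ℕ.* ρ′ ℕ.+ ρ ℕ.* b) ℕ.+ ρ′ ℕ.* (ρ ℕ.* (ρ ℕ.* b ℕ.+ 2 ℕ.* (b ℕ.* ρ′))))) ℕ.* (e ℕ.* (b ℕ.* μ)))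
        ≤⟨ ℕ.*-monoʳ-≤ (suc (suc r) !) (ℕ.*-monoˡ-≤ (e ℕ.* (b ℕ.* μ)) (perturbation-≤ b ρ ρ′ 100b≤ρ ρ≤ρ′)) ⟩
      suc (suc r) ! ℕ.* (Χ ℕ.* Χ ℕ.* (e ℕ.* (b ℕ.* μ)))
        ≡⟨ cong (suc (suc r) ! ℕ.*_) (lem₂ Χ e (b ℕ.* μ)) ⟩
      suc (suc r) ! ℕ.* (Χ ℕ.* (Χ ℕ.* e) ℕ.* (b ℕ.* μ)) ∎
      where
      open ℕ.≤-Reasoning
      e : ℕ
      e = Χ ℕ.^ r
      x≤ : ∣ x-term r ∣ ℕ.≤ suc r ! ℕ.* ((ρ ℕ.* ρ′ ℕ.+ b ℕ.* b) ℕ.* (Χ ℕ.* e ℕ.* (b ℕ.* μ)) ℕ.+ ρ′ ℕ.* (b ℕ.* b) ℕ.* (Χ ℕ.* e ℕ.* μ))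
      x≤ = product-sum A* (R′ * perturbation (suc r)) (R′ * (B * B′)) (unperturbed (suc r)) (suc r !) (Χ ℕ.* e ℕ.* (b ℕ.* μ)) (Χ ℕ.* e ℕ.* μ)
        ∣A*∣≤ (ℕ.≤-reflexive (trans (abs-* R′ (B * B′)) (cong (ρ′ ℕ.*_) (trans (abs-* B B′) (cong (b ℕ.*_) ∣B′∣≡∣B∣)))))
        ih₁ (unperturbed-bound (suc r))
      y≤ : ∣ y-term r ∣ ℕ.≤ r ! ℕ.* ((b ℕ.* ρ′ ℕ.+ ρ ℕ.* b) ℕ.* (b ℕ.* ρ′ ℕ.+ ρ ℕ.* b) ℕ.* (e ℕ.* (b ℕ.* μ))
                    ℕ.+ ρ′ ℕ.* (ρ ℕ.* b ℕ.* (ρ ℕ.* b ℕ.+ 2 ℕ.* (b ℕ.* ρ′))) ℕ.* (e ℕ.* μ))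
      y≤ = product-sum (B* * B*) (R′ * perturbation r) (R′ * (R * B′ * (R * B′ - + 2 * (B * R′)))) (unperturbed r) (r !) (e ℕ.* (b ℕ.* μ)) (e ℕ.* μ)
        (ℕ.≤-trans (ℕ.≤-reflexive (abs-* B* B*)) (ℕ.*-mono-≤ ∣B*∣≤ ∣B*∣≤))
        (begin
          ∣ R′ * (R * B′ * (R * B′ - + 2 * (B * R′))) ∣
            ≡⟨ trans (abs-* R′ (R * B′ * (R * B′ - + 2 * (B * R′)))) (cong (ρ′ ℕ.*_) (abs-* (R * B′) (R * B′ - + 2 * (B * R′)))) ⟩
          ρ′ ℕ.* (∣ R * B′ ∣ ℕ.* ∣ R * B′ - + 2 * (B * R′) ∣)
            ≤⟨ ℕ.*-monoʳ-≤ ρ′ (ℕ.*-monoʳ-≤ ∣ R * B′ ∣ (∣i-j∣≤∣i∣+∣j∣ (R * B′) (+ 2 * (B * R′)))) ⟩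
          ρ′ ℕ.* (∣ R * B′ ∣ ℕ.* (∣ R * B′ ∣ ℕ.+ ∣ + 2 * (B * R′) ∣))
            ≡⟨ cong₂ (λ x y → ρ′ ℕ.* (x ℕ.* (x ℕ.+ y))) (trans (abs-* R B′) (cong (ρ ℕ.*_) ∣B′∣≡∣B∣))
                 (trans (abs-* (+ 2) (B * R′)) (cong (2 ℕ.*_) (abs-* B R′))) ⟩
          ρ′ ℕ.* (ρ ℕ.* b ℕ.* (ρ ℕ.* b ℕ.+ 2 ℕ.* (b ℕ.* ρ′))) ∎)
        ih₀ (unperturbed-bound r)
      lem₁ : ∀ Χ e b μ ρ ρ′ →
        16 ℕ.* ((ρ ℕ.* ρ′ ℕ.+ b ℕ.* b) ℕ.* (Χ ℕ.* e ℕ.* (b ℕ.* μ)) ℕ.+ ρ′ ℕ.* (b ℕ.* b) ℕ.* (Χ ℕ.* e ℕ.* μ))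
        ℕ.+ 64 ℕ.* ((b ℕ.* ρ′ ℕ.+ ρ ℕ.* b) ℕ.* (b ℕ.* ρ′ ℕ.+ ρ ℕ.* b) ℕ.* (e ℕ.* (b ℕ.* μ))
                    ℕ.+ ρ′ ℕ.* (ρ ℕ.* b ℕ.* (ρ ℕ.* b ℕ.+ 2 ℕ.* (b ℕ.* ρ′))) ℕ.* (e ℕ.* μ))
        ≡ (16 ℕ.* Χ ℕ.* (ρ ℕ.* ρ′ ℕ.+ b ℕ.* b ℕ.+ b ℕ.* ρ′)
        ℕ.+ 64 ℕ.* ((b ℕ.* ρ′ ℕ.+ ρ ℕ.* b) ℕ.* (b ℕ.* ρ′ ℕ.+ ρ ℕ.* b) ℕ.+ ρ′ ℕ.* (ρ ℕ.* (ρ ℕ.* b ℕ.+ 2 ℕ.* (b ℕ.* ρ′))))) ℕ.* (e ℕ.* (b ℕ.* μ))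
      lem₁ = ℕ-solve-∀
      lem₂ : ∀ x e u → x ℕ.* x ℕ.* (e ℕ.* u) ≡ x ℕ.* (x ℕ.* e) ℕ.* u
      lem₂ = ℕ-solve-∀

-- By homogeneity L at σηη̄′ is L at Dx⁴, so σʳR′ʳL(η) is DʳL(x⁴) minus the perturbation. The first
-- part is small by `L-at-fourth-power-bound`, the second by `perturbation-bound`; the common factor
-- sʳρ′ʳ cancels at the end.
main-inequality : ∀ (R B R′ B′ n m : ℤ) (D : ℕ) (σ : ℤ) →
  ∣ B′ ∣ ≡ ∣ B ∣ → ∣ R ∣ ℕ.≤ ∣ R′ ∣ → 2 ℕ.* ∣ n ∣ ℕ.≤ ∣ m ∣ → 100 ℕ.* ∣ B ∣ ℕ.≤ ∣ R ∣ →
  + D * Re⁴ m n ≡ σ * (R * R′ + B * B′) → + D * Im⁴ m n ≡ σ * (B * R′ - R * B′) →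
  ℕ.NonZero ∣ σ ∣ → ℕ.NonZero ∣ R′ ∣ →
  let ρ = ∣ R ∣ ; ρ′ = ∣ R′ ∣ ; b = ∣ B ∣ ; ν = ∣ n ∣ ; μ = ∣ m ∣ in
  64 ℕ.* D ℕ.* (ν ℕ.* ν) ℕ.* (μ ℕ.* μ ℕ.+ ν ℕ.* ν) ℕ.* ρ ℕ.≤ 5 ℕ.* ∣ σ ∣ ℕ.* (b ℕ.* b) ℕ.* ρ′ →
  ∀ r → ρ ℕ.^ r ℕ.* ρ′ ℕ.* ∣ L R B n m r ∣
    ℕ.≤ r ! ℕ.* (ν ℕ.* (5 ℕ.* (b ℕ.* b)) ℕ.^ r ℕ.* ρ′ ℕ.+ ρ ℕ.^ r ℕ.* (17 ℕ.* ρ) ℕ.^ r ℕ.* (b ℕ.* μ))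
main-inequality R B R′ B′ n m D σ ∣B′∣≡∣B∣ ρ≤ρ′ 2ν≤μ 100b≤ρ re im σ≢0 ρ′≢0 small r =
  ℕ.*-cancelˡ-≤ (s ℕ.^ r ℕ.* ρ′ ℕ.^ r) {{ℕ.m*n≢0 (s ℕ.^ r) (ρ′ ℕ.^ r) {{ℕ.m^n≢0 s r {{σ≢0}}}} {{ℕ.m^n≢0 ρ′ r {{ρ′≢0}}}}}} (begin
  s ℕ.^ r ℕ.* ρ′ ℕ.^ r ℕ.* (ρ ℕ.^ r ℕ.* ρ′ ℕ.* l)
    ≡⟨ lem₁ (s ℕ.^ r) (ρ′ ℕ.^ r) (ρ ℕ.^ r) ρ′ l ⟩
  ρ ℕ.^ r ℕ.* (s ℕ.^ r ℕ.* (ρ′ ℕ.^ r ℕ.* l) ℕ.* ρ′)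
    ≡⟨ cong (ρ ℕ.^ r ℕ.*_) abs-left ⟨
  ρ ℕ.^ r ℕ.* ∣ σ ^ r * unperturbed R B R′ B′ n m ∣B′∣≡∣B∣ ρ≤ρ′ 2ν≤μ 100b≤ρ r * R′ ∣
    ≤⟨ ℕ.*-monoʳ-≤ (ρ ℕ.^ r) triangle ⟩
  ρ ℕ.^ r ℕ.* (D ℕ.^ r ℕ.* l̃ ℕ.* ρ′ ℕ.+ s ℕ.^ r ℕ.* ∣ R′ * Δ′ ∣)
    ≡⟨ lem₂ (ρ ℕ.^ r) (D ℕ.^ r) l̃ ρ′ (s ℕ.^ r) ∣ R′ * Δ′ ∣ ⟩
  ρ ℕ.^ r ℕ.* D ℕ.^ r ℕ.* l̃ ℕ.* ρ′ ℕ.+ ρ ℕ.^ r ℕ.* s ℕ.^ r ℕ.* ∣ R′ * Δ′ ∣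
    ≤⟨ ℕ.+-mono-≤ (ℕ.*-monoˡ-≤ ρ′ main-term)
         (ℕ.*-monoʳ-≤ (ρ ℕ.^ r ℕ.* s ℕ.^ r) (perturbation-bound R B R′ B′ n m ∣B′∣≡∣B∣ ρ≤ρ′ 2ν≤μ 100b≤ρ r)) ⟩
  r ! ℕ.* ν ℕ.* (5 ℕ.* s ℕ.* (b ℕ.* b) ℕ.* ρ′) ℕ.^ r ℕ.* ρ′ ℕ.+ ρ ℕ.^ r ℕ.* s ℕ.^ r ℕ.* (r ! ℕ.* ((17 ℕ.* (ρ ℕ.* ρ′)) ℕ.^ r ℕ.* (b ℕ.* μ)))
    ≡⟨ cong₂ (λ x y → r ! ℕ.* ν ℕ.* x ℕ.* ρ′ ℕ.+ ρ ℕ.^ r ℕ.* s ℕ.^ r ℕ.* (r ! ℕ.* (y ℕ.* (b ℕ.* μ)))) power₁ power₂ ⟩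
  r ! ℕ.* ν ℕ.* ((5 ℕ.* (b ℕ.* b)) ℕ.^ r ℕ.* (s ℕ.^ r ℕ.* ρ′ ℕ.^ r)) ℕ.* ρ′
    ℕ.+ ρ ℕ.^ r ℕ.* s ℕ.^ r ℕ.* (r ! ℕ.* ((17 ℕ.* ρ) ℕ.^ r ℕ.* ρ′ ℕ.^ r ℕ.* (b ℕ.* μ)))
    ≡⟨ lem₃ (r !) ν ((5 ℕ.* (b ℕ.* b)) ℕ.^ r) (s ℕ.^ r) (ρ′ ℕ.^ r) ρ′ (ρ ℕ.^ r) ((17 ℕ.* ρ) ℕ.^ r) (b ℕ.* μ) ⟩
  s ℕ.^ r ℕ.* ρ′ ℕ.^ r ℕ.* (r ! ℕ.* (ν ℕ.* (5 ℕ.* (b ℕ.* b)) ℕ.^ r ℕ.* ρ′ ℕ.+ ρ ℕ.^ r ℕ.* (17 ℕ.* ρ) ℕ.^ r ℕ.* (b ℕ.* μ))) ∎)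
  where
  open ℕ.≤-Reasoning
  ρ ρ′ b ν μ s l l̃ : ℕ
  ρ = ∣ R ∣
  ρ′ = ∣ R′ ∣
  b = ∣ B ∣
  ν = ∣ n ∣
  μ = ∣ m ∣
  s = ∣ σ ∣
  l = ∣ L R B n m r ∣
  l̃ = ∣ L (Re⁴ m n) (Im⁴ m n) n m r ∣
  c′ Δ′ λ* λ̃ : ℤ
  c′ = unperturbed R B R′ B′ n m ∣B′∣≡∣B∣ ρ≤ρ′ 2ν≤μ 100b≤ρ r
  Δ′ = perturbation R B R′ B′ n m ∣B′∣≡∣B∣ ρ≤ρ′ 2ν≤μ 100b≤ρ r
  λ* = L (R * R′ + B * B′) (B * R′ - R * B′) n m r
  λ̃ = L (Re⁴ m n) (Im⁴ m n) n m r
  scaled : σ ^ r * λ* ≡ (+ D) ^ r * λ̃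
  scaled = trans (sym (L-homogeneous σ (R * R′ + B * B′) (B * R′ - R * B′) n m r))
    (trans (cong₂ (λ x y → L x y n m r) (sym re) (sym im)) (L-homogeneous (+ D) (Re⁴ m n) (Im⁴ m n) n m r))
  decompose : σ ^ r * c′ * R′ ≡ (+ D) ^ r * λ̃ * R′ - σ ^ r * (R′ * Δ′)
  decompose = trans (lem (σ ^ r) c′ R′ λ*) (cong (λ x → x * R′ - σ ^ r * (R′ * Δ′)) scaled)
    where
    lem : ∀ e c r l → e * c * r ≡ e * l * r - e * (r * (l - c))
    lem = solve-∀
  abs-left : ∣ σ ^ r * c′ * R′ ∣ ≡ s ℕ.^ r ℕ.* (ρ′ ℕ.^ r ℕ.* l) ℕ.* ρ′
  abs-left = trans (abs-*³ (σ ^ r) c′ R′) (cong₂ (λ x y → x ℕ.* y ℕ.* ρ′) (abs-^ σ r)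
    (trans (abs-* (R′ ^ r) (L R B n m r)) (cong (ℕ._* l) (abs-^ R′ r))))
  triangle : ∣ σ ^ r * c′ * R′ ∣ ℕ.≤ D ℕ.^ r ℕ.* l̃ ℕ.* ρ′ ℕ.+ s ℕ.^ r ℕ.* ∣ R′ * Δ′ ∣
  triangle = begin
    ∣ σ ^ r * c′ * R′ ∣
      ≡⟨ cong ∣_∣ decompose ⟩
    ∣ (+ D) ^ r * λ̃ * R′ - σ ^ r * (R′ * Δ′) ∣
      ≤⟨ ∣i-j∣≤∣i∣+∣j∣ ((+ D) ^ r * λ̃ * R′) (σ ^ r * (R′ * Δ′)) ⟩
    ∣ (+ D) ^ r * λ̃ * R′ ∣ ℕ.+ ∣ σ ^ r * (R′ * Δ′) ∣
      ≡⟨ cong₂ ℕ._+_ (trans (abs-*³ ((+ D) ^ r) λ̃ R′) (cong (λ x → x ℕ.* l̃ ℕ.* ρ′) (abs-^ (+ D) r)))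
           (trans (abs-* (σ ^ r) (R′ * Δ′)) (cong (ℕ._* ∣ R′ * Δ′ ∣) (abs-^ σ r))) ⟩
    D ℕ.^ r ℕ.* l̃ ℕ.* ρ′ ℕ.+ s ℕ.^ r ℕ.* ∣ R′ * Δ′ ∣ ∎
  N : ℕ
  N = μ ℕ.* μ ℕ.+ ν ℕ.* ν
  main-term : ρ ℕ.^ r ℕ.* D ℕ.^ r ℕ.* l̃ ℕ.≤ r ! ℕ.* ν ℕ.* (5 ℕ.* s ℕ.* (b ℕ.* b) ℕ.* ρ′) ℕ.^ r
  main-term = begin
    ρ ℕ.^ r ℕ.* D ℕ.^ r ℕ.* l̃
      ≤⟨ ℕ.*-monoʳ-≤ (ρ ℕ.^ r ℕ.* D ℕ.^ r) (L-at-fourth-power-bound m n r) ⟩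
    ρ ℕ.^ r ℕ.* D ℕ.^ r ℕ.* (r ! ℕ.* ν ℕ.* (64 ℕ.* (ν ℕ.* ν) ℕ.* N) ℕ.^ r)
      ≡⟨ lem₄ (ρ ℕ.^ r) (D ℕ.^ r) (r !) ν ((64 ℕ.* (ν ℕ.* ν) ℕ.* N) ℕ.^ r) ⟩
    r ! ℕ.* ν ℕ.* (D ℕ.^ r ℕ.* (64 ℕ.* (ν ℕ.* ν) ℕ.* N) ℕ.^ r ℕ.* ρ ℕ.^ r)
      ≡⟨ cong (r ! ℕ.* ν ℕ.*_) (trans (cong (ℕ._* ρ ℕ.^ r) (sym (^-distribʳ-* r D (64 ℕ.* (ν ℕ.* ν) ℕ.* N))))
           (sym (^-distribʳ-* r (D ℕ.* (64 ℕ.* (ν ℕ.* ν) ℕ.* N)) ρ))) ⟩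
    r ! ℕ.* ν ℕ.* (D ℕ.* (64 ℕ.* (ν ℕ.* ν) ℕ.* N) ℕ.* ρ) ℕ.^ r
      ≡⟨ cong (λ x → r ! ℕ.* ν ℕ.* x ℕ.^ r) (lem₅ D (ν ℕ.* ν) N ρ) ⟩
    r ! ℕ.* ν ℕ.* (64 ℕ.* D ℕ.* (ν ℕ.* ν) ℕ.* N ℕ.* ρ) ℕ.^ r
      ≤⟨ ℕ.*-monoʳ-≤ (r ! ℕ.* ν) (ℕ.^-monoˡ-≤ r small) ⟩
    r ! ℕ.* ν ℕ.* (5 ℕ.* s ℕ.* (b ℕ.* b) ℕ.* ρ′) ℕ.^ r ∎
    where
    lem₄ : ∀ p d f v x → p ℕ.* d ℕ.* (f ℕ.* v ℕ.* x) ≡ f ℕ.* v ℕ.* (d ℕ.* x ℕ.* p)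
    lem₄ = ℕ-solve-∀
    lem₅ : ∀ d v x p → d ℕ.* (64 ℕ.* v ℕ.* x) ℕ.* p ≡ 64 ℕ.* d ℕ.* v ℕ.* x ℕ.* p
    lem₅ = ℕ-solve-∀
  power₁ : (5 ℕ.* s ℕ.* (b ℕ.* b) ℕ.* ρ′) ℕ.^ r ≡ (5 ℕ.* (b ℕ.* b)) ℕ.^ r ℕ.* (s ℕ.^ r ℕ.* ρ′ ℕ.^ r)
  power₁ = trans (cong (ℕ._^ r) (lem s (b ℕ.* b) ρ′))
    (trans (^-distribʳ-* r (5 ℕ.* (b ℕ.* b)) (s ℕ.* ρ′)) (cong ((5 ℕ.* (b ℕ.* b)) ℕ.^ r ℕ.*_) (^-distribʳ-* r s ρ′)))
    where
    lem : ∀ s x p → 5 ℕ.* s ℕ.* x ℕ.* p ≡ 5 ℕ.* x ℕ.* (s ℕ.* p)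
    lem = ℕ-solve-∀
  power₂ : (17 ℕ.* (ρ ℕ.* ρ′)) ℕ.^ r ≡ (17 ℕ.* ρ) ℕ.^ r ℕ.* ρ′ ℕ.^ r
  power₂ = trans (cong (ℕ._^ r) (sym (ℕ.*-assoc 17 ρ ρ′))) (^-distribʳ-* r (17 ℕ.* ρ) ρ′)
  lem₁ : ∀ s p′ p q l → s ℕ.* p′ ℕ.* (p ℕ.* q ℕ.* l) ≡ p ℕ.* (s ℕ.* (p′ ℕ.* l) ℕ.* q)
  lem₁ = ℕ-solve-∀
  lem₂ : ∀ p d l q s x → p ℕ.* (d ℕ.* l ℕ.* q ℕ.+ s ℕ.* x) ≡ p ℕ.* d ℕ.* l ℕ.* q ℕ.+ p ℕ.* s ℕ.* x
  lem₂ = ℕ-solve-∀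
  lem₃ : ∀ f v x s p′ q p y u → f ℕ.* v ℕ.* (x ℕ.* (s ℕ.* p′)) ℕ.* q ℕ.+ p ℕ.* s ℕ.* (f ℕ.* (y ℕ.* p′ ℕ.* u))
    ≡ s ℕ.* p′ ℕ.* (f ℕ.* (v ℕ.* x ℕ.* q ℕ.+ p ℕ.* y ℕ.* u))
  lem₃ = ℕ-solve-∀

-- Contradiction from two large solutions

module NoApproximation (R B R′ B′ n m : ℤ) (D : ℕ) (σ : ℤ) (H : ℕ)
  (∣B′∣≡∣B∣ : ∣ B′ ∣ ≡ ∣ B ∣) (0<b : 0 ℕ.< ∣ B ∣) (0<ν : 0 ℕ.< ∣ n ∣)
  (0<s : 0 ℕ.< ∣ σ ∣) (s≤4 : ∣ σ ∣ ℕ.≤ 4)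
  (bb≤D : ∣ B ∣ ℕ.* ∣ B ∣ ℕ.≤ D)
  (225bbb≤ρ : 225 ℕ.* (∣ B ∣ ℕ.* ∣ B ∣ ℕ.* ∣ B ∣) ℕ.≤ ∣ R ∣)
  (1100b≤ρ : 1100 ℕ.* ∣ B ∣ ℕ.≤ ∣ R ∣) (1000ρ≤ρ′ : 1000 ℕ.* ∣ R ∣ ℕ.≤ ∣ R′ ∣)
  (2ν≤μ : 2 ℕ.* ∣ n ∣ ℕ.≤ ∣ m ∣)
  (re : + D * Re⁴ m n ≡ σ * (R * R′ + B * B′)) (im : + D * Im⁴ m n ≡ σ * (B * R′ - R * B′))
  (norm : D ℕ.* ((∣ m ∣ ℕ.* ∣ m ∣ ℕ.+ ∣ n ∣ ℕ.* ∣ n ∣) ℕ.* (∣ m ∣ ℕ.* ∣ m ∣ ℕ.+ ∣ n ∣ ℕ.* ∣ n ∣)) ≡ ∣ σ ∣ ℕ.* H)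
  (ρρ′≤H : ∣ R ∣ ℕ.* ∣ R′ ∣ ℕ.≤ H) (H≤2ρρ′ : H ℕ.≤ 2 ℕ.* (∣ R ∣ ℕ.* ∣ R′ ∣))
  where

  private
    ρ ρ′ b ν μ s δ : ℕ
    ρ = ∣ R ∣
    ρ′ = ∣ R′ ∣
    b = ∣ B ∣
    ν = ∣ n ∣
    μ = ∣ m ∣
    s = ∣ σ ∣
    δ = ∣ m * m - n * n ∣

    0<D : 0 ℕ.< D
    0<D = ℕ.<-≤-trans (ℕ.*-mono-< 0<b 0<b) bb≤D
    ν≤μ : ν ℕ.≤ μ
    ν≤μ = ℕ.≤-trans (ℕ.m≤m+n ν (ν ℕ.+ 0)) 2ν≤μ
    0<μ : 0 ℕ.< μ
    0<μ = ℕ.<-≤-trans 0<ν ν≤μ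
    0<ρ : 0 ℕ.< ρ
    0<ρ = ℕ.<-≤-trans (ℕ.*-mono-< {0} {1100} (ℕ.s≤s ℕ.z≤n) 0<b) 1100b≤ρ
    ρ≤ρ′ : ρ ℕ.≤ ρ′
    ρ≤ρ′ = ℕ.≤-trans (ℕ.m≤m+n ρ (999 ℕ.* ρ)) 1000ρ≤ρ′
    100b≤ρ : 100 ℕ.* b ℕ.≤ ρ
    100b≤ρ = ℕ.≤-trans (ℕ.*-monoˡ-≤ b (ℕ.m≤m+n 100 1000)) 1100b≤ρ

    square-gap : ∀ k x y → k ℕ.* (∣ x ∣ ℕ.* ∣ x ∣) ℕ.≤ ∣ + k * (x * x) - y * y ∣ ℕ.+ ∣ y ∣ ℕ.* ∣ y ∣
    square-gap k x y = subst₂ ℕ._≤_ (trans (cong ∣_∣ (lem (+ k * (x * x)) (y * y))) (trans (abs-* (+ k) (x * x)) (cong (k ℕ.*_) (abs-* x x))))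
      (cong (∣ + k * (x * x) - y * y ∣ ℕ.+_) (abs-* y y)) (∣i+j∣≤∣i∣+∣j∣ (+ k * (x * x) - y * y) (y * y))
      where
      lem : ∀ x y → x - y + y ≡ x
      lem = solve-∀

    μμ≤δ+νν : μ ℕ.* μ ℕ.≤ δ ℕ.+ ν ℕ.* ν
    μμ≤δ+νν = subst₂ (λ x y → x ℕ.≤ ∣ y - n * n ∣ ℕ.+ ν ℕ.* ν) (ℕ.*-identityˡ (μ ℕ.* μ)) (*-identityˡ (m * m)) (square-gap 1 m n)

    imaginary : D ℕ.* (4 ℕ.* (ν ℕ.* μ ℕ.* δ)) ℕ.≤ s ℕ.* (b ℕ.* (ρ ℕ.+ ρ′))
    imaginary = begin
      D ℕ.* (4 ℕ.* (ν ℕ.* μ ℕ.* δ))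
        ≡⟨ cong (λ x → D ℕ.* (4 ℕ.* (x ℕ.* δ))) (ℕ.*-comm ν μ) ⟩
      D ℕ.* (4 ℕ.* (μ ℕ.* ν ℕ.* δ))
        ≡⟨ trans (abs-* (+ D) (Im⁴ m n)) (cong (D ℕ.*_) (trans (abs-* (+ 4) (m * n * (m * m - n * n))) (cong (4 ℕ.*_) (abs-*³ m n (m * m - n * n))))) ⟨
      ∣ + D * Im⁴ m n ∣
        ≡⟨ trans (cong ∣_∣ im) (abs-* σ (B * R′ - R * B′)) ⟩
      s ℕ.* ∣ B * R′ - R * B′ ∣
        ≤⟨ ℕ.*-monoʳ-≤ s (∣i-j∣≤∣i∣+∣j∣ (B * R′) (R * B′)) ⟩
      s ℕ.* (∣ B * R′ ∣ ℕ.+ ∣ R * B′ ∣)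
        ≡⟨ cong (s ℕ.*_) (trans (cong₂ ℕ._+_ (abs-* B R′) (trans (abs-* R B′) (cong (ρ ℕ.*_) ∣B′∣≡∣B∣))) (lem b ρ ρ′)) ⟩
      s ℕ.* (b ℕ.* (ρ ℕ.+ ρ′)) ∎
      where
      open ℕ.≤-Reasoning
      lem : ∀ b p q → b ℕ.* q ℕ.+ p ℕ.* b ≡ b ℕ.* (p ℕ.+ q)
      lem = ℕ-solve-∀

  open Sizes D s ρ ρ′ b ν μ δ H 0<D 0<μ 0<b 2ν≤μ s≤4 μμ≤δ+νν imaginary norm ρρ′≤H H≤2ρρ′ 1100b≤ρ 1000ρ≤ρ′
  open Selection b ρ ρ′ ν μ D 0<b 0<ν bb≤D 225bbb≤ρ 39νρ≤10bμ Dμ⁴≤8ρρ′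

  private
    ℓᵣ : ℕ → ℕ
    ℓᵣ r = ∣ L R B n m r ∣

    main : ∀ r G → r ! ℕ.* G ℕ.≤ ℓᵣ r → MainBound r G
    main r G large = ℕ.*-cancelˡ-≤ (r !) {{r ℕ.!≢0}} (ℕ.≤-trans
      (ℕ.≤-trans (ℕ.≤-reflexive (lem (r !) (ρ ℕ.^ r ℕ.* ρ′) G)) (ℕ.*-monoʳ-≤ (ρ ℕ.^ r ℕ.* ρ′) large))
      (main-inequality R B R′ B′ n m D σ ∣B′∣≡∣B∣ ρ≤ρ′ 2ν≤μ 100b≤ρ re im (ℕ.>-nonZero 0<s)
        (ℕ.>-nonZero (ℕ.<-≤-trans 0<ρ ρ≤ρ′)) main-term-small r))
      where
      lem : ∀ f x g → f ℕ.* (x ℕ.* g) ≡ x ℕ.* (f ℕ.* g)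
      lem = ℕ-solve-∀

    -- Order 1 needs its own argument, since `tail′` requires a positive exponent in `growth`. If L₁
    -- were 0, only the perturbation would remain, which makes 32Dν³μ² at most 12ρbμ; with 39νρ ≤
    -- 10bμ this contradicts b² ≤ Dν⁴.
    L₁≢0 : L R B n m 1 ≢ + 0
    L₁≢0 L₁≡0 = ℕ.<-irrefl refl (begin-strict
      12 ℕ.* (ρ ℕ.* b ℕ.* μ) ℕ.* (10 ℕ.* b)
        ≡⟨ lem₁ 12 10 ρ b μ ⟩
      12 ℕ.* 10 ℕ.* (b ℕ.* b ℕ.* (ρ ℕ.* μ))
        <⟨ ℕ.*-monoˡ-< (b ℕ.* b ℕ.* (ρ ℕ.* μ)) {{b²ρμ≢0}} (ℕ.<ᵇ⇒< (12 ℕ.* 10) (32 ℕ.* 39) _) ⟩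
      32 ℕ.* 39 ℕ.* (b ℕ.* b ℕ.* (ρ ℕ.* μ))
        ≤⟨ ℕ.*-monoʳ-≤ (32 ℕ.* 39) (ℕ.*-monoˡ-≤ (ρ ℕ.* μ) (ℕ.≤-trans bb≤D (ℕ.m≤m*n D (ν ℕ.* ν ℕ.* (ν ℕ.* ν)) {{ν⁴≢0}}))) ⟩
      32 ℕ.* 39 ℕ.* (D ℕ.* (ν ℕ.* ν ℕ.* (ν ℕ.* ν)) ℕ.* (ρ ℕ.* μ))
        ≡⟨ lem₂ 32 39 D ν ρ μ ⟩
      32 ℕ.* (D ℕ.* (ν ℕ.* ν ℕ.* ν) ℕ.* μ) ℕ.* (39 ℕ.* (ν ℕ.* ρ))
        ≤⟨ ℕ.*-monoʳ-≤ (32 ℕ.* (D ℕ.* (ν ℕ.* ν ℕ.* ν) ℕ.* μ)) 39νρ≤10bμ ⟩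
      32 ℕ.* (D ℕ.* (ν ℕ.* ν ℕ.* ν) ℕ.* μ) ℕ.* (10 ℕ.* (b ℕ.* μ))
        ≡⟨ lem₃ 10 D (ν ℕ.* ν ℕ.* ν) μ b ⟩
      D ℕ.* (8 ℕ.* (ν ℕ.* ν ℕ.* ν)) ℕ.* (4 ℕ.* (μ ℕ.* μ)) ℕ.* (10 ℕ.* b)
        ≤⟨ ℕ.*-monoˡ-≤ (10 ℕ.* b) upper ⟩
      12 ℕ.* (ρ ℕ.* b ℕ.* μ) ℕ.* (10 ℕ.* b) ∎)
      where
      open ℕ.≤-Reasoning
      ν⁴≢0 : ℕ.NonZero (ν ℕ.* ν ℕ.* (ν ℕ.* ν))
      ν⁴≢0 = ℕ.>-nonZero (ℕ.*-mono-< (ℕ.*-mono-< 0<ν 0<ν) (ℕ.*-mono-< 0<ν 0<ν))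
      b²ρμ≢0 : ℕ.NonZero (b ℕ.* b ℕ.* (ρ ℕ.* μ))
      b²ρμ≢0 = ℕ.>-nonZero (ℕ.*-mono-< (ℕ.*-mono-< 0<b 0<b) (ℕ.*-mono-< 0<ρ 0<μ))
      -- The evaluation at x⁴ for r = 1, with sign reversed, on the left; the perturbation times σ
      -- on the right.
      exact : + D * ((n * n * n) * (+ 8 * (+ 5 * (m * m) - n * n))) ≡ - (σ * (+ 8 * (B * B′) * n + + 2 * (R * B′) * m))
      exact = trans (trans (lem (+ D) m n) (cong -_ (trans (lem′ (+ D) (Re⁴ m n) (Im⁴ m n) n m)
        (cong₂ (λ x y → + 8 * x * n - + 2 * y * m) re im)))) (cong -_ (trans (lem″ σ R B R′ B′ n m)
        (trans (cong (λ x → σ * (+ 8 * (B * B′) * n + + 2 * (R * B′) * m + R′ * x)) L₁≡0)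
          (cong (σ *_) (trans (cong (λ x → + 8 * (B * B′) * n + + 2 * (R * B′) * m + x) (*-zeroʳ R′)) (+-identityʳ (+ 8 * (B * B′) * n + + 2 * (R * B′) * m)))))))
        where
        lem : ∀ D m n → D * ((n * n * n) * (+ 8 * (+ 5 * (m * m) - n * n)))
          ≡ - (D * (+ 8 * (m * m * (m * m) - + 6 * (m * m * (n * n)) + n * n * (n * n)) * n - + 2 * (+ 4 * (m * n * (m * m - n * n))) * m))
        lem = solve-∀
        lem′ : ∀ D x y n m → D * (+ 8 * x * n - + 2 * y * m) ≡ + 8 * (D * x) * n - + 2 * (D * y) * m
        lem′ = solve-∀
        lem″ : ∀ σ R B R′ B′ n m → + 8 * (σ * (R * R′ + B * B′)) * n - + 2 * (σ * (B * R′ - R * B′)) * m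
          ≡ σ * (+ 8 * (B * B′) * n + + 2 * (R * B′) * m + R′ * (+ 8 * R * n - + 2 * B * m))
        lem″ = solve-∀
      upper : D ℕ.* (8 ℕ.* (ν ℕ.* ν ℕ.* ν)) ℕ.* (4 ℕ.* (μ ℕ.* μ)) ℕ.≤ 12 ℕ.* (ρ ℕ.* b ℕ.* μ)
      upper = begin
        D ℕ.* (8 ℕ.* (ν ℕ.* ν ℕ.* ν)) ℕ.* (4 ℕ.* (μ ℕ.* μ))
          ≤⟨ ℕ.*-monoʳ-≤ (D ℕ.* (8 ℕ.* (ν ℕ.* ν ℕ.* ν))) 4μμ≤ ⟩
        D ℕ.* (8 ℕ.* (ν ℕ.* ν ℕ.* ν)) ℕ.* ∣ + 5 * (m * m) - n * n ∣
          ≡⟨ lem₄ D (ν ℕ.* ν ℕ.* ν) ∣ + 5 * (m * m) - n * n ∣ ⟩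
        D ℕ.* (ν ℕ.* ν ℕ.* ν ℕ.* (8 ℕ.* ∣ + 5 * (m * m) - n * n ∣))
          ≡⟨ trans (abs-* (+ D) (n * n * n * (+ 8 * (+ 5 * (m * m) - n * n)))) (cong (D ℕ.*_)
               (trans (abs-* (n * n * n) (+ 8 * (+ 5 * (m * m) - n * n))) (cong₂ ℕ._*_ (abs-*³ n n n) (abs-* (+ 8) (+ 5 * (m * m) - n * n))))) ⟨
        ∣ + D * ((n * n * n) * (+ 8 * (+ 5 * (m * m) - n * n))) ∣
          ≡⟨ trans (cong ∣_∣ exact) (trans (∣-i∣≡∣i∣ (σ * (+ 8 * (B * B′) * n + + 2 * (R * B′) * m))) (abs-* σ (+ 8 * (B * B′) * n + + 2 * (R * B′) * m))) ⟩
        s ℕ.* ∣ + 8 * (B * B′) * n + + 2 * (R * B′) * m ∣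
          ≤⟨ ℕ.*-mono-≤ s≤4 (∣i+j∣≤∣i∣+∣j∣ (+ 8 * (B * B′) * n) (+ 2 * (R * B′) * m)) ⟩
        4 ℕ.* (∣ + 8 * (B * B′) * n ∣ ℕ.+ ∣ + 2 * (R * B′) * m ∣)
          ≡⟨ cong (4 ℕ.*_) (cong₂ ℕ._+_
               (trans (abs-*³ (+ 8) (B * B′) n) (cong (λ x → 8 ℕ.* x ℕ.* ν) (trans (abs-* B B′) (cong (b ℕ.*_) ∣B′∣≡∣B∣))))
               (trans (abs-*³ (+ 2) (R * B′) m) (cong (λ x → 2 ℕ.* x ℕ.* μ) (trans (abs-* R B′) (cong (ρ ℕ.*_) ∣B′∣≡∣B∣))))) ⟩
        4 ℕ.* (8 ℕ.* (b ℕ.* b) ℕ.* ν ℕ.+ 2 ℕ.* (ρ ℕ.* b) ℕ.* μ)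
          ≤⟨ ℕ.*-monoʳ-≤ 4 (ℕ.+-monoˡ-≤ (2 ℕ.* (ρ ℕ.* b) ℕ.* μ) (ℕ.*-mono-≤ 8bb≤ρb ν≤μ)) ⟩
        4 ℕ.* (ρ ℕ.* b ℕ.* μ ℕ.+ 2 ℕ.* (ρ ℕ.* b) ℕ.* μ)
          ≡⟨ lem₅ (ρ ℕ.* b) μ ⟩
        12 ℕ.* (ρ ℕ.* b ℕ.* μ) ∎
        where
        8bb≤ρb : 8 ℕ.* (b ℕ.* b) ℕ.≤ ρ ℕ.* b
        8bb≤ρb = ℕ.≤-trans (ℕ.≤-reflexive (sym (ℕ.*-assoc 8 b b))) (ℕ.*-monoˡ-≤ b (ℕ.≤-trans (ℕ.*-monoˡ-≤ b (ℕ.m≤m+n 8 92)) 100b≤ρ))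
        4μμ≤ : 4 ℕ.* (μ ℕ.* μ) ℕ.≤ ∣ + 5 * (m * m) - n * n ∣
        4μμ≤ = ℕ.+-cancelʳ-≤ (μ ℕ.* μ) _ _ (ℕ.≤-trans (ℕ.≤-reflexive (ℕ.+-comm (4 ℕ.* (μ ℕ.* μ)) (μ ℕ.* μ)))
          (ℕ.≤-trans (square-gap 5 m n) (ℕ.+-monoʳ-≤ ∣ + 5 * (m * m) - n * n ∣ (ℕ.*-mono-≤ ν≤μ ν≤μ))))
        lem₄ : ∀ D v x → D ℕ.* (8 ℕ.* v) ℕ.* x ≡ D ℕ.* (v ℕ.* (8 ℕ.* x))
        lem₄ = ℕ-solve-∀
        lem₅ : ∀ x u → 4 ℕ.* (x ℕ.* u ℕ.+ 2 ℕ.* x ℕ.* u) ≡ 12 ℕ.* (x ℕ.* u)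
        lem₅ = ℕ-solve-∀
      lem₁ : ∀ k l p b u → k ℕ.* (p ℕ.* b ℕ.* u) ℕ.* (l ℕ.* b) ≡ k ℕ.* l ℕ.* (b ℕ.* b ℕ.* (p ℕ.* u))
      lem₁ = ℕ-solve-∀
      lem₂ : ∀ k l D v p u → k ℕ.* l ℕ.* (D ℕ.* (v ℕ.* v ℕ.* (v ℕ.* v)) ℕ.* (p ℕ.* u)) ≡ k ℕ.* (D ℕ.* (v ℕ.* v ℕ.* v) ℕ.* u) ℕ.* (l ℕ.* (v ℕ.* p))
      lem₂ = ℕ-solve-∀
      lem₃ : ∀ k D v u b → 32 ℕ.* (D ℕ.* v ℕ.* u) ℕ.* (k ℕ.* (b ℕ.* u)) ≡ D ℕ.* (8 ℕ.* v) ℕ.* (4 ℕ.* (u ℕ.* u)) ℕ.* (k ℕ.* b)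
      lem₃ = ℕ-solve-∀

    B≢0 : B ≢ + 0
    B≢0 refl = ℕ.n≮0 0<b

    n≢0 : n ≢ + 0
    n≢0 refl = ℕ.n≮0 0<ν

    nonzero-case : ∀ r → L R B n m r ≢ + 0 → MainBound r 1
    nonzero-case r L≢0 = main r 1 (subst (ℕ._≤ ℓᵣ r) (sym (ℕ.*-identityʳ (r !))) (r!≤∣L∣ R B n m r L≢0))

    -- If a value vanishes, the next one is `coeff₀` · B² times the previous one, and that one is
    -- nonzero, hence at least (t + 1)!.
    zero-case : ∀ t → L R B n m (suc (suc t)) ≡ + 0 → MainBound (suc (suc (suc t))) (30 ℕ.* (b ℕ.* b))
    zero-case t L≡0 = main (suc (suc (suc t))) (30 ℕ.* (b ℕ.* b)) (begin
      suc (suc (suc t)) ! ℕ.* (30 ℕ.* (b ℕ.* b))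
        ≡⟨ lem t (suc t !) (b ℕ.* b) ⟩
      30 ℕ.* (suc (suc t) ℕ.* suc (suc (suc t))) ℕ.* (b ℕ.* b) ℕ.* suc t !
        ≤⟨ ℕ.*-mono-≤ (ℕ.*-monoˡ-≤ (b ℕ.* b) (≤∣coeff₀∣ (suc t))) (r!≤∣L∣ R B n m (suc t) previous≢0) ⟩
      ∣ coeff₀ (suc t) ∣ ℕ.* (b ℕ.* b) ℕ.* ℓᵣ (suc t)
        ≡⟨ trans (abs-*³ (coeff₀ (suc t)) (B * B) (L R B n m (suc t))) (cong (λ x → ∣ coeff₀ (suc t) ∣ ℕ.* x ℕ.* ℓᵣ (suc t)) (abs-* B B)) ⟨
      ∣ coeff₀ (suc t) * (B * B) * L R B n m (suc t) ∣
        ≡⟨ cong ∣_∣ next ⟨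
      ℓᵣ (suc (suc (suc t))) ∎)
      where
      open ℕ.≤-Reasoning
      previous≢0 : L R B n m (suc t) ≢ + 0
      previous≢0 e = n≢0 (L-consecutive-zeros R B n m B≢0 (suc t) e L≡0)
      next : L R B n m (suc (suc (suc t))) ≡ coeff₀ (suc t) * (B * B) * L R B n m (suc t)
      next = trans (cong (λ x → coeff₁ (suc t) * R * x + coeff₀ (suc t) * (B * B) * L R B n m (suc t)) L≡0)
        (trans (cong (_+ coeff₀ (suc t) * (B * B) * L R B n m (suc t)) (*-zeroʳ (coeff₁ (suc t) * R))) (+-identityˡ (coeff₀ (suc t) * (B * B) * L R B n m (suc t))))
      lem : ∀ t f d → suc (suc (suc t)) ℕ.* (suc (suc t) ℕ.* f) ℕ.* (30 ℕ.* d) ≡ 30 ℕ.* (suc (suc t) ℕ.* suc (suc (suc t))) ℕ.* d ℕ.* f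
      lem = ℕ-solve-∀

  no-approximation : ⊥
  no-approximation = go (proj₁ selection) (proj₁ (proj₂ selection)) (proj₂ (proj₂ selection))
    where
    -- The order used is r + 1, or r + 2 if L vanishes at r + 1.
    go : ∀ r → Small (suc r) → ¬ Small r → ⊥
    go zero    s ¬s = impossible 0 s ¬s (nonzero-case 1 L₁≢0)
    go (suc t) s ¬s with L R B n m (suc (suc t)) ≟ + 0
    ... | no  L≢0 = impossible (suc t) s ¬s (nonzero-case (suc (suc t)) L≢0)
    ... | yes L≡0 = impossible′ t s ¬s (zero-case t L≡0)

-- Solutions of the Thue equation

square-≤ : ∀ {x y} → x ℕ.* x ℕ.≤ y ℕ.* y → x ℕ.≤ y
square-≤ {x} {y} h = [ (λ x≤y → x≤y) , (λ y<x → ⊥-elim (ℕ.<⇒≱ (ℕ.*-mono-< y<x y<x) h)) ]′ (ℕ.≤-<-connex x y)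

abs-square : ∀ x → + (∣ x ∣ ℕ.* ∣ x ∣) ≡ x * x
abs-square (+ n)    = pos-* n n
abs-square -[1+ n ] = refl

abs-squares : ∀ x y → + (∣ x ∣ ℕ.* ∣ x ∣ ℕ.+ ∣ y ∣ ℕ.* ∣ y ∣) ≡ x * x + y * y
abs-squares x y = cong₂ _+_ (abs-square x) (abs-square y)

abs-value : ∀ x {n} → ∣ x ∣ ≡ n → x ≡ + n ⊎ x ≡ - (+ n)
abs-value (+ n)    refl = inj₁ refl
abs-value -[1+ n ] refl = inj₂ refl

Re⁴-Im⁴-norm : ∀ p q → let N = p * p + q * q in Re⁴ p q * Re⁴ p q + Im⁴ p q * Im⁴ p q ≡ N * N * (N * N)
Re⁴-Im⁴-norm p q = lem p q
  where
  lem : ∀ p q → (p * p * (p * p) - + 6 * (p * p * (q * q)) + q * q * (q * q)) * (p * p * (p * p) - + 6 * (p * p * (q * q)) + q * q * (q * q))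
      + + 4 * (p * q * (p * p - q * q)) * (+ 4 * (p * q * (p * p - q * q)))
    ≡ (p * p + q * q) * (p * p + q * q) * ((p * p + q * q) * (p * p + q * q))
  lem = solve-∀

-- (p + iq)⁴ (a - ib) has imaginary part ± b.
record Thue (a b y : ℕ) : Set where
  field
    p q : ℤ
    norm : p * p + q * q ≡ + y
    imaginary : ∣ + a * Im⁴ p q - + b * Re⁴ p q ∣ ≡ b
  R B : ℤ
  R = + a * Re⁴ p q + + b * Im⁴ p q
  B = + a * Im⁴ p q - + b * Re⁴ p q

module _ {a b y : ℕ} (t : Thue a b y) where
  open Thue t

  power-norm : Re⁴ p q * Re⁴ p q + Im⁴ p q * Im⁴ p q ≡ + (y ℕ.* y ℕ.* (y ℕ.* y))
  power-norm = trans (Re⁴-Im⁴-norm p q) (trans (cong (λ N → N * N * (N * N)) norm)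
    (trans (cong₂ _*_ (sym (pos-* y y)) (sym (pos-* y y))) (sym (pos-* (y ℕ.* y) (y ℕ.* y)))))

  -- The norm is multiplicative: R + iB is γ⁴ ω̄ with γ = p + iq, and |B| = b.
  R-norm : ∣ R ∣ ℕ.* ∣ R ∣ ℕ.+ b ℕ.* b ≡ (a ℕ.* a ℕ.+ b ℕ.* b) ℕ.* (y ℕ.* y ℕ.* (y ℕ.* y))
  R-norm = trans (cong (λ x → ∣ R ∣ ℕ.* ∣ R ∣ ℕ.+ x ℕ.* x) (sym imaginary)) (+-injective (begin
    + (∣ R ∣ ℕ.* ∣ R ∣ ℕ.+ ∣ B ∣ ℕ.* ∣ B ∣)
      ≡⟨ abs-squares R B ⟩
    R * R + B * B
      ≡⟨ lem (+ a) (+ b) (Re⁴ p q) (Im⁴ p q) ⟩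
    (+ a * + a + + b * + b) * (Re⁴ p q * Re⁴ p q + Im⁴ p q * Im⁴ p q)
      ≡⟨ cong₂ _*_ (sym (abs-squares (+ a) (+ b))) power-norm ⟩
    + (a ℕ.* a ℕ.+ b ℕ.* b) * + (y ℕ.* y ℕ.* (y ℕ.* y))
      ≡⟨ pos-* (a ℕ.* a ℕ.+ b ℕ.* b) (y ℕ.* y ℕ.* (y ℕ.* y)) ⟨
    + ((a ℕ.* a ℕ.+ b ℕ.* b) ℕ.* (y ℕ.* y ℕ.* (y ℕ.* y))) ∎))
    where
    open ≡-Reasoning
    lem : ∀ a b x y → (a * x + b * y) * (a * x + b * y) + (a * y - b * x) * (a * y - b * x) ≡ (a * a + b * b) * (x * x + y * y)
    lem = solve-∀

  module _ (0<a : 0 ℕ.< a) (0<b : 0 ℕ.< b) (coprime : Coprime a b) (1<y : 1 ℕ.< y) where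
    private
      X Y : ℤ
      X = Re⁴ p q
      Y = Im⁴ p q

      power-norm-ℕ : ∣ X ∣ ℕ.* ∣ X ∣ ℕ.+ ∣ Y ∣ ℕ.* ∣ Y ∣ ≡ y ℕ.* y ℕ.* (y ℕ.* y)
      power-norm-ℕ = +-injective (trans (abs-squares X Y) power-norm)

      aY≡b[X+e] : ∃ λ e → + a * Y ≡ + b * (X + e)
      aY≡b[X+e] with abs-value B imaginary
      ... | inj₁ B≡b = + 1 , trans (lem (+ a * Y) (+ b * X)) (trans (cong (_+ + b * X) B≡b) (lem′ (+ b) X))
        where
        lem : ∀ x y → x ≡ x - y + y
        lem = solve-∀
        lem′ : ∀ b x → b + b * x ≡ b * (x + + 1)
        lem′ = solve-∀
      ... | inj₂ B≡-b = - + 1 , trans (lem (+ a * Y) (+ b * X)) (trans (cong (_+ + b * X) B≡-b) (lem′ (+ b) X))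
        where
        lem : ∀ x y → x ≡ x - y + y
        lem = solve-∀
        lem′ : ∀ b x → - b + b * x ≡ b * (x + - + 1)
        lem′ = solve-∀

      b∣Y : b ℕ.∣ ∣ Y ∣
      b∣Y = coprime-divisor (Coprimality.sym coprime) (ℕ.divides ∣ X + proj₁ aY≡b[X+e] ∣
        (trans (sym (abs-* (+ a) Y)) (trans (cong ∣_∣ (proj₂ aY≡b[X+e])) (trans (abs-* (+ b) (X + proj₁ aY≡b[X+e])) (ℕ.*-comm b _)))))

      Y≢0 : ∣ Y ∣ ≢ 0
      Y≢0 Y≡0 = ℕ.<-irrefl refl (begin-strict
        1 ℕ.* 1                              <⟨ ℕ.*-mono-< (ℕ.*-mono-< 1<y 1<y) (ℕ.*-mono-< 1<y 1<y) ⟩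
        y ℕ.* y ℕ.* (y ℕ.* y)                ≡⟨ power-norm-ℕ ⟨
        ∣ X ∣ ℕ.* ∣ X ∣ ℕ.+ ∣ Y ∣ ℕ.* ∣ Y ∣  ≡⟨ cong₂ (λ x y → x ℕ.* x ℕ.+ y ℕ.* y) X≡1 Y≡0 ⟩
        1                                    ∎)
        where
        open ℕ.≤-Reasoning
        X≡1 : ∣ X ∣ ≡ 1
        X≡1 = ℕ.*-cancelˡ-≡ ∣ X ∣ 1 b {{ℕ.>-nonZero 0<b}} (trans (sym (trans (cong ∣_∣ B≡) (trans (∣-i∣≡∣i∣ (+ b * X)) (abs-* (+ b) X))))
          (trans imaginary (sym (ℕ.*-identityʳ b))))
          where
          B≡ : B ≡ - (+ b * X)
          B≡ = trans (cong (λ y → + a * y - + b * X) (∣i∣≡0⇒i≡0 {Y} Y≡0)) (lem (+ a) (+ b * X))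
            where
            lem : ∀ a x → a * + 0 - x ≡ - x
            lem = solve-∀

    -- With γ⁴ = X + iY the equation reads aY = b(X ± 1), so b divides Y by coprimality. Y is
    -- nonzero, since otherwise |X| = 1 although X² + Y² = y⁴ > 1. Hence b ≤ |Y| ≤ y².
    b≤y² : b ℕ.≤ y ℕ.* y
    b≤y² = ℕ.≤-trans (ℕ.∣⇒≤ {{ℕ.≢-nonZero Y≢0}} b∣Y)
      (square-≤ (ℕ.≤-trans (ℕ.m≤n+m (∣ Y ∣ ℕ.* ∣ Y ∣) (∣ X ∣ ℕ.* ∣ X ∣)) (ℕ.≤-reflexive power-norm-ℕ)))

    -- Im γ⁴ ≠ 0 excludes p = 0, q = 0 and |p| = |q|; the least remaining sum of squares is 1 + 4.
    5≤y : 5 ℕ.≤ y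
    5≤y = subst (5 ℕ.≤_) (+-injective (trans (abs-squares p q) norm)) (sum-of-squares ∣ p ∣ ∣ q ∣ p≢0 q≢0 p≢q)
      where
      p≢0 : ∣ p ∣ ≢ 0
      p≢0 e = Y≢0 (cong ∣_∣ (trans (cong (λ p → Im⁴ p q) (∣i∣≡0⇒i≡0 {p} e)) (lem q)))
        where
        lem : ∀ q → + 4 * (+ 0 * q * (+ 0 * + 0 - q * q)) ≡ + 0
        lem = solve-∀
      q≢0 : ∣ q ∣ ≢ 0
      q≢0 e = Y≢0 (cong ∣_∣ (trans (cong (Im⁴ p) (∣i∣≡0⇒i≡0 {q} e)) (lem p)))
        where
        lem : ∀ p → + 4 * (p * + 0 * (p * p - + 0 * + 0)) ≡ + 0
        lem = solve-∀
      p≢q : ∣ p ∣ ≢ ∣ q ∣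
      p≢q e = Y≢0 (cong ∣_∣ (trans (cong (λ x → + 4 * (p * q * (x - q * q))) p²≡q²) (lem p q)))
        where
        p²≡q² : p * p ≡ q * q
        p²≡q² = trans (sym (abs-square p)) (trans (cong (λ x → + (x ℕ.* x)) e) (abs-square q))
        lem : ∀ p q → + 4 * (p * q * (q * q - q * q)) ≡ + 0
        lem = solve-∀
      4≤ : ∀ x → 4 ℕ.≤ suc (suc x) ℕ.* suc (suc x)
      4≤ x = ℕ.*-mono-≤ {2} {suc (suc x)} {2} {suc (suc x)} (ℕ.s≤s (ℕ.s≤s ℕ.z≤n)) (ℕ.s≤s (ℕ.s≤s ℕ.z≤n))
      sum-of-squares : ∀ x y → x ≢ 0 → y ≢ 0 → x ≢ y → 5 ℕ.≤ x ℕ.* x ℕ.+ y ℕ.* y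
      sum-of-squares zero          y             x≢0 y≢0 x≢y = ⊥-elim (x≢0 refl)
      sum-of-squares (suc x)       zero          x≢0 y≢0 x≢y = ⊥-elim (y≢0 refl)
      sum-of-squares (suc zero)    (suc zero)    x≢0 y≢0 x≢y = ⊥-elim (x≢y refl)
      sum-of-squares (suc (suc x)) (suc y)       x≢0 y≢0 x≢y =
        ℕ.+-mono-≤ {4} {suc (suc x) ℕ.* suc (suc x)} {1} {suc y ℕ.* suc y} (4≤ x) (ℕ.s≤s ℕ.z≤n)
      sum-of-squares (suc zero)    (suc (suc y)) x≢0 y≢0 x≢y = ℕ.s≤s (4≤ y)

    -- R² + b² = (a² + b²) y⁴ with a ≥ 1, and the surplus y⁴ covers b² because b ≤ y².
    by²≤R : b ℕ.* (y ℕ.* y) ℕ.≤ ∣ R ∣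
    by²≤R = square-≤ (ℕ.+-cancelʳ-≤ (b ℕ.* b) _ _ (begin
      b ℕ.* (y ℕ.* y) ℕ.* (b ℕ.* (y ℕ.* y)) ℕ.+ b ℕ.* b
        ≤⟨ ℕ.+-monoʳ-≤ (b ℕ.* (y ℕ.* y) ℕ.* (b ℕ.* (y ℕ.* y))) (ℕ.*-mono-≤ b≤y² b≤y²) ⟩
      b ℕ.* (y ℕ.* y) ℕ.* (b ℕ.* (y ℕ.* y)) ℕ.+ y ℕ.* y ℕ.* (y ℕ.* y)
        ≡⟨ lem b (y ℕ.* y) ⟩
      (1 ℕ.* 1 ℕ.+ b ℕ.* b) ℕ.* (y ℕ.* y ℕ.* (y ℕ.* y))
        ≤⟨ ℕ.*-monoˡ-≤ (y ℕ.* y ℕ.* (y ℕ.* y)) (ℕ.+-monoˡ-≤ (b ℕ.* b) (ℕ.*-mono-≤ 0<a 0<a)) ⟩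
      (a ℕ.* a ℕ.+ b ℕ.* b) ℕ.* (y ℕ.* y ℕ.* (y ℕ.* y))
        ≡⟨ R-norm ⟨
      ∣ R ∣ ℕ.* ∣ R ∣ ℕ.+ b ℕ.* b ∎))
      where
      open ℕ.≤-Reasoning
      lem : ∀ b z → b ℕ.* z ℕ.* (b ℕ.* z) ℕ.+ z ℕ.* z ≡ (1 ℕ.* 1 ℕ.+ b ℕ.* b) ℕ.* (z ℕ.* z)
      lem = ℕ-solve-∀

-- Fourth powers of products and rotation towards the real axis

Re² Im² : ℤ → ℤ → ℤ
Re² p q = p * p - q * q
Im² p q = + 2 * (p * q)

Re⁴-square : ∀ p q → Re⁴ p q ≡ Re² (Re² p q) (Im² p q)
Re⁴-square p q = lem p q
  where
  lem : ∀ p q → p * p * (p * p) - + 6 * (p * p * (q * q)) + q * q * (q * q)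
    ≡ (p * p - q * q) * (p * p - q * q) - + 2 * (p * q) * (+ 2 * (p * q))
  lem = solve-∀

Im⁴-square : ∀ p q → Im⁴ p q ≡ Im² (Re² p q) (Im² p q)
Im⁴-square p q = lem p q
  where
  lem : ∀ p q → + 4 * (p * q * (p * p - q * q)) ≡ + 2 * ((p * p - q * q) * (+ 2 * (p * q)))
  lem = solve-∀

Re²-product : ∀ p q p′ q′ → Re² (p * p′ + q * q′) (q * p′ - p * q′) ≡ Re² p q * Re² p′ q′ + Im² p q * Im² p′ q′
Re²-product p q p′ q′ = lem p q p′ q′
  where
  lem : ∀ p q p′ q′ → (p * p′ + q * q′) * (p * p′ + q * q′) - (q * p′ - p * q′) * (q * p′ - p * q′)
    ≡ (p * p - q * q) * (p′ * p′ - q′ * q′) + + 2 * (p * q) * (+ 2 * (p′ * q′))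
  lem = solve-∀

Im²-product : ∀ p q p′ q′ → Im² (p * p′ + q * q′) (q * p′ - p * q′) ≡ Im² p q * Re² p′ q′ - Re² p q * Im² p′ q′
Im²-product p q p′ q′ = lem p q p′ q′
  where
  lem : ∀ p q p′ q′ → + 2 * ((p * p′ + q * q′) * (q * p′ - p * q′))
    ≡ + 2 * (p * q) * (p′ * p′ - q′ * q′) - (p * p - q * q) * (+ 2 * (p′ * q′))
  lem = solve-∀

-- Multiplicativity for γγ̄′, obtained by squaring twice so that each polynomial identity stays
-- small.
Re⁴-product : ∀ p q p′ q′ → Re⁴ (p * p′ + q * q′) (q * p′ - p * q′) ≡ Re⁴ p q * Re⁴ p′ q′ + Im⁴ p q * Im⁴ p′ q′
Re⁴-product p q p′ q′ = begin
  Re⁴ (p * p′ + q * q′) (q * p′ - p * q′)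
    ≡⟨ Re⁴-square (p * p′ + q * q′) (q * p′ - p * q′) ⟩
  Re² (Re² (p * p′ + q * q′) (q * p′ - p * q′)) (Im² (p * p′ + q * q′) (q * p′ - p * q′))
    ≡⟨ cong₂ Re² (Re²-product p q p′ q′) (Im²-product p q p′ q′) ⟩
  Re² (Re² p q * Re² p′ q′ + Im² p q * Im² p′ q′) (Im² p q * Re² p′ q′ - Re² p q * Im² p′ q′)
    ≡⟨ Re²-product (Re² p q) (Im² p q) (Re² p′ q′) (Im² p′ q′) ⟩
  Re² (Re² p q) (Im² p q) * Re² (Re² p′ q′) (Im² p′ q′) + Im² (Re² p q) (Im² p q) * Im² (Re² p′ q′) (Im² p′ q′)
    ≡⟨ cong₂ _+_ (cong₂ _*_ (Re⁴-square p q) (Re⁴-square p′ q′)) (cong₂ _*_ (Im⁴-square p q) (Im⁴-square p′ q′)) ⟨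
  Re⁴ p q * Re⁴ p′ q′ + Im⁴ p q * Im⁴ p′ q′ ∎
  where open ≡-Reasoning

Im⁴-product : ∀ p q p′ q′ → Im⁴ (p * p′ + q * q′) (q * p′ - p * q′) ≡ Im⁴ p q * Re⁴ p′ q′ - Re⁴ p q * Im⁴ p′ q′
Im⁴-product p q p′ q′ = begin
  Im⁴ (p * p′ + q * q′) (q * p′ - p * q′)
    ≡⟨ Im⁴-square (p * p′ + q * q′) (q * p′ - p * q′) ⟩
  Im² (Re² (p * p′ + q * q′) (q * p′ - p * q′)) (Im² (p * p′ + q * q′) (q * p′ - p * q′))
    ≡⟨ cong₂ Im² (Re²-product p q p′ q′) (Im²-product p q p′ q′) ⟩
  Im² (Re² p q * Re² p′ q′ + Im² p q * Im² p′ q′) (Im² p q * Re² p′ q′ - Re² p q * Im² p′ q′)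
    ≡⟨ Im²-product (Re² p q) (Im² p q) (Re² p′ q′) (Im² p′ q′) ⟩
  Im² (Re² p q) (Im² p q) * Re² (Re² p′ q′) (Im² p′ q′) - Re² (Re² p q) (Im² p q) * Im² (Re² p′ q′) (Im² p′ q′)
    ≡⟨ cong₂ _-_ (cong₂ _*_ (Im⁴-square p q) (Re⁴-square p′ q′)) (cong₂ _*_ (Re⁴-square p q) (Im⁴-square p′ q′)) ⟨
  Im⁴ p q * Re⁴ p′ q′ - Re⁴ p q * Im⁴ p′ q′ ∎
  where open ≡-Reasoning

-- x is μ times 1, -i, 1 - i or 1 + i, so that σ is 1 or -4.
record Rotation (m₀ n₀ : ℤ) : Set where
  field
    m n σ : ℤ
    small : 2 ℕ.* ∣ n ∣ ℕ.≤ ∣ m ∣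
    0<s : 0 ℕ.< ∣ σ ∣
    s≤4 : ∣ σ ∣ ℕ.≤ 4
    re : Re⁴ m n ≡ σ * Re⁴ m₀ n₀
    im : Im⁴ m n ≡ σ * Im⁴ m₀ n₀
    norm² : (m * m + n * n) * (m * m + n * n) ≡ + ∣ σ ∣ * ((m₀ * m₀ + n₀ * n₀) * (m₀ * m₀ + n₀ * n₀))

-- Decides which of 1 - i and 1 + i turns a number near a diagonal towards the real axis.
same-sign : ∀ m n → ∣ m + n ∣ ≡ ∣ m ∣ ℕ.+ ∣ n ∣ ⊎ ∣ m - n ∣ ≡ ∣ m ∣ ℕ.+ ∣ n ∣
same-sign (+ x)    (+ y)       = inj₁ refl
same-sign (+ x)    -[1+ y ]    = inj₂ refl
same-sign -[1+ x ] (+ zero)    = inj₁ (cong suc (sym (ℕ.+-identityʳ x)))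
same-sign -[1+ x ] (+ (suc y)) = inj₂ (cong suc (sym (ℕ.+-suc x y)))
same-sign -[1+ x ] -[1+ y ]    = inj₁ (cong suc (sym (ℕ.+-suc x y)))

-- The claim 4u² ≤ v² amounts to 3x² + 3y² ≤ 10xy, that is (3x - y)(x - 3y) ≤ 0, which holds for
-- ratios between 1/3 and 3; here they lie between 1/2 and 2.
diagonal-≤ : ∀ x y u v → v ≡ x ℕ.+ y → x ℕ.≤ 2 ℕ.* y → y ℕ.≤ 2 ℕ.* x →
  u ℕ.* u ℕ.+ v ℕ.* v ≡ 2 ℕ.* (x ℕ.* x ℕ.+ y ℕ.* y) → 2 ℕ.* u ℕ.≤ v
diagonal-≤ x y u v refl x≤2y y≤2x squares = square-≤ (ℕ.+-cancelʳ-≤ (4 ℕ.* (v ℕ.* v)) _ _ (begin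
  2 ℕ.* u ℕ.* (2 ℕ.* u) ℕ.+ 4 ℕ.* (v ℕ.* v)
    ≡⟨ lem₁ u v ⟩
  4 ℕ.* (u ℕ.* u ℕ.+ v ℕ.* v)
    ≡⟨ cong (4 ℕ.*_) squares ⟩
  4 ℕ.* (2 ℕ.* (x ℕ.* x ℕ.+ y ℕ.* y))
    ≡⟨ lem₂ x y ⟩
  5 ℕ.* (x ℕ.* x ℕ.+ y ℕ.* y) ℕ.+ 3 ℕ.* (x ℕ.* x ℕ.+ y ℕ.* y)
    ≤⟨ ℕ.+-monoʳ-≤ (5 ℕ.* (x ℕ.* x ℕ.+ y ℕ.* y)) three ⟩
  5 ℕ.* (x ℕ.* x ℕ.+ y ℕ.* y) ℕ.+ 10 ℕ.* (x ℕ.* y)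
    ≡⟨ lem₃ x y ⟩
  (x ℕ.+ y) ℕ.* (x ℕ.+ y) ℕ.+ 4 ℕ.* ((x ℕ.+ y) ℕ.* (x ℕ.+ y)) ∎))
  where
  open ℕ.≤-Reasoning
  lem₁ : ∀ u v → 2 ℕ.* u ℕ.* (2 ℕ.* u) ℕ.+ 4 ℕ.* (v ℕ.* v) ≡ 4 ℕ.* (u ℕ.* u ℕ.+ v ℕ.* v)
  lem₁ = ℕ-solve-∀
  lem₂ : ∀ x y → 4 ℕ.* (2 ℕ.* (x ℕ.* x ℕ.+ y ℕ.* y)) ≡ 5 ℕ.* (x ℕ.* x ℕ.+ y ℕ.* y) ℕ.+ 3 ℕ.* (x ℕ.* x ℕ.+ y ℕ.* y)
  lem₂ = ℕ-solve-∀
  lem₃ : ∀ x y → 5 ℕ.* (x ℕ.* x ℕ.+ y ℕ.* y) ℕ.+ 10 ℕ.* (x ℕ.* y) ≡ (x ℕ.+ y) ℕ.* (x ℕ.+ y) ℕ.+ 4 ℕ.* ((x ℕ.+ y) ℕ.* (x ℕ.+ y))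
  lem₃ = ℕ-solve-∀
  ordered : ∀ x d → d ℕ.≤ x → 3 ℕ.* (x ℕ.* x ℕ.+ (x ℕ.+ d) ℕ.* (x ℕ.+ d)) ℕ.≤ 10 ℕ.* (x ℕ.* (x ℕ.+ d))
  ordered x d d≤x = begin
    3 ℕ.* (x ℕ.* x ℕ.+ (x ℕ.+ d) ℕ.* (x ℕ.+ d))
      ≡⟨ expand x d ⟩
    6 ℕ.* (x ℕ.* x) ℕ.+ 6 ℕ.* (x ℕ.* d) ℕ.+ 3 ℕ.* (d ℕ.* d)
      ≤⟨ ℕ.+-monoʳ-≤ (6 ℕ.* (x ℕ.* x) ℕ.+ 6 ℕ.* (x ℕ.* d)) (ℕ.*-monoʳ-≤ 3 (ℕ.*-monoˡ-≤ d d≤x)) ⟩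
    6 ℕ.* (x ℕ.* x) ℕ.+ 6 ℕ.* (x ℕ.* d) ℕ.+ 3 ℕ.* (x ℕ.* d)
      ≤⟨ ℕ.m≤m+n _ (4 ℕ.* (x ℕ.* x) ℕ.+ x ℕ.* d) ⟩
    6 ℕ.* (x ℕ.* x) ℕ.+ 6 ℕ.* (x ℕ.* d) ℕ.+ 3 ℕ.* (x ℕ.* d) ℕ.+ (4 ℕ.* (x ℕ.* x) ℕ.+ x ℕ.* d)
      ≡⟨ collect x d ⟩
    10 ℕ.* (x ℕ.* (x ℕ.+ d)) ∎
    where
    expand : ∀ x d → 3 ℕ.* (x ℕ.* x ℕ.+ (x ℕ.+ d) ℕ.* (x ℕ.+ d)) ≡ 6 ℕ.* (x ℕ.* x) ℕ.+ 6 ℕ.* (x ℕ.* d) ℕ.+ 3 ℕ.* (d ℕ.* d)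
    expand = ℕ-solve-∀
    collect : ∀ x d → 6 ℕ.* (x ℕ.* x) ℕ.+ 6 ℕ.* (x ℕ.* d) ℕ.+ 3 ℕ.* (x ℕ.* d) ℕ.+ (4 ℕ.* (x ℕ.* x) ℕ.+ x ℕ.* d) ≡ 10 ℕ.* (x ℕ.* (x ℕ.+ d))
    collect = ℕ-solve-∀
  half : ∀ x d → x ℕ.+ d ℕ.≤ 2 ℕ.* x → d ℕ.≤ x
  half x d h = ℕ.+-cancelˡ-≤ x d x (ℕ.≤-trans h (ℕ.≤-reflexive (cong (x ℕ.+_) (ℕ.+-identityʳ x))))
  three : 3 ℕ.* (x ℕ.* x ℕ.+ y ℕ.* y) ℕ.≤ 10 ℕ.* (x ℕ.* y)
  three with ℕ.≤-total x y
  ... | inj₁ x≤y = subst (λ y → 3 ℕ.* (x ℕ.* x ℕ.+ y ℕ.* y) ℕ.≤ 10 ℕ.* (x ℕ.* y)) (ℕ.m+[n∸m]≡n x≤y)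
    (ordered x (y ℕ.∸ x) (half x (y ℕ.∸ x) (ℕ.≤-trans (ℕ.≤-reflexive (ℕ.m+[n∸m]≡n x≤y)) y≤2x)))
  ... | inj₂ y≤x = subst₂ ℕ._≤_ (cong (3 ℕ.*_) (ℕ.+-comm (y ℕ.* y) (x ℕ.* x))) (cong (10 ℕ.*_) (ℕ.*-comm y x))
    (subst (λ x → 3 ℕ.* (y ℕ.* y ℕ.+ x ℕ.* x) ℕ.≤ 10 ℕ.* (y ℕ.* x)) (ℕ.m+[n∸m]≡n y≤x)
    (ordered y (x ℕ.∸ y) (half y (x ℕ.∸ y) (ℕ.≤-trans (ℕ.≤-reflexive (ℕ.m+[n∸m]≡n y≤x)) x≤2y))))

rotation : ∀ m₀ n₀ → Rotation m₀ n₀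
rotation m₀ n₀ with 2 ℕ.* ∣ n₀ ∣ ℕ.≤? ∣ m₀ ∣ | 2 ℕ.* ∣ m₀ ∣ ℕ.≤? ∣ n₀ ∣ | same-sign m₀ n₀
... | yes h | _ | _ = record { m = m₀ ; n = n₀ ; σ = + 1 ; small = h ; 0<s = ℕ.s≤s ℕ.z≤n ; s≤4 = ℕ.s≤s ℕ.z≤n
  ; re = sym (*-identityˡ (Re⁴ m₀ n₀)) ; im = sym (*-identityˡ (Im⁴ m₀ n₀))
  ; norm² = sym (*-identityˡ ((m₀ * m₀ + n₀ * n₀) * (m₀ * m₀ + n₀ * n₀))) }
... | no _ | yes h | _ = record { m = n₀ ; n = - m₀ ; σ = + 1
  ; small = subst (λ x → 2 ℕ.* x ℕ.≤ ∣ n₀ ∣) (sym (∣-i∣≡∣i∣ m₀)) h ; 0<s = ℕ.s≤s ℕ.z≤n ; s≤4 = ℕ.s≤s ℕ.z≤n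
  ; re = re-lem m₀ n₀ ; im = im-lem m₀ n₀ ; norm² = norm-lem m₀ n₀ }
  where
  re-lem : ∀ m n → n * n * (n * n) - + 6 * (n * n * (- m * - m)) + - m * - m * (- m * - m)
    ≡ + 1 * (m * m * (m * m) - + 6 * (m * m * (n * n)) + n * n * (n * n))
  re-lem = solve-∀
  im-lem : ∀ m n → + 4 * (n * - m * (n * n - - m * - m)) ≡ + 1 * (+ 4 * (m * n * (m * m - n * n)))
  im-lem = solve-∀
  norm-lem : ∀ m n → (n * n + - m * - m) * (n * n + - m * - m) ≡ + 1 * ((m * m + n * n) * (m * m + n * n))
  norm-lem = solve-∀
... | no h₁ | no h₂ | inj₁ same = record { m = m₀ + n₀ ; n = n₀ - m₀ ; σ = - + 4
  ; small = diagonal-≤ (∣ m₀ ∣) (∣ n₀ ∣) (∣ n₀ - m₀ ∣) (∣ m₀ + n₀ ∣) same (ℕ.<⇒≤ (ℕ.≰⇒> h₁)) (ℕ.<⇒≤ (ℕ.≰⇒> h₂)) squares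
  ; 0<s = ℕ.s≤s ℕ.z≤n ; s≤4 = ℕ.≤-refl
  ; re = re-lem m₀ n₀ ; im = im-lem m₀ n₀ ; norm² = norm-lem m₀ n₀ }
  where
  squares : ∣ n₀ - m₀ ∣ ℕ.* ∣ n₀ - m₀ ∣ ℕ.+ ∣ m₀ + n₀ ∣ ℕ.* ∣ m₀ + n₀ ∣ ≡ 2 ℕ.* (∣ m₀ ∣ ℕ.* ∣ m₀ ∣ ℕ.+ ∣ n₀ ∣ ℕ.* ∣ n₀ ∣)
  squares = +-injective (trans (abs-squares (n₀ - m₀) (m₀ + n₀)) (trans (lem m₀ n₀)
    (trans (cong (+ 2 *_) (sym (abs-squares m₀ n₀))) (sym (pos-* 2 (∣ m₀ ∣ ℕ.* ∣ m₀ ∣ ℕ.+ ∣ n₀ ∣ ℕ.* ∣ n₀ ∣))))))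
    where
    lem : ∀ m n → (n - m) * (n - m) + (m + n) * (m + n) ≡ + 2 * (m * m + n * n)
    lem = solve-∀
  re-lem : ∀ m n → (m + n) * (m + n) * ((m + n) * (m + n)) - + 6 * ((m + n) * (m + n) * ((n - m) * (n - m))) + (n - m) * (n - m) * ((n - m) * (n - m))
    ≡ - + 4 * (m * m * (m * m) - + 6 * (m * m * (n * n)) + n * n * (n * n))
  re-lem = solve-∀
  im-lem : ∀ m n → + 4 * ((m + n) * (n - m) * ((m + n) * (m + n) - (n - m) * (n - m))) ≡ - + 4 * (+ 4 * (m * n * (m * m - n * n)))
  im-lem = solve-∀
  norm-lem : ∀ m n → ((m + n) * (m + n) + (n - m) * (n - m)) * ((m + n) * (m + n) + (n - m) * (n - m)) ≡ + 4 * ((m * m + n * n) * (m * m + n * n))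
  norm-lem = solve-∀
... | no h₁ | no h₂ | inj₂ opposite = record { m = m₀ - n₀ ; n = m₀ + n₀ ; σ = - + 4
  ; small = diagonal-≤ (∣ m₀ ∣) (∣ n₀ ∣) (∣ m₀ + n₀ ∣) (∣ m₀ - n₀ ∣) opposite (ℕ.<⇒≤ (ℕ.≰⇒> h₁)) (ℕ.<⇒≤ (ℕ.≰⇒> h₂)) squares
  ; 0<s = ℕ.s≤s ℕ.z≤n ; s≤4 = ℕ.≤-refl
  ; re = re-lem m₀ n₀ ; im = im-lem m₀ n₀ ; norm² = norm-lem m₀ n₀ }
  where
  squares : ∣ m₀ + n₀ ∣ ℕ.* ∣ m₀ + n₀ ∣ ℕ.+ ∣ m₀ - n₀ ∣ ℕ.* ∣ m₀ - n₀ ∣ ≡ 2 ℕ.* (∣ m₀ ∣ ℕ.* ∣ m₀ ∣ ℕ.+ ∣ n₀ ∣ ℕ.* ∣ n₀ ∣)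
  squares = +-injective (trans (abs-squares (m₀ + n₀) (m₀ - n₀)) (trans (lem m₀ n₀)
    (trans (cong (+ 2 *_) (sym (abs-squares m₀ n₀))) (sym (pos-* 2 (∣ m₀ ∣ ℕ.* ∣ m₀ ∣ ℕ.+ ∣ n₀ ∣ ℕ.* ∣ n₀ ∣))))))
    where
    lem : ∀ m n → (m + n) * (m + n) + (m - n) * (m - n) ≡ + 2 * (m * m + n * n)
    lem = solve-∀
  re-lem : ∀ m n → (m - n) * (m - n) * ((m - n) * (m - n)) - + 6 * ((m - n) * (m - n) * ((m + n) * (m + n))) + (m + n) * (m + n) * ((m + n) * (m + n))
    ≡ - + 4 * (m * m * (m * m) - + 6 * (m * m * (n * n)) + n * n * (n * n))
  re-lem = solve-∀
  im-lem : ∀ m n → + 4 * ((m - n) * (m + n) * ((m - n) * (m - n) - (m + n) * (m + n))) ≡ - + 4 * (+ 4 * (m * n * (m * m - n * n)))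
  im-lem = solve-∀
  norm-lem : ∀ m n → ((m - n) * (m - n) + (m + n) * (m + n)) * ((m - n) * (m - n) + (m + n) * (m + n)) ≡ + 4 * ((m * m + n * n) * (m * m + n * n))
  norm-lem = solve-∀

-- The gap principle

module Pair {a b y z : ℕ} (t : Thue a b y) (t′ : Thue a b z) where
  open Thue t
  open Thue t′ using () renaming (p to p′; q to q′; R to R′; B to B′; norm to norm′; imaginary to imaginary′)

  m₀ n₀ : ℤ
  m₀ = p * p′ + q * q′
  n₀ = q * p′ - p * q′

  D : ℕ
  D = a ℕ.* a ℕ.+ b ℕ.* b

  pair-norm : m₀ * m₀ + n₀ * n₀ ≡ + (y ℕ.* z)
  pair-norm = trans (lem p q p′ q′) (trans (cong₂ _*_ norm norm′) (sym (pos-* y z)))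
    where
    lem : ∀ p q p′ q′ → (p * p′ + q * q′) * (p * p′ + q * q′) + (q * p′ - p * q′) * (q * p′ - p * q′)
      ≡ (p * p + q * q) * (p′ * p′ + q′ * q′)
    lem = solve-∀

  -- With `pair-im` this says D x⁴ = η η̄′ for x = γγ̄′, because ωω̄ = D.
  pair-re : + D * Re⁴ m₀ n₀ ≡ R * R′ + B * B′
  pair-re = trans (cong₂ _*_ (abs-squares (+ a) (+ b)) (Re⁴-product p q p′ q′))
    (lem (+ a) (+ b) (Re⁴ p q) (Im⁴ p q) (Re⁴ p′ q′) (Im⁴ p′ q′))
    where
    lem : ∀ a b x y x′ y′ → (a * a + b * b) * (x * x′ + y * y′)
      ≡ (a * x + b * y) * (a * x′ + b * y′) + (a * y - b * x) * (a * y′ - b * x′)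
    lem = solve-∀

  pair-im : + D * Im⁴ m₀ n₀ ≡ B * R′ - R * B′
  pair-im = trans (cong₂ _*_ (abs-squares (+ a) (+ b)) (Im⁴-product p q p′ q′))
    (lem (+ a) (+ b) (Re⁴ p q) (Im⁴ p q) (Re⁴ p′ q′) (Im⁴ p′ q′))
    where
    lem : ∀ a b x y x′ y′ → (a * a + b * b) * (y * x′ - x * y′)
      ≡ (a * y - b * x) * (a * x′ + b * y′) - (a * x + b * y) * (a * y′ - b * x′)
    lem = solve-∀

  module _ (0<b : 0 ℕ.< b) (y<z : y ℕ.< z) where
    private
      ρ ρ′ : ℕ
      ρ = ∣ R ∣
      ρ′ = ∣ R′ ∣

      0<D : 0 ℕ.< D
      0<D = ℕ.<-≤-trans (ℕ.*-mono-< 0<b 0<b) (ℕ.m≤n+m (b ℕ.* b) (a ℕ.* a))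

      ρ<ρ′ : ρ ℕ.< ρ′
      ρ<ρ′ = ℕ.≰⇒> λ ρ′≤ρ → ℕ.<⇒≱ (ℕ.*-monoʳ-< D {{ℕ.>-nonZero 0<D}} (ℕ.*-mono-< (ℕ.*-mono-< y<z y<z) (ℕ.*-mono-< y<z y<z)))
        (ℕ.≤-trans (ℕ.≤-reflexive (sym (R-norm t′))) (ℕ.≤-trans (ℕ.+-monoˡ-≤ (b ℕ.* b) (ℕ.*-mono-≤ ρ′≤ρ ρ′≤ρ)) (ℕ.≤-reflexive (R-norm t))))

    -- Otherwise BR′ = RB′ with |B| = |B′| = b, so ρ = ρ′, whereas y < z forces ρ < ρ′.
    pair-im≢0 : Im⁴ m₀ n₀ ≢ + 0
    pair-im≢0 e = ℕ.<⇒≢ (ℕ.*-monoʳ-< b {{ℕ.>-nonZero 0<b}} ρ<ρ′) (begin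
      b ℕ.* ρ       ≡⟨ ℕ.*-comm b ρ ⟩
      ρ ℕ.* b       ≡⟨ cong (ρ ℕ.*_) imaginary′ ⟨
      ρ ℕ.* ∣ B′ ∣  ≡⟨ abs-* R B′ ⟨
      ∣ R * B′ ∣    ≡⟨ cong ∣_∣ (i-j≡0⇒i≡j (B * R′) (R * B′) (trans (sym pair-im) (trans (cong (+ D *_) e) (*-zeroʳ (+ D))))) ⟨
      ∣ B * R′ ∣    ≡⟨ abs-* B R′ ⟩
      ∣ B ∣ ℕ.* ρ′  ≡⟨ cong (ℕ._* ρ′) imaginary ⟩
      b ℕ.* ρ′      ∎)
      where open ≡-Reasoning

    private
      ν μ δ S : ℕ
      ν = ∣ n₀ ∣
      μ = ∣ m₀ ∣
      δ = ∣ m₀ * m₀ - n₀ * n₀ ∣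
      S = y ℕ.* z

      ν≢0 : ν ≢ 0
      ν≢0 e = pair-im≢0 (trans (cong (Im⁴ m₀) (∣i∣≡0⇒i≡0 {n₀} e)) (lem m₀))
        where
        lem : ∀ p → + 4 * (p * + 0 * (p * p - + 0 * + 0)) ≡ + 0
        lem = solve-∀
      μ≢0 : μ ≢ 0
      μ≢0 e = pair-im≢0 (trans (cong (λ m → Im⁴ m n₀) (∣i∣≡0⇒i≡0 {m₀} e)) (lem n₀))
        where
        lem : ∀ q → + 4 * (+ 0 * q * (+ 0 * + 0 - q * q)) ≡ + 0
        lem = solve-∀
      d≢0 : ∣ m₀ - n₀ ∣ ≢ 0
      d≢0 e = pair-im≢0 (trans (lem m₀ n₀) (trans (cong (λ x → + 4 * (m₀ * n₀ * (x * (m₀ + n₀)))) (∣i∣≡0⇒i≡0 {m₀ - n₀} e)) (lem′ (m₀ * n₀) (m₀ + n₀))))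
        where
        lem : ∀ m n → + 4 * (m * n * (m * m - n * n)) ≡ + 4 * (m * n * ((m - n) * (m + n)))
        lem = solve-∀
        lem′ : ∀ x y → + 4 * (x * (+ 0 * y)) ≡ + 0
        lem′ = solve-∀
      e≢0 : ∣ m₀ + n₀ ∣ ≢ 0
      e≢0 e = pair-im≢0 (trans (lem m₀ n₀) (trans (cong (λ x → + 4 * (m₀ * n₀ * ((m₀ - n₀) * x))) (∣i∣≡0⇒i≡0 {m₀ + n₀} e)) (lem′ (m₀ * n₀) (m₀ - n₀))))
        where
        lem : ∀ m n → + 4 * (m * n * (m * m - n * n)) ≡ + 4 * (m * n * ((m - n) * (m + n)))
        lem = solve-∀
        lem′ : ∀ x y → + 4 * (x * (y * + 0)) ≡ + 0
        lem′ = solve-∀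

      product-≥ : ∀ x y → x ≢ 0 → y ≢ 0 → x ℕ.+ y ℕ.≤ x ℕ.* y ℕ.+ 1
      product-≥ zero    y       x≢0 y≢0 = ⊥-elim (x≢0 refl)
      product-≥ (suc x) zero    x≢0 y≢0 = ⊥-elim (y≢0 refl)
      product-≥ (suc x) (suc y) x≢0 y≢0 = ℕ.≤-trans (ℕ.m≤m+n _ (x ℕ.* y)) (ℕ.≤-reflexive (lem x y))
        where
        lem : ∀ x y → suc x ℕ.+ suc y ℕ.+ x ℕ.* y ≡ suc x ℕ.* suc y ℕ.+ 1
        lem = ℕ-solve-∀

      square≢0 : ∀ {x} → x ≢ 0 → x ℕ.* x ≢ 0
      square≢0 {x} x≢0 e = [ x≢0 , x≢0 ]′ (ℕ.m*n≡0⇒m≡0∨n≡0 x e)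

      -- The squares of the imaginary and real parts of x²; their sum is S², and 4uv is the square
      -- of Im x⁴.
      u v : ℕ
      u = 4 ℕ.* (μ ℕ.* μ ℕ.* (ν ℕ.* ν))
      v = δ ℕ.* δ

      μ²+ν²≡S : μ ℕ.* μ ℕ.+ ν ℕ.* ν ≡ S
      μ²+ν²≡S = +-injective (trans (abs-squares m₀ n₀) pair-norm)

      u+v≡S² : u ℕ.+ v ≡ S ℕ.* S
      u+v≡S² = +-injective (begin
        + u + + v
          ≡⟨ cong₂ _+_ (trans (pos-* 4 (μ ℕ.* μ ℕ.* (ν ℕ.* ν))) (cong (+ 4 *_) (trans (pos-* (μ ℕ.* μ) (ν ℕ.* ν)) (cong₂ _*_ (abs-square m₀) (abs-square n₀))))) (abs-square (m₀ * m₀ - n₀ * n₀)) ⟩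
        + 4 * (m₀ * m₀ * (n₀ * n₀)) + (m₀ * m₀ - n₀ * n₀) * (m₀ * m₀ - n₀ * n₀)
          ≡⟨ lem (m₀ * m₀) (n₀ * n₀) ⟩
        (m₀ * m₀ + n₀ * n₀) * (m₀ * m₀ + n₀ * n₀)
          ≡⟨ trans (cong₂ _*_ pair-norm pair-norm) (sym (pos-* S S)) ⟩
        + (S ℕ.* S) ∎)
        where
        open ≡-Reasoning
        lem : ∀ x y → + 4 * (x * y) + (x - y) * (x - y) ≡ (x + y) * (x + y)
        lem = solve-∀

      1≤S : 1 ℕ.≤ S
      1≤S = subst (1 ℕ.≤_) μ²+ν²≡S (ℕ.≤-trans (ℕ.n≢0⇒n>0 (square≢0 μ≢0)) (ℕ.m≤m+n (μ ℕ.* μ) (ν ℕ.* ν)))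

      2S≤u+1 : 2 ℕ.* S ℕ.≤ u ℕ.+ 1
      2S≤u+1 = ℕ.+-cancelʳ-≤ 3 _ _ (begin
        2 ℕ.* S ℕ.+ 3        ≤⟨ ℕ.+-monoʳ-≤ (2 ℕ.* S) (s≤ S 2≤S) ⟩
        2 ℕ.* S ℕ.+ 2 ℕ.* S  ≡⟨ lem₁ S ⟩
        4 ℕ.* S              ≡⟨ cong (4 ℕ.*_) (sym μ²+ν²≡S) ⟩
        4 ℕ.* (μ ℕ.* μ ℕ.+ ν ℕ.* ν)  ≤⟨ ℕ.*-monoʳ-≤ 4 (product-≥ (μ ℕ.* μ) (ν ℕ.* ν) (square≢0 μ≢0) (square≢0 ν≢0)) ⟩
        4 ℕ.* (μ ℕ.* μ ℕ.* (ν ℕ.* ν) ℕ.+ 1) ≡⟨ lem₂ (μ ℕ.* μ ℕ.* (ν ℕ.* ν)) ⟩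
        u ℕ.+ 1 ℕ.+ 3        ∎)
        where
        open ℕ.≤-Reasoning
        2≤S : 2 ℕ.≤ S
        2≤S = subst (2 ℕ.≤_) μ²+ν²≡S (ℕ.+-mono-≤ {1} {μ ℕ.* μ} {1} {ν ℕ.* ν} (ℕ.n≢0⇒n>0 (square≢0 μ≢0)) (ℕ.n≢0⇒n>0 (square≢0 ν≢0)))
        s≤ : ∀ S → 2 ℕ.≤ S → 3 ℕ.≤ 2 ℕ.* S
        s≤ S h = ℕ.≤-trans (ℕ.n≤1+n 3) (ℕ.*-monoʳ-≤ 2 h)
        lem₁ : ∀ x → 2 ℕ.* x ℕ.+ 2 ℕ.* x ≡ 4 ℕ.* x
        lem₁ = ℕ-solve-∀
        lem₂ : ∀ x → 4 ℕ.* (x ℕ.+ 1) ≡ 4 ℕ.* x ℕ.+ 1 ℕ.+ 3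
        lem₂ = ℕ-solve-∀

      2S≤v+1 : 2 ℕ.* S ℕ.≤ v ℕ.+ 1
      2S≤v+1 = subst₂ ℕ._≤_ sum-eq product-eq (product-≥ (d ℕ.* d) (e ℕ.* e) (square≢0 d≢0) (square≢0 e≢0))
        where
        d e : ℕ
        d = ∣ m₀ - n₀ ∣
        e = ∣ m₀ + n₀ ∣
        sum-eq : d ℕ.* d ℕ.+ e ℕ.* e ≡ 2 ℕ.* S
        sum-eq = +-injective (trans (abs-squares (m₀ - n₀) (m₀ + n₀)) (trans (lem m₀ n₀)
          (trans (cong (+ 2 *_) pair-norm) (sym (pos-* 2 S)))))
          where
          lem : ∀ m n → (m - n) * (m - n) + (m + n) * (m + n) ≡ + 2 * (m * m + n * n)
          lem = solve-∀
        product-eq : d ℕ.* d ℕ.* (e ℕ.* e) ℕ.+ 1 ≡ v ℕ.+ 1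
        product-eq = cong (ℕ._+ 1) (trans (lem d e) (cong (λ x → x ℕ.* x) (trans (sym (abs-* (m₀ - n₀) (m₀ + n₀))) (cong ∣_∣ (lem′ m₀ n₀)))))
          where
          lem : ∀ x y → x ℕ.* x ℕ.* (y ℕ.* y) ≡ x ℕ.* y ℕ.* (x ℕ.* y)
          lem = ℕ-solve-∀
          lem′ : ∀ m n → (m - n) * (m + n) ≡ m * m - n * n
          lem′ = solve-∀

      -- Both u and v are at least k = 2S - 1, so (u - k)(v - k) ≥ 0 gives uv ≥ k(u + v) - k² = kS²
      -- - k². Geometrically, x⁴ is not real, so by integrality it cannot lie too close to the real
      -- axis.
      uv-≥ : 2 ℕ.* (S ℕ.* S ℕ.* S) ℕ.≤ u ℕ.* v ℕ.+ 5 ℕ.* (S ℕ.* S)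
      uv-≥ = aux (u ℕ.∸ k) (v ℕ.∸ k) (ℕ.m+[n∸m]≡n (k≤ 2S≤u+1)) (ℕ.m+[n∸m]≡n (k≤ 2S≤v+1))
        where
        open ℕ.≤-Reasoning
        k : ℕ
        k = 2 ℕ.* S ℕ.∸ 1
        1+k≡2S : k ℕ.+ 1 ≡ 2 ℕ.* S
        1+k≡2S = ℕ.m∸n+n≡m (ℕ.≤-trans 1≤S (ℕ.m≤m+n S (S ℕ.+ 0)))
        k≤ : ∀ {x} → 2 ℕ.* S ℕ.≤ x ℕ.+ 1 → k ℕ.≤ x
        k≤ h = ℕ.+-cancelʳ-≤ 1 _ _ (ℕ.≤-trans (ℕ.≤-reflexive 1+k≡2S) h)
        k≤2S : k ℕ.≤ 2 ℕ.* S
        k≤2S = ℕ.≤-trans (ℕ.m≤m+n k 1) (ℕ.≤-reflexive 1+k≡2S)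
        aux : ∀ g h → k ℕ.+ g ≡ u → k ℕ.+ h ≡ v → 2 ℕ.* (S ℕ.* S ℕ.* S) ℕ.≤ u ℕ.* v ℕ.+ 5 ℕ.* (S ℕ.* S)
        aux g h eg eh = begin
          2 ℕ.* (S ℕ.* S ℕ.* S)
            ≡⟨ lem₁ S ⟩
          2 ℕ.* S ℕ.* (S ℕ.* S)
            ≡⟨ cong (ℕ._* (S ℕ.* S)) 1+k≡2S ⟨
          (k ℕ.+ 1) ℕ.* (S ℕ.* S)
            ≡⟨ trans (ℕ.*-distribʳ-+ (S ℕ.* S) k 1) (cong (λ x → k ℕ.* x ℕ.+ 1 ℕ.* (S ℕ.* S)) (trans (sym u+v≡S²) (sym (cong₂ ℕ._+_ eg eh)))) ⟩
          k ℕ.* (k ℕ.+ g ℕ.+ (k ℕ.+ h)) ℕ.+ 1 ℕ.* (S ℕ.* S)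
            ≤⟨ ℕ.m≤m+n _ (g ℕ.* h) ⟩
          k ℕ.* (k ℕ.+ g ℕ.+ (k ℕ.+ h)) ℕ.+ 1 ℕ.* (S ℕ.* S) ℕ.+ g ℕ.* h
            ≡⟨ lem₂ k g h (S ℕ.* S) ⟩
          (k ℕ.+ g) ℕ.* (k ℕ.+ h) ℕ.+ k ℕ.* k ℕ.+ S ℕ.* S
            ≤⟨ ℕ.+-monoˡ-≤ (S ℕ.* S) (ℕ.+-monoʳ-≤ ((k ℕ.+ g) ℕ.* (k ℕ.+ h)) (ℕ.*-mono-≤ k≤2S k≤2S)) ⟩
          (k ℕ.+ g) ℕ.* (k ℕ.+ h) ℕ.+ 2 ℕ.* S ℕ.* (2 ℕ.* S) ℕ.+ S ℕ.* S
            ≡⟨ lem₃ ((k ℕ.+ g) ℕ.* (k ℕ.+ h)) S ⟩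
          (k ℕ.+ g) ℕ.* (k ℕ.+ h) ℕ.+ 5 ℕ.* (S ℕ.* S)
            ≡⟨ cong₂ (λ x y → x ℕ.* y ℕ.+ 5 ℕ.* (S ℕ.* S)) eg eh ⟩
          u ℕ.* v ℕ.+ 5 ℕ.* (S ℕ.* S) ∎
          where
          lem₁ : ∀ S → 2 ℕ.* (S ℕ.* S ℕ.* S) ≡ 2 ℕ.* S ℕ.* (S ℕ.* S)
          lem₁ = ℕ-solve-∀
          lem₂ : ∀ k g h s → k ℕ.* (k ℕ.+ g ℕ.+ (k ℕ.+ h)) ℕ.+ 1 ℕ.* s ℕ.+ g ℕ.* h ≡ (k ℕ.+ g) ℕ.* (k ℕ.+ h) ℕ.+ k ℕ.* k ℕ.+ s
          lem₂ = ℕ-solve-∀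
          lem₃ : ∀ x S → x ℕ.+ 2 ℕ.* S ℕ.* (2 ℕ.* S) ℕ.+ S ℕ.* S ≡ x ℕ.+ 5 ℕ.* (S ℕ.* S)
          lem₃ = ℕ-solve-∀

      Y⁴ Z⁴ : ℕ
      Y⁴ = y ℕ.* y ℕ.* (y ℕ.* y)
      Z⁴ = z ℕ.* z ℕ.* (z ℕ.* z)

      -- The opposite bound: D · Im x⁴ = BR′ - RB′ has absolute value at most b(ρ + ρ′), since both
      -- η and η′ are within b of the real axis.
      uv-≤ : 2 ℕ.* (u ℕ.* v) ℕ.≤ Y⁴ ℕ.+ Z⁴
      uv-≤ = ℕ.*-cancelˡ-≤ (2 ℕ.* (D ℕ.* D)) {{ℕ.m*n≢0 2 (D ℕ.* D) {{_}} {{ℕ.m*n≢0 D D {{ℕ.>-nonZero 0<D}} {{ℕ.>-nonZero 0<D}}}}}} (begin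
        2 ℕ.* (D ℕ.* D) ℕ.* (2 ℕ.* (u ℕ.* v))
          ≡⟨ lem₁ D (μ ℕ.* μ) (ν ℕ.* ν) v ⟩
        (D ℕ.* D) ℕ.* (16 ℕ.* (μ ℕ.* μ ℕ.* (ν ℕ.* ν)) ℕ.* v)
          ≡⟨ lem₂ D μ ν δ ⟩
        D ℕ.* (4 ℕ.* (μ ℕ.* ν ℕ.* δ)) ℕ.* (D ℕ.* (4 ℕ.* (μ ℕ.* ν ℕ.* δ)))
          ≡⟨ cong (λ x → x ℕ.* x) im-abs ⟨
        ∣ B * R′ - R * B′ ∣ ℕ.* ∣ B * R′ - R * B′ ∣
          ≤⟨ ℕ.*-mono-≤ im-≤ im-≤ ⟩
        b ℕ.* (ρ ℕ.+ ρ′) ℕ.* (b ℕ.* (ρ ℕ.+ ρ′))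
          ≡⟨ lem₃ b ρ ρ′ ⟩
        b ℕ.* b ℕ.* ((ρ ℕ.+ ρ′) ℕ.* (ρ ℕ.+ ρ′))
          ≤⟨ ℕ.*-mono-≤ (ℕ.m≤n+m (b ℕ.* b) (a ℕ.* a)) (sum-square ρ ρ′) ⟩
        D ℕ.* (2 ℕ.* (ρ ℕ.* ρ ℕ.+ ρ′ ℕ.* ρ′))
          ≤⟨ ℕ.*-monoʳ-≤ D (ℕ.*-monoʳ-≤ 2 (ℕ.+-mono-≤ (ℕ.≤-trans (ℕ.m≤m+n (ρ ℕ.* ρ) (b ℕ.* b)) (ℕ.≤-reflexive (R-norm t)))
               (ℕ.≤-trans (ℕ.m≤m+n (ρ′ ℕ.* ρ′) (b ℕ.* b)) (ℕ.≤-reflexive (R-norm t′))))) ⟩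
        D ℕ.* (2 ℕ.* (D ℕ.* Y⁴ ℕ.+ D ℕ.* Z⁴))
          ≡⟨ lem₄ D Y⁴ Z⁴ ⟩
        2 ℕ.* (D ℕ.* D) ℕ.* (Y⁴ ℕ.+ Z⁴) ∎)
        where
        open ℕ.≤-Reasoning
        im-abs : ∣ B * R′ - R * B′ ∣ ≡ D ℕ.* (4 ℕ.* (μ ℕ.* ν ℕ.* δ))
        im-abs = trans (cong ∣_∣ (sym pair-im)) (trans (abs-* (+ D) (Im⁴ m₀ n₀)) (cong (D ℕ.*_)
          (trans (abs-* (+ 4) (m₀ * n₀ * (m₀ * m₀ - n₀ * n₀))) (cong (4 ℕ.*_) (abs-*³ m₀ n₀ (m₀ * m₀ - n₀ * n₀))))))
        im-≤ : ∣ B * R′ - R * B′ ∣ ℕ.≤ b ℕ.* (ρ ℕ.+ ρ′)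
        im-≤ = ℕ.≤-trans (∣i-j∣≤∣i∣+∣j∣ (B * R′) (R * B′)) (ℕ.≤-reflexive (trans
          (cong₂ ℕ._+_ (trans (abs-* B R′) (cong (ℕ._* ρ′) imaginary)) (trans (abs-* R B′) (cong (ρ ℕ.*_) imaginary′))) (lem b ρ ρ′)))
          where
          lem : ∀ b p q → b ℕ.* q ℕ.+ p ℕ.* b ≡ b ℕ.* (p ℕ.+ q)
          lem = ℕ-solve-∀
        sum-square : ∀ x y → (x ℕ.+ y) ℕ.* (x ℕ.+ y) ℕ.≤ 2 ℕ.* (x ℕ.* x ℕ.+ y ℕ.* y)
        sum-square x y with ℕ.≤-total x y
        ... | inj₁ x≤y = subst (λ y → (x ℕ.+ y) ℕ.* (x ℕ.+ y) ℕ.≤ 2 ℕ.* (x ℕ.* x ℕ.+ y ℕ.* y)) (ℕ.m+[n∸m]≡n x≤y) (ordered x (y ℕ.∸ x))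
          where
          ordered : ∀ x d → (x ℕ.+ (x ℕ.+ d)) ℕ.* (x ℕ.+ (x ℕ.+ d)) ℕ.≤ 2 ℕ.* (x ℕ.* x ℕ.+ (x ℕ.+ d) ℕ.* (x ℕ.+ d))
          ordered x d = ℕ.≤-trans (ℕ.m≤m+n _ (d ℕ.* d)) (ℕ.≤-reflexive (lem x d))
            where
            lem : ∀ x d → (x ℕ.+ (x ℕ.+ d)) ℕ.* (x ℕ.+ (x ℕ.+ d)) ℕ.+ d ℕ.* d ≡ 2 ℕ.* (x ℕ.* x ℕ.+ (x ℕ.+ d) ℕ.* (x ℕ.+ d))
            lem = ℕ-solve-∀
        ... | inj₂ y≤x = subst (λ x → (x ℕ.+ y) ℕ.* (x ℕ.+ y) ℕ.≤ 2 ℕ.* (x ℕ.* x ℕ.+ y ℕ.* y)) (ℕ.m+[n∸m]≡n y≤x) (ordered y (x ℕ.∸ y))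
          where
          ordered : ∀ y d → (y ℕ.+ d ℕ.+ y) ℕ.* (y ℕ.+ d ℕ.+ y) ℕ.≤ 2 ℕ.* ((y ℕ.+ d) ℕ.* (y ℕ.+ d) ℕ.+ y ℕ.* y)
          ordered y d = ℕ.≤-trans (ℕ.m≤m+n _ (d ℕ.* d)) (ℕ.≤-reflexive (lem y d))
            where
            lem : ∀ y d → (y ℕ.+ d ℕ.+ y) ℕ.* (y ℕ.+ d ℕ.+ y) ℕ.+ d ℕ.* d ≡ 2 ℕ.* ((y ℕ.+ d) ℕ.* (y ℕ.+ d) ℕ.+ y ℕ.* y)
            lem = ℕ-solve-∀
        lem₁ : ∀ D x y v → 2 ℕ.* (D ℕ.* D) ℕ.* (2 ℕ.* (4 ℕ.* (x ℕ.* y) ℕ.* v)) ≡ (D ℕ.* D) ℕ.* (16 ℕ.* (x ℕ.* y) ℕ.* v)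
        lem₁ = ℕ-solve-∀
        lem₂ : ∀ D m n d → (D ℕ.* D) ℕ.* (16 ℕ.* (m ℕ.* m ℕ.* (n ℕ.* n)) ℕ.* (d ℕ.* d)) ≡ D ℕ.* (4 ℕ.* (m ℕ.* n ℕ.* d)) ℕ.* (D ℕ.* (4 ℕ.* (m ℕ.* n ℕ.* d)))
        lem₂ = ℕ-solve-∀
        lem₃ : ∀ b p q → b ℕ.* (p ℕ.+ q) ℕ.* (b ℕ.* (p ℕ.+ q)) ≡ b ℕ.* b ℕ.* ((p ℕ.+ q) ℕ.* (p ℕ.+ q))
        lem₃ = ℕ-solve-∀
        lem₄ : ∀ D y z → D ℕ.* (2 ℕ.* (D ℕ.* y ℕ.+ D ℕ.* z)) ≡ 2 ℕ.* (D ℕ.* D) ℕ.* (y ℕ.+ z)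
        lem₄ = ℕ-solve-∀

    -- Together the two bounds give 4S³ ≤ y⁴ + z⁴ + 10S². If z were below 3y³, then z⁴ ≤ 3S³ and y⁴
    -- ≤ S² would leave S³ ≤ 11S², against S ≥ 25.
    gap : 5 ℕ.≤ y → 3 ℕ.* (y ℕ.* y ℕ.* y) ℕ.≤ z
    gap 5≤y = ℕ.≮⇒≥ λ z<3y³ → ℕ.<⇒≱ 11<S (ℕ.*-cancelʳ-≤ S 11 (S ℕ.* S) {{ℕ.m*n≢0 S S {{ℕ.>-nonZero 1≤S}} {{ℕ.>-nonZero 1≤S}}}} (S³≤11S² (ℕ.<⇒≤ z<3y³)))
      where
      open ℕ.≤-Reasoning
      11<S : 11 ℕ.< S
      11<S = ℕ.≤-trans (ℕ.≤ᵇ⇒≤ 12 25 _) (ℕ.*-mono-≤ 5≤y (ℕ.≤-trans 5≤y (ℕ.<⇒≤ y<z)))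
      S³≤11S² : z ℕ.≤ 3 ℕ.* (y ℕ.* y ℕ.* y) → S ℕ.* (S ℕ.* S) ℕ.≤ 11 ℕ.* (S ℕ.* S)
      S³≤11S² z≤3y³ = ℕ.+-cancelˡ-≤ (3 ℕ.* (S ℕ.* S ℕ.* S)) _ _ (begin
        3 ℕ.* (S ℕ.* S ℕ.* S) ℕ.+ S ℕ.* (S ℕ.* S)
          ≡⟨ lem₁ S ⟩
        2 ℕ.* (2 ℕ.* (S ℕ.* S ℕ.* S))
          ≤⟨ ℕ.*-monoʳ-≤ 2 uv-≥ ⟩
        2 ℕ.* (u ℕ.* v ℕ.+ 5 ℕ.* (S ℕ.* S))
          ≡⟨ lem₂ (u ℕ.* v) (S ℕ.* S) ⟩
        2 ℕ.* (u ℕ.* v) ℕ.+ 10 ℕ.* (S ℕ.* S)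
          ≤⟨ ℕ.+-monoˡ-≤ (10 ℕ.* (S ℕ.* S)) uv-≤ ⟩
        Y⁴ ℕ.+ Z⁴ ℕ.+ 10 ℕ.* (S ℕ.* S)
          ≤⟨ ℕ.+-monoˡ-≤ (10 ℕ.* (S ℕ.* S)) (ℕ.+-mono-≤ (ℕ.*-monoʳ-≤ (y ℕ.* y) (ℕ.*-mono-≤ (ℕ.<⇒≤ y<z) (ℕ.<⇒≤ y<z))) (ℕ.*-monoʳ-≤ (z ℕ.* z) (ℕ.*-monoʳ-≤ z z≤3y³))) ⟩
        y ℕ.* y ℕ.* (z ℕ.* z) ℕ.+ z ℕ.* z ℕ.* (z ℕ.* (3 ℕ.* (y ℕ.* y ℕ.* y))) ℕ.+ 10 ℕ.* (S ℕ.* S)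
          ≡⟨ lem₃ y z ⟩
        3 ℕ.* (S ℕ.* S ℕ.* S) ℕ.+ 11 ℕ.* (S ℕ.* S) ∎)
        where
        lem₁ : ∀ S → 3 ℕ.* (S ℕ.* S ℕ.* S) ℕ.+ S ℕ.* (S ℕ.* S) ≡ 2 ℕ.* (2 ℕ.* (S ℕ.* S ℕ.* S))
        lem₁ = ℕ-solve-∀
        lem₂ : ∀ x y → 2 ℕ.* (x ℕ.+ 5 ℕ.* y) ≡ 2 ℕ.* x ℕ.+ 10 ℕ.* y
        lem₂ = ℕ-solve-∀
        lem₃ : ∀ y z → y ℕ.* y ℕ.* (z ℕ.* z) ℕ.+ z ℕ.* z ℕ.* (z ℕ.* (3 ℕ.* (y ℕ.* y ℕ.* y))) ℕ.+ 10 ℕ.* (y ℕ.* z ℕ.* (y ℕ.* z))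
          ≡ 3 ℕ.* (y ℕ.* z ℕ.* (y ℕ.* z) ℕ.* (y ℕ.* z)) ℕ.+ 11 ℕ.* (y ℕ.* z ℕ.* (y ℕ.* z))
        lem₃ = ℕ-solve-∀

-- Three solutions above 1 are impossible

module _ {a b : ℕ} (0<a : 0 ℕ.< a) (0<b : 0 ℕ.< b) (coprime : Coprime a b) where

  module Base {y z : ℕ} (t : Thue a b y) (t′ : Thue a b z) (1<y : 1 ℕ.< y) (y<z : y ℕ.< z)
              (225bb≤yy : 225 ℕ.* (b ℕ.* b) ℕ.≤ y ℕ.* y) (375≤y : 375 ℕ.≤ y) where
    open Thue t
    open Thue t′ using () renaming (R to R′; B to B′; imaginary to imaginary′)
    open Pair t t′
    open ℕ.≤-Reasoning

    private
      ρ ρ′ S H Y⁴ Z⁴ : ℕ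
      ρ = ∣ R ∣
      ρ′ = ∣ R′ ∣
      S = y ℕ.* z
      H = D ℕ.* (S ℕ.* S)
      Y⁴ = y ℕ.* y ℕ.* (y ℕ.* y)
      Z⁴ = z ℕ.* z ℕ.* (z ℕ.* z)

      bb≤D : b ℕ.* b ℕ.≤ D
      bb≤D = ℕ.m≤n+m (b ℕ.* b) (a ℕ.* a)
      0<D : 0 ℕ.< D
      0<D = ℕ.<-≤-trans (ℕ.*-mono-< 0<b 0<b) bb≤D
      byy≤ρ : b ℕ.* (y ℕ.* y) ℕ.≤ ρ
      byy≤ρ = by²≤R t 0<a 0<b coprime 1<y
      375·375≤yy : 375 ℕ.* 375 ℕ.≤ y ℕ.* y
      375·375≤yy = ℕ.*-mono-≤ 375≤y 375≤y

      1100b≤ρ : 1100 ℕ.* b ℕ.≤ ρ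
      1100b≤ρ = begin
        1100 ℕ.* b         ≡⟨ ℕ.*-comm 1100 b ⟩
        b ℕ.* 1100         ≤⟨ ℕ.*-monoʳ-≤ b (ℕ.≤-trans (ℕ.≤ᵇ⇒≤ 1100 (375 ℕ.* 375) _) 375·375≤yy) ⟩
        b ℕ.* (y ℕ.* y)    ≤⟨ byy≤ρ ⟩
        ρ                  ∎

      225bbb≤ρ : 225 ℕ.* (b ℕ.* b ℕ.* b) ℕ.≤ ρ
      225bbb≤ρ = begin
        225 ℕ.* (b ℕ.* b ℕ.* b)    ≡⟨ lem b (b ℕ.* b) ⟩
        b ℕ.* (225 ℕ.* (b ℕ.* b))  ≤⟨ ℕ.*-monoʳ-≤ b 225bb≤yy ⟩
        b ℕ.* (y ℕ.* y)            ≤⟨ byy≤ρ ⟩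
        ρ                          ∎
        where
        lem : ∀ b c → 225 ℕ.* (c ℕ.* b) ≡ b ℕ.* (225 ℕ.* c)
        lem = ℕ-solve-∀

      32y≤z : 32 ℕ.* y ℕ.≤ z
      32y≤z = begin
        32 ℕ.* y                   ≤⟨ ℕ.*-monoˡ-≤ y (ℕ.≤-trans (ℕ.≤ᵇ⇒≤ 32 (375 ℕ.* 375) _) 375·375≤yy) ⟩
        y ℕ.* y ℕ.* y              ≤⟨ ℕ.m≤m+n (y ℕ.* y ℕ.* y) _ ⟩
        3 ℕ.* (y ℕ.* y ℕ.* y)      ≤⟨ gap 0<b y<z (5≤y t 0<a 0<b coprime 1<y) ⟩
        z                          ∎

      square-product : ∀ x y → x ℕ.* y ℕ.* (x ℕ.* y) ≡ x ℕ.* x ℕ.* (y ℕ.* y)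
      square-product = ℕ-solve-∀

      growth-≤ : ∀ k l → k ℕ.* k ℕ.+ 1 ℕ.≤ l ℕ.* l ℕ.* (l ℕ.* l) → l ℕ.* y ℕ.≤ z → k ℕ.* ρ ℕ.≤ ρ′
      growth-≤ k l kk<l⁴ ly≤z = square-≤ (ℕ.+-cancelʳ-≤ (b ℕ.* b) _ _ (begin
        k ℕ.* ρ ℕ.* (k ℕ.* ρ) ℕ.+ b ℕ.* b
          ≡⟨ cong (ℕ._+ b ℕ.* b) (square-product k ρ) ⟩
        k ℕ.* k ℕ.* (ρ ℕ.* ρ) ℕ.+ b ℕ.* b
          ≤⟨ ℕ.+-mono-≤ (ℕ.*-monoʳ-≤ (k ℕ.* k) (ℕ.≤-trans (ℕ.m≤m+n (ρ ℕ.* ρ) (b ℕ.* b)) (ℕ.≤-reflexive (R-norm t))))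
               (ℕ.≤-trans bb≤D (ℕ.m≤m*n D Y⁴ {{ℕ.>-nonZero 0<Y⁴}})) ⟩
        k ℕ.* k ℕ.* (D ℕ.* Y⁴) ℕ.+ D ℕ.* Y⁴
          ≡⟨ lem₂ (k ℕ.* k) (D ℕ.* Y⁴) ⟩
        (k ℕ.* k ℕ.+ 1) ℕ.* (D ℕ.* Y⁴)
          ≤⟨ ℕ.*-monoˡ-≤ (D ℕ.* Y⁴) kk<l⁴ ⟩
        l ℕ.* l ℕ.* (l ℕ.* l) ℕ.* (D ℕ.* Y⁴)
          ≡⟨ lem₃ l D y ⟩
        D ℕ.* (l ℕ.* y ℕ.* (l ℕ.* y) ℕ.* (l ℕ.* y ℕ.* (l ℕ.* y)))
          ≤⟨ ℕ.*-monoʳ-≤ D (ℕ.*-mono-≤ (ℕ.*-mono-≤ ly≤z ly≤z) (ℕ.*-mono-≤ ly≤z ly≤z)) ⟩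
        D ℕ.* Z⁴
          ≡⟨ R-norm t′ ⟨
        ρ′ ℕ.* ρ′ ℕ.+ b ℕ.* b ∎))
        where
        0<y : 0 ℕ.< y
        0<y = ℕ.<⇒≤ 1<y
        0<Y⁴ : 0 ℕ.< Y⁴
        0<Y⁴ = ℕ.*-mono-< (ℕ.*-mono-< 0<y 0<y) (ℕ.*-mono-< 0<y 0<y)
        lem₂ : ∀ k x → k ℕ.* x ℕ.+ x ≡ (k ℕ.+ 1) ℕ.* x
        lem₂ = ℕ-solve-∀
        lem₃ : ∀ k D y → k ℕ.* k ℕ.* (k ℕ.* k) ℕ.* (D ℕ.* (y ℕ.* y ℕ.* (y ℕ.* y))) ≡ D ℕ.* (k ℕ.* y ℕ.* (k ℕ.* y) ℕ.* (k ℕ.* y ℕ.* (k ℕ.* y)))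
        lem₃ = ℕ-solve-∀

      1000ρ≤ρ′ : 1000 ℕ.* ρ ℕ.≤ ρ′
      -- ρ grows like the square of y, and 32⁴ = 1048576 just exceeds 1000² + 1.
      1000ρ≤ρ′ = growth-≤ 1000 32 (ℕ.≤ᵇ⇒≤ (1000 ℕ.* 1000 ℕ.+ 1) (32 ℕ.* 32 ℕ.* (32 ℕ.* 32)) _) 32y≤z

      -- `H` is the absolute value of η η̄′; it differs from ρρ′ only through the small imaginary
      -- parts, so it lies between ρρ′ and 2ρρ′.
      HH≡ : H ℕ.* H ≡ (ρ ℕ.* ρ ℕ.+ b ℕ.* b) ℕ.* (ρ′ ℕ.* ρ′ ℕ.+ b ℕ.* b)
      HH≡ = trans (lem D y z) (sym (cong₂ ℕ._*_ (R-norm t) (R-norm t′)))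
        where
        lem : ∀ D y z → D ℕ.* (y ℕ.* z ℕ.* (y ℕ.* z)) ℕ.* (D ℕ.* (y ℕ.* z ℕ.* (y ℕ.* z)))
          ≡ D ℕ.* (y ℕ.* y ℕ.* (y ℕ.* y)) ℕ.* (D ℕ.* (z ℕ.* z ℕ.* (z ℕ.* z)))
        lem = ℕ-solve-∀

      ρρ′≤H : ρ ℕ.* ρ′ ℕ.≤ H
      ρρ′≤H = square-≤ (begin
        ρ ℕ.* ρ′ ℕ.* (ρ ℕ.* ρ′)                              ≡⟨ square-product ρ ρ′ ⟩
        ρ ℕ.* ρ ℕ.* (ρ′ ℕ.* ρ′)                              ≤⟨ ℕ.*-mono-≤ (ℕ.m≤m+n (ρ ℕ.* ρ) (b ℕ.* b)) (ℕ.m≤m+n (ρ′ ℕ.* ρ′) (b ℕ.* b)) ⟩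
        (ρ ℕ.* ρ ℕ.+ b ℕ.* b) ℕ.* (ρ′ ℕ.* ρ′ ℕ.+ b ℕ.* b)    ≡⟨ HH≡ ⟨
        H ℕ.* H                                              ∎)

      b≤ρ : b ℕ.≤ ρ
      b≤ρ = ℕ.≤-trans (ℕ.m≤m+n b (1099 ℕ.* b)) 1100b≤ρ
      b≤ρ′ : b ℕ.≤ ρ′
      b≤ρ′ = ℕ.≤-trans b≤ρ (ℕ.≤-trans (ℕ.m≤m+n ρ (999 ℕ.* ρ)) 1000ρ≤ρ′)

      H≤2ρρ′ : H ℕ.≤ 2 ℕ.* (ρ ℕ.* ρ′)
      H≤2ρρ′ = square-≤ (begin
        H ℕ.* H
          ≡⟨ HH≡ ⟩
        (ρ ℕ.* ρ ℕ.+ b ℕ.* b) ℕ.* (ρ′ ℕ.* ρ′ ℕ.+ b ℕ.* b)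
          ≤⟨ ℕ.*-mono-≤ (ℕ.+-monoʳ-≤ (ρ ℕ.* ρ) (ℕ.*-mono-≤ b≤ρ b≤ρ)) (ℕ.+-monoʳ-≤ (ρ′ ℕ.* ρ′) (ℕ.*-mono-≤ b≤ρ′ b≤ρ′)) ⟩
        (ρ ℕ.* ρ ℕ.+ ρ ℕ.* ρ) ℕ.* (ρ′ ℕ.* ρ′ ℕ.+ ρ′ ℕ.* ρ′)
          ≡⟨ lem ρ ρ′ ⟩
        2 ℕ.* (ρ ℕ.* ρ′) ℕ.* (2 ℕ.* (ρ ℕ.* ρ′)) ∎)
        where
        lem : ∀ x y → (x ℕ.* x ℕ.+ x ℕ.* x) ℕ.* (y ℕ.* y ℕ.+ y ℕ.* y) ≡ 2 ℕ.* (x ℕ.* y) ℕ.* (2 ℕ.* (x ℕ.* y))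
        lem = ℕ-solve-∀

      open Rotation (rotation m₀ n₀) renaming (norm² to rotation-norm)

      0<ν : 0 ℕ.< ∣ n ∣
      0<ν = ℕ.n≢0⇒n>0 λ ν≡0 → [ (λ σ≡0 → ℕ.<⇒≢ 0<s (sym (cong ∣_∣ σ≡0))) , pair-im≢0 0<b y<z ]′
        (i*j≡0⇒i≡0∨j≡0 σ (trans (sym im) (trans (cong (Im⁴ m) (∣i∣≡0⇒i≡0 {n} ν≡0)) (lem m))))
        where
        lem : ∀ p → + 4 * (p * + 0 * (p * p - + 0 * + 0)) ≡ + 0
        lem = solve-∀

      scale-re : + D * Re⁴ m n ≡ σ * (R * R′ + B * B′)
      scale-re = trans (cong (+ D *_) re) (trans (lem (+ D) σ (Re⁴ m₀ n₀)) (cong (σ *_) pair-re))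
        where
        lem : ∀ d s x → d * (s * x) ≡ s * (d * x)
        lem = solve-∀

      scale-im : + D * Im⁴ m n ≡ σ * (B * R′ - R * B′)
      scale-im = trans (cong (+ D *_) im) (trans (lem (+ D) σ (Im⁴ m₀ n₀)) (cong (σ *_) pair-im))
        where
        lem : ∀ d s x → d * (s * x) ≡ s * (d * x)
        lem = solve-∀

      N : ℕ
      N = ∣ m ∣ ℕ.* ∣ m ∣ ℕ.+ ∣ n ∣ ℕ.* ∣ n ∣

      NN≡ : N ℕ.* N ≡ ∣ σ ∣ ℕ.* (S ℕ.* S)
      NN≡ = +-injective (trans (pos-* N N) (trans (cong₂ _*_ (abs-squares m n) (abs-squares m n)) (trans rotation-norm
        (trans (cong (λ x → + ∣ σ ∣ * (x * x)) pair-norm) (trans (cong (+ ∣ σ ∣ *_) (sym (pos-* S S))) (sym (pos-* ∣ σ ∣ (S ℕ.* S))))))))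

      scale-norm : D ℕ.* (N ℕ.* N) ≡ ∣ σ ∣ ℕ.* H
      scale-norm = trans (cong (D ℕ.*_) NN≡) (lem D ∣ σ ∣ (S ℕ.* S))
        where
        lem : ∀ d s x → d ℕ.* (s ℕ.* x) ≡ s ℕ.* (d ℕ.* x)
        lem = ℕ-solve-∀

    contradiction : ⊥
    contradiction = NoApproximation.no-approximation R B R′ B′ n m D σ H
      (trans imaginary′ (sym imaginary)) (subst (0 ℕ.<_) (sym imaginary) 0<b) 0<ν 0<s s≤4
      (subst (λ x → x ℕ.* x ℕ.≤ D) (sym imaginary) bb≤D)
      (subst (λ x → 225 ℕ.* (x ℕ.* x ℕ.* x) ℕ.≤ ρ) (sym imaginary) 225bbb≤ρ)
      (subst (λ x → 1100 ℕ.* x ℕ.≤ ρ) (sym imaginary) 1100b≤ρ) 1000ρ≤ρ′ small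
      scale-re scale-im scale-norm ρρ′≤H H≤2ρρ′

  -- The smallest solution makes the middle one large: y ≥ 3x³ ≥ 375, and y² ≥ 9x⁶ ≥ 9 · 25 · b² by
  -- x ≥ 5 and b ≤ x².
  no-three-solutions : ∀ {x y z} → Thue a b x → Thue a b y → Thue a b z → 1 ℕ.< x → x ℕ.< y → y ℕ.< z → ⊥
  no-three-solutions {x} {y} {z} tx ty tz 1<x x<y y<z = Base.contradiction ty tz (ℕ.<-trans 1<x x<y) y<z 225bb≤yy 375≤y
    where
    open ℕ.≤-Reasoning
    5≤x : 5 ℕ.≤ x
    5≤x = 5≤y tx 0<a 0<b coprime 1<x
    b≤xx : b ℕ.≤ x ℕ.* x
    b≤xx = b≤y² tx 0<a 0<b coprime 1<x
    3xxx≤y : 3 ℕ.* (x ℕ.* x ℕ.* x) ℕ.≤ y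
    3xxx≤y = Pair.gap tx ty 0<b x<y 5≤x
    375≤y : 375 ℕ.≤ y
    375≤y = ℕ.≤-trans (ℕ.*-monoʳ-≤ 3 (ℕ.*-mono-≤ (ℕ.*-mono-≤ 5≤x 5≤x) 5≤x)) 3xxx≤y
    225bb≤yy : 225 ℕ.* (b ℕ.* b) ℕ.≤ y ℕ.* y
    225bb≤yy = begin
      225 ℕ.* (b ℕ.* b)
        ≡⟨ ℕ.*-assoc 9 25 (b ℕ.* b) ⟩
      9 ℕ.* (25 ℕ.* (b ℕ.* b))
        ≤⟨ ℕ.*-monoʳ-≤ 9 (ℕ.*-mono-≤ (ℕ.*-mono-≤ 5≤x 5≤x) (ℕ.*-mono-≤ b≤xx b≤xx)) ⟩
      9 ℕ.* (x ℕ.* x ℕ.* (x ℕ.* x ℕ.* (x ℕ.* x)))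
        ≡⟨ lem x ⟩
      3 ℕ.* (x ℕ.* x ℕ.* x) ℕ.* (3 ℕ.* (x ℕ.* x ℕ.* x))
        ≤⟨ ℕ.*-mono-≤ 3xxx≤y 3xxx≤y ⟩
      y ℕ.* y ∎
      where
      lem : ∀ x → 9 ℕ.* (x ℕ.* x ℕ.* (x ℕ.* x ℕ.* (x ℕ.* x))) ≡ 3 ℕ.* (x ℕ.* x ℕ.* x) ℕ.* (3 ℕ.* (x ℕ.* x ℕ.* x))
      lem = ℕ-solve-∀

-- From the quartic equation to the Thue equation

sign² : ∀ {e} → IsSign e → e * e ≡ + 1
sign² (inj₁ refl) = refl
sign² (inj₂ refl) = refl

sign-abs : ∀ {e} → IsSign e → ∣ e ∣ ≡ 1
sign-abs (inj₁ refl) = refl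
sign-abs (inj₂ refl) = refl

sign-neg : ∀ {e} → IsSign e → IsSign (- e)
sign-neg (inj₁ refl) = inj₂ refl
sign-neg (inj₂ refl) = inj₁ refl

sign-of : ∀ z → ∃ λ η → IsSign η × z ≡ η * + ∣ z ∣
sign-of (+ n)    = + 1 , inj₁ refl , sym (*-identityˡ (+ n))
sign-of -[1+ n ] = - + 1 , inj₂ refl , cong -[1+_] (sym (ℕ.+-identityʳ n))

mul-assoc : ∀ D u v w → mul D (mul D u v) w ≡ mul D u (mul D v w)
mul-assoc D (u₁ , u₂) (v₁ , v₂) (w₁ , w₂) = cong₂ _,_ (lem₁ D u₁ u₂ v₁ v₂ w₁ w₂) (lem₂ D u₁ u₂ v₁ v₂ w₁ w₂)
  where
  lem₁ : ∀ D u₁ u₂ v₁ v₂ w₁ w₂ → (u₁ * v₁ + D * (u₂ * v₂)) * w₁ + D * ((u₁ * v₂ + u₂ * v₁) * w₂)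
    ≡ u₁ * (v₁ * w₁ + D * (v₂ * w₂)) + D * (u₂ * (v₁ * w₂ + v₂ * w₁))
  lem₁ = solve-∀
  lem₂ : ∀ D u₁ u₂ v₁ v₂ w₁ w₂ → (u₁ * v₁ + D * (u₂ * v₂)) * w₂ + (u₁ * v₂ + u₂ * v₁) * w₁
    ≡ u₁ * (v₁ * w₂ + v₂ * w₁) + u₂ * (v₁ * w₁ + D * (v₂ * w₂))
  lem₂ = solve-∀

mul-identityˡ : ∀ D w → mul D (+ 1 , + 0) w ≡ w
mul-identityˡ D (w₁ , w₂) = cong₂ _,_ (lem₁ D w₁ w₂) (lem₂ w₁ w₂)
  where
  lem₁ : ∀ D x y → + 1 * x + D * (+ 0 * y) ≡ x
  lem₁ = solve-∀
  lem₂ : ∀ x y → + 1 * y + + 0 * x ≡ y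
  lem₂ = solve-∀

pow-+ : ∀ D z m n → pow D z (m ℕ.+ n) ≡ mul D (pow D z m) (pow D z n)
pow-+ D z zero    n = sym (mul-identityˡ D (pow D z n))
pow-+ D z (suc m) n = trans (cong (mul D z) (pow-+ D z m n)) (sym (mul-assoc D z (pow D z m) (pow D z n)))

pow-double : ∀ D z n → pow D z (2 ℕ.* n) ≡ mul D (pow D z n) (pow D z n)
pow-double D z n = trans (cong (λ k → pow D z (n ℕ.+ k)) (ℕ.+-identityʳ n)) (pow-+ D z n n)

2^2n : ∀ n → (+ 2) ^ (2 ℕ.* n) ≡ (+ 2) ^ n * (+ 2) ^ n
2^2n n = trans (cong (λ k → (+ 2) ^ (n ℕ.+ k)) (ℕ.+-identityʳ n)) (^-distribˡ-+-* (+ 2) n n)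

quadraticNorm : ℤ → ℤ√ → ℤ
quadraticNorm D (u , v) = u * u - D * (v * v)

quadraticNorm-mul : ∀ D z w → quadraticNorm D (mul D z w) ≡ quadraticNorm D z * quadraticNorm D w
quadraticNorm-mul D (u , v) (s , t) = lem D u v s t
  where
  lem : ∀ D u v s t → (u * s + D * (v * t)) * (u * s + D * (v * t)) - D * ((u * t + v * s) * (u * t + v * s))
    ≡ (u * u - D * (v * v)) * (s * s - D * (t * t))
  lem = solve-∀

-- The norm of (T + U√D)ⁿ is (-4)ⁿ; only the fact that its sign squares to 1 is needed, so the sign
-- κ is left unspecified.
quadraticNorm-pow : ∀ D z → quadraticNorm D z ≡ - + 4 → ∀ n →
  ∃ λ κ → IsSign κ × quadraticNorm D (pow D z n) ≡ κ * ((+ 2) ^ n * (+ 2) ^ n)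
quadraticNorm-pow D z h zero    = + 1 , inj₁ refl , lem D
  where
  lem : ∀ D → + 1 * + 1 - D * (+ 0 * + 0) ≡ + 1 * (+ 1 * + 1)
  lem = solve-∀
quadraticNorm-pow D z h (suc n) with quadraticNorm-pow D z h n
... | κ , sκ , ih = - κ , sign-neg sκ , trans (quadraticNorm-mul D z (pow D z n)) (trans (cong₂ _*_ h ih) (lem κ ((+ 2) ^ n)))
  where
  lem : ∀ κ e → - + 4 * (κ * (e * e)) ≡ - κ * (+ 2 * e * (+ 2 * e))
  lem = solve-∀

module _ (a b T U : ℕ) (pell : (+ T) ^ 2 - + (a ℕ.^ 2 ℕ.+ b ℕ.^ 2) * (+ U) ^ 2 ≡ - + 4) where
  private
    D : ℕ
    D = a ℕ.^ 2 ℕ.+ b ℕ.^ 2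

  D≡ : + D ≡ + a * + a + + b * + b
  D≡ = cong₂ _+_ (square a) (square b)
    where
    square : ∀ x → + (x ℕ.^ 2) ≡ + x * + x
    square x = trans (cong (λ y → + (x ℕ.* y)) (ℕ.*-identityʳ x)) (pos-* x x)

  pell-norm : quadraticNorm (+ D) (+ T , + U) ≡ - + 4
  pell-norm = trans (lem (+ T) (+ D) (+ U)) pell
    where
    lem : ∀ t d u → t * t - d * (u * u) ≡ t * (t * + 1) - d * (u * (u * + 1))
    lem = solve-∀

  -- Since α²ᵏ is a square, y is a sum of two squares up to the power of 2.
  record SumOfSquares (y : ℤ) : Set where
    field
      n : ℕ
      P Q ε δ κ : ℤ
      sign-ε : IsSign ε
      sign-δ : IsSign δ
      sign-κ : IsSign κ
      norm : P * P - + D * (Q * Q) ≡ κ * ((+ 2) ^ n * (+ 2) ^ n)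
      value : (+ 2) ^ n * (+ 2) ^ n * y ≡ ε * ((P + δ * + a * Q) * (P + δ * + a * Q) + + b * Q * (+ b * Q))

  -- The left side is the √D-coordinate of (δa + √D)(P + Q√D)². Since D = a² + b² and δ² = 1, it is
  -- a sum of two squares.
  square-expand : ∀ P Q δ → IsSign δ → P * P + + D * (Q * Q) + δ * + a * (P * Q + Q * P)
    ≡ (P + δ * + a * Q) * (P + δ * + a * Q) + + b * Q * (+ b * Q)
  square-expand P Q δ sδ = trans (cong (λ d → P * P + d * (Q * Q) + δ * + a * (P * Q + Q * P)) D≡δ²) (lem P Q δ (+ a) (+ b))
    where
    D≡δ² : + D ≡ δ * δ * (+ a * + a) + + b * + b
    D≡δ² = trans D≡ (cong (_+ + b * + b) (trans (sym (*-identityˡ (+ a * + a))) (cong (_* (+ a * + a)) (sym (sign² sδ)))))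
    lem : ∀ P Q δ a b → P * P + (δ * δ * (a * a) + b * b) * (Q * Q) + δ * a * (P * Q + Q * P)
      ≡ (P + δ * a * Q) * (P + δ * a * Q) + b * Q * (b * Q)
    lem = solve-∀

  2^n≢0 : ∀ n → NonZero ((+ 2) ^ n)
  2^n≢0 n = subst NonZero (pos-^ 2 n) (ℕ.m^n≢0 2 n)

  sumOfSquares : ∀ x y ε δ k → IsSign ε → IsSign δ → HasForm D a T U x y ε δ k → SumOfSquares y
  sumOfSquares x y ε δ (+ n) sε sδ h = record
    { n = n ; P = P ; Q = Q ; ε = ε ; δ = δ ; κ = proj₁ pow-norm ; sign-ε = sε ; sign-δ = sδ ; sign-κ = proj₁ (proj₂ pow-norm)
    ; norm = proj₂ (proj₂ pow-norm)
    ; value = trans (cong (_* y) (sym (2^2n n))) (trans (cong proj₂ (trans h (cong (mul (+ D) (scale ε (δ * + a , + 1))) (pow-double (+ D) (+ T , + U) n))))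
        (trans (lem ε (δ * + a) P Q (+ D)) (cong (ε *_) (square-expand P Q δ sδ)))) }
    where
    P Q : ℤ
    P = proj₁ (pow (+ D) (+ T , + U) n)
    Q = proj₂ (pow (+ D) (+ T , + U) n)
    pow-norm : ∃ λ κ → IsSign κ × P * P - + D * (Q * Q) ≡ κ * ((+ 2) ^ n * (+ 2) ^ n)
    pow-norm = quadraticNorm-pow (+ D) (+ T , + U) pell-norm n
    lem : ∀ ε c P Q D → ε * c * (P * Q + Q * P) + ε * + 1 * (P * P + D * (Q * Q))
      ≡ ε * (P * P + D * (Q * Q) + c * (P * Q + Q * P))
    lem = solve-∀
  -- For negative exponents the equation is multiplied by the conjugate of (P + Q√D)². The product
  -- of the two is the square of the norm, 16ⁿ, and conjugation replaces δ by - δ.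
  sumOfSquares x y ε δ -[1+ k ] sε sδ h = record
    { n = n ; P = P ; Q = Q ; ε = ε ; δ = - δ ; κ = κ ; sign-ε = sε ; sign-δ = sign-neg sδ ; sign-κ = sκ
    ; norm = norm′
    ; value = *-cancelˡ-≡ (e * e) (e * e * y) _ {{i*j≢0 e e {{2^n≢0 n}} {{2^n≢0 n}}}} (begin
        e * e * (e * e * y)
          ≡⟨ lem₁ e y ⟩
        + 1 * (e * e) * (e * e) * y
          ≡⟨ cong (λ o → o * (e * e) * (e * e) * y) (sign² sκ) ⟨
        κ * κ * (e * e) * (e * e) * y
          ≡⟨ lem₂ κ (e * e) y ⟩
        κ * (e * e) * (κ * (e * e)) * y
          ≡⟨ cong (λ o → o * o * y) norm′ ⟨
        (P * P - + D * (Q * Q)) * (P * P - + D * (Q * Q)) * y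
          ≡⟨ lem₃ x y P Q (+ D) ⟩
        (P * P + + D * (Q * Q)) * (x * (P * Q + Q * P) + y * (P * P + + D * (Q * Q)))
          - (P * Q + Q * P) * (x * (P * P + + D * (Q * Q)) + + D * (y * (P * Q + Q * P)))
          ≡⟨ cong₂ (λ u v → (P * P + + D * (Q * Q)) * u - (P * Q + Q * P) * v) (cong proj₂ h′) (cong proj₁ h′) ⟩
        (P * P + + D * (Q * Q)) * (e * e * (ε * + 1)) - (P * Q + Q * P) * (e * e * (ε * (δ * + a)))
          ≡⟨ lem₄ (P * P + + D * (Q * Q)) (P * Q + Q * P) (e * e) ε δ (+ a) ⟩
        e * e * (ε * (P * P + + D * (Q * Q) + - δ * + a * (P * Q + Q * P)))
          ≡⟨ cong (λ o → e * e * (ε * o)) (square-expand P Q (- δ) (sign-neg sδ)) ⟩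
        e * e * (ε * ((P + - δ * + a * Q) * (P + - δ * + a * Q) + + b * Q * (+ b * Q))) ∎) }
    where
    open ≡-Reasoning
    n : ℕ
    n = suc k
    P Q e : ℤ
    P = proj₁ (pow (+ D) (+ T , + U) n)
    Q = proj₂ (pow (+ D) (+ T , + U) n)
    e = (+ 2) ^ n
    pow-norm : ∃ λ κ → IsSign κ × P * P - + D * (Q * Q) ≡ κ * (e * e)
    pow-norm = quadraticNorm-pow (+ D) (+ T , + U) pell-norm n
    κ : ℤ
    κ = proj₁ pow-norm
    sκ : IsSign κ
    sκ = proj₁ (proj₂ pow-norm)
    norm′ : P * P - + D * (Q * Q) ≡ κ * (e * e)
    norm′ = proj₂ (proj₂ pow-norm)
    h′ : mul (+ D) (x , y) (mul (+ D) (P , Q) (P , Q)) ≡ scale (e * e) (scale ε (δ * + a , + 1))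
    h′ = trans (cong (mul (+ D) (x , y)) (sym (pow-double (+ D) (+ T , + U) n)))
      (trans h (cong (λ c → scale c (scale ε (δ * + a , + 1))) (2^2n n)))
    lem₁ : ∀ e y → e * e * (e * e * y) ≡ + 1 * (e * e) * (e * e) * y
    lem₁ = solve-∀
    lem₂ : ∀ κ f y → κ * κ * f * f * y ≡ κ * f * (κ * f) * y
    lem₂ = solve-∀
    lem₃ : ∀ x y P Q D → (P * P - D * (Q * Q)) * (P * P - D * (Q * Q)) * y
      ≡ (P * P + D * (Q * Q)) * (x * (P * Q + Q * P) + y * (P * P + D * (Q * Q)))
        - (P * Q + Q * P) * (x * (P * P + D * (Q * Q)) + D * (y * (P * Q + Q * P)))
    lem₃ = solve-∀
    lem₄ : ∀ u v f ε δ a → u * (f * (ε * + 1)) - v * (f * (ε * (δ * a))) ≡ f * (ε * (u + - δ * a * v))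
    lem₄ = solve-∀

halve : ∀ z k → ∣ z ∣ ≡ 2 ℕ.* k → ∃ λ w → z ≡ + 2 * w × ∣ w ∣ ≡ k
halve z k e with abs-value z e
... | inj₁ z≡ = + k , trans z≡ (pos-* 2 k) , refl
... | inj₂ z≡ = - + k , trans z≡ (trans (cong -_ (pos-* 2 k)) (neg-distribʳ-* (+ 2) (+ k))) , ∣-i∣≡∣i∣ (+ k)

-- Descent: a sum of two squares divisible by 4 has both terms even, so one factor 2 is removed from
-- A and B at each step.
divide-by-2^ : ∀ n A B Z → ∣ A ∣ ℕ.* ∣ A ∣ ℕ.+ ∣ B ∣ ℕ.* ∣ B ∣ ≡ 2 ℕ.^ n ℕ.* 2 ℕ.^ n ℕ.* Z →
  ∃₂ λ A′ B′ → A ≡ (+ 2) ^ n * A′ × B ≡ (+ 2) ^ n * B′ × ∣ A′ ∣ ℕ.* ∣ A′ ∣ ℕ.+ ∣ B′ ∣ ℕ.* ∣ B′ ∣ ≡ Z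
divide-by-2^ zero    A B Z e = A , B , sym (*-identityˡ A) , sym (*-identityˡ B) , trans e (ℕ.+-identityʳ Z)
divide-by-2^ (suc n) A B Z e with even-of-sum-divisible-by-4 ∣ A ∣ ∣ B ∣ (2 ℕ.^ n ℕ.* 2 ℕ.^ n ℕ.* Z) (trans e (lem (2 ℕ.^ n) Z))
  where
  lem : ∀ e z → 2 ℕ.* e ℕ.* (2 ℕ.* e) ℕ.* z ≡ 4 ℕ.* (e ℕ.* e ℕ.* z)
  lem = ℕ-solve-∀
... | (k , ek) , (l , el) with halve A k ek | halve B l el
... | A₁ , A≡ , ∣A₁∣ | B₁ , B≡ , ∣B₁∣ with divide-by-2^ n A₁ B₁ Z (ℕ.*-cancelˡ-≡ _ _ 4 (trans (lem₁ ∣ A₁ ∣ ∣ B₁ ∣)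
  (trans (cong₂ (λ x y → x ℕ.* x ℕ.+ y ℕ.* y) (trans (cong (2 ℕ.*_) ∣A₁∣) (sym ek)) (trans (cong (2 ℕ.*_) ∣B₁∣) (sym el))) (trans e (lem₂ (2 ℕ.^ n) Z)))))
  where
  lem₁ : ∀ x y → 4 ℕ.* (x ℕ.* x ℕ.+ y ℕ.* y) ≡ 2 ℕ.* x ℕ.* (2 ℕ.* x) ℕ.+ 2 ℕ.* y ℕ.* (2 ℕ.* y)
  lem₁ = ℕ-solve-∀
  lem₂ : ∀ e z → 2 ℕ.* e ℕ.* (2 ℕ.* e) ℕ.* z ≡ 4 ℕ.* (e ℕ.* e ℕ.* z)
  lem₂ = ℕ-solve-∀
... | A′ , B′ , A₁≡ , B₁≡ , e′ = A′ , B′ , trans A≡ (trans (cong (+ 2 *_) A₁≡) (sym (*-assoc (+ 2) ((+ 2) ^ n) A′))) ,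
  trans B≡ (trans (cong (+ 2 *_) B₁≡) (sym (*-assoc (+ 2) ((+ 2) ^ n) B′))) , e′

module _ {a b y : ℕ} where

  thue-from-squares : ∀ {x w p q η} → IsSign η → p ℕ.* p ≡ x ℕ.+ q ℕ.* q → p ℕ.* q ≡ w → p ℕ.* p ℕ.+ q ℕ.* q ≡ y →
    ∣ + a * (+ 2 * (η * (+ x * + (2 ℕ.* w)))) - + b * (+ x * + x - + (2 ℕ.* w) * + (2 ℕ.* w)) ∣ ≡ b → Thue a b y
  thue-from-squares {x} {w} {p} {q} {η} sη pp pq ppqq h = record
    { p = + p ; q = η * + q
    ; norm = trans (trans (lem₁ (+ p) η (+ q)) (cong (λ o → + p * + p + o * (+ q * + q)) (sign² sη)))
        (trans (cong (λ z → + p * + p + z) (*-identityˡ (+ q * + q))) (trans (sym (abs-squares (+ p) (+ q))) (cong +_ ppqq)))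
    ; imaginary = trans (cong ∣_∣ (trans (cong₂ (λ X Y → + a * Y - + b * X)
          (trans (Re⁴-square (+ p) (η * + q)) (cong₂ (λ s t → s * s - t * t) re im))
          (trans (Im⁴-square (+ p) (η * + q)) (cong₂ (λ s t → + 2 * (s * t)) re im)))
        (trans (lem₂ (+ a) (+ b) (+ x) η (+ (2 ℕ.* w))) (cong (λ o → + a * (+ 2 * (η * (+ x * + (2 ℕ.* w)))) - + b * (+ x * + x - o * (+ (2 ℕ.* w) * + (2 ℕ.* w)))) (sign² sη)))))
        (trans (cong (λ z → ∣ + a * (+ 2 * (η * (+ x * + (2 ℕ.* w)))) - + b * (+ x * + x - z) ∣) (*-identityˡ (+ (2 ℕ.* w) * + (2 ℕ.* w)))) h) }
    where
    re : Re² (+ p) (η * + q) ≡ + x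
    re = trans (lem (+ p) η (+ q)) (trans (cong₂ (λ z o → z - o * (+ q * + q)) (trans (sym (pos-* p p)) (trans (cong +_ pp) (cong (λ z → + x + z) (pos-* q q)))) (sign² sη))
      (lem′ (+ x) (+ q * + q)))
      where
      lem : ∀ p η q → p * p - η * q * (η * q) ≡ p * p - η * η * (q * q)
      lem = solve-∀
      lem′ : ∀ x z → x + z - + 1 * z ≡ x
      lem′ = solve-∀
    im : Im² (+ p) (η * + q) ≡ η * + (2 ℕ.* w)
    im = trans (lem (+ p) η (+ q)) (cong (η *_) (trans (cong (+ 2 *_) (trans (sym (pos-* p q)) (cong +_ pq))) (sym (pos-* 2 w))))
      where
      lem : ∀ p η q → + 2 * (p * (η * q)) ≡ η * (+ 2 * (p * q))
      lem = solve-∀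
    lem₁ : ∀ p η q → p * p + η * q * (η * q) ≡ p * p + η * η * (q * q)
    lem₁ = solve-∀
    lem₂ : ∀ a b x η t → a * (+ 2 * (x * (η * t))) - b * (x * x - η * t * (η * t)) ≡ a * (+ 2 * (η * (x * t))) - b * (x * x - η * η * (t * t))
    lem₂ = solve-∀

  -- The hypothesis is Im ((A + iδB)² ω̄) = ± b, with A + iδB of norm Y². By the parametrisation of
  -- Pythagorean triples, A + iδB is up to a unit and conjugation the square of p + iq; `η`, the
  -- sign of ABδ, fixes the sign of the imaginary part.
  thue-from-gaussian : ∀ A B δ → IsSign δ → Coprime ∣ A ∣ ∣ B ∣ → ∣ A ∣ ℕ.* ∣ A ∣ ℕ.+ ∣ B ∣ ℕ.* ∣ B ∣ ≡ y ℕ.* y →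
    ∣ + a * (+ 2 * (A * B * δ)) - + b * (A * A - B * B) ∣ ≡ b → Thue a b y
  thue-from-gaussian A B δ sδ c e h with sign-of (A * B * δ)
  ... | η , sη , AB≡ with one-even ∣ A ∣ ∣ B ∣ y e
  ... | inj₂ (w , ∣B∣≡2w) with pythagorean ∣ A ∣ w y (trans (cong (λ z → ∣ A ∣ ℕ.* ∣ A ∣ ℕ.+ z ℕ.* z) (sym ∣B∣≡2w)) e) (subst (Coprime ∣ A ∣) ∣B∣≡2w c)
  ... | p , q , pp , pq , ppqq = thue-from-squares {∣ A ∣} {w} {p} {q} {η} sη pp pq ppqq (trans (cong ∣_∣ (cong₂ (λ u v → + a * (+ 2 * u) - + b * v)
      (trans (cong (η *_) abs-product) (sym AB≡)) (cong₂ _-_ (trans (sym (pos-* ∣ A ∣ ∣ A ∣)) (abs-square A)) B²))) h)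
    where
    B² : + (2 ℕ.* w) * + (2 ℕ.* w) ≡ B * B
    B² = trans (cong (λ z → + z * + z) (sym ∣B∣≡2w)) (trans (sym (pos-* ∣ B ∣ ∣ B ∣)) (abs-square B))
    abs-product : + ∣ A ∣ * + (2 ℕ.* w) ≡ + ∣ A * B * δ ∣
    abs-product = trans (cong (λ z → + ∣ A ∣ * + z) (sym ∣B∣≡2w)) (trans (sym (pos-* ∣ A ∣ ∣ B ∣)) (cong +_ (sym (trans (abs-*³ A B δ)
      (trans (cong (∣ A ∣ ℕ.* ∣ B ∣ ℕ.*_) (sign-abs sδ)) (ℕ.*-identityʳ (∣ A ∣ ℕ.* ∣ B ∣)))))))
  -- When A is the even leg, |B| - iη|A| takes the place of |A| + iη|B|. This negates the square, so
  -- the imaginary part only changes sign.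
  thue-from-gaussian A B δ sδ c e h | η , sη , AB≡ | inj₁ (w , ∣A∣≡2w)
    with pythagorean ∣ B ∣ w y (trans (cong (λ z → ∣ B ∣ ℕ.* ∣ B ∣ ℕ.+ z ℕ.* z) (sym ∣A∣≡2w)) (trans (ℕ.+-comm (∣ B ∣ ℕ.* ∣ B ∣) (∣ A ∣ ℕ.* ∣ A ∣)) e))
      (subst (Coprime ∣ B ∣) ∣A∣≡2w (Coprimality.sym c))
  ... | p , q , pp , pq , ppqq = thue-from-squares {∣ B ∣} {w} {p} {q} { - η} (sign-neg sη) pp pq ppqq (trans (cong ∣_∣ (trans (cong₂ (λ u v → + a * (+ 2 * u) - + b * v)
      (trans (sym (neg-distribˡ-* η (+ ∣ B ∣ * + (2 ℕ.* w)))) (cong -_ (trans (cong (η *_) abs-product) (sym AB≡)))) (cong₂ _-_ (trans (sym (pos-* ∣ B ∣ ∣ B ∣)) (abs-square B)) A²))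
      (lem (+ a) (+ b) (A * B * δ) (A * A) (B * B)))) (trans (∣-i∣≡∣i∣ (+ a * (+ 2 * (A * B * δ)) - + b * (A * A - B * B))) h))
    where
    A² : + (2 ℕ.* w) * + (2 ℕ.* w) ≡ A * A
    A² = trans (cong (λ z → + z * + z) (sym ∣A∣≡2w)) (trans (sym (pos-* ∣ A ∣ ∣ A ∣)) (abs-square A))
    abs-product : + ∣ B ∣ * + (2 ℕ.* w) ≡ + ∣ A * B * δ ∣
    abs-product = trans (cong (λ z → + ∣ B ∣ * + z) (sym ∣A∣≡2w)) (trans (sym (pos-* ∣ B ∣ ∣ A ∣)) (cong +_ (sym (trans (abs-*³ A B δ)
      (trans (cong (∣ A ∣ ℕ.* ∣ B ∣ ℕ.*_) (sign-abs sδ)) (trans (ℕ.*-identityʳ (∣ A ∣ ℕ.* ∣ B ∣)) (ℕ.*-comm ∣ A ∣ ∣ B ∣)))))))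
    lem : ∀ a b z s t → a * (+ 2 * - z) - b * (t - s) ≡ - (a * (+ 2 * z) - b * (s - t))
    lem = solve-∀

quartic-ℕ : ∀ D b X Y → (+ X) ^ 2 - + D * (+ Y) ^ 4 ≡ - ((+ b) ^ 2) → X ℕ.* X ℕ.+ b ℕ.* b ≡ D ℕ.* (Y ℕ.* Y ℕ.* (Y ℕ.* Y))
quartic-ℕ D b X Y h = +-injective (begin
  + (X ℕ.* X ℕ.+ b ℕ.* b)
    ≡⟨ cong₂ _+_ (pos-* X X) (pos-* b b) ⟩
  + X * + X + + b * + b
    ≡⟨ lem₁ (+ X) (+ b) (+ D) (+ Y) ⟩
  (+ X) ^ 2 - + D * (+ Y) ^ 4 + (+ b) ^ 2 + + D * (+ Y * + Y * (+ Y * + Y))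
    ≡⟨ cong (λ z → z + (+ b) ^ 2 + + D * (+ Y * + Y * (+ Y * + Y))) h ⟩
  - ((+ b) ^ 2) + (+ b) ^ 2 + + D * (+ Y * + Y * (+ Y * + Y))
    ≡⟨ lem₂ ((+ b) ^ 2) (+ D * (+ Y * + Y * (+ Y * + Y))) ⟩
  + D * (+ Y * + Y * (+ Y * + Y))
    ≡⟨ cong (+ D *_) (trans (cong₂ _*_ (sym (pos-* Y Y)) (sym (pos-* Y Y))) (sym (pos-* (Y ℕ.* Y) (Y ℕ.* Y)))) ⟩
  + D * + (Y ℕ.* Y ℕ.* (Y ℕ.* Y))
    ≡⟨ pos-* D (Y ℕ.* Y ℕ.* (Y ℕ.* Y)) ⟨
  + (D ℕ.* (Y ℕ.* Y ℕ.* (Y ℕ.* Y))) ∎)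
  where
  open ≡-Reasoning
  lem₁ : ∀ X b D Y → X * X + b * b ≡ X * (X * + 1) - D * (Y * (Y * (Y * (Y * + 1)))) + b * (b * + 1) + D * (Y * Y * (Y * Y))
  lem₁ = solve-∀
  lem₂ : ∀ x y → - x + x + y ≡ y
  lem₂ = solve-∀

∣-combination : ∀ {d} A B δ a b → d ℕ.∣ ∣ A ∣ → d ℕ.∣ ∣ B ∣ → d ℕ.∣ ∣ a * (+ 2 * (A * B * δ)) - b * (A * A - B * B) ∣
∣-combination {d} A B δ a b d∣A d∣B = ℤ.∣⇒∣ᵤ {+ d} {a * (+ 2 * (A * B * δ)) - b * (A * A - B * B)}
  (ℤ.∣m∣n⇒∣m-n (ℤ.∣n⇒∣m*n a (ℤ.∣n⇒∣m*n (+ 2) (ℤ.∣m⇒∣m*n δ (ℤ.∣m⇒∣m*n B A′))))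
    (ℤ.∣n⇒∣m*n b (ℤ.∣m∣n⇒∣m-n (ℤ.∣m⇒∣m*n A A′) (ℤ.∣m⇒∣m*n B B′))))
  where
  A′ : + d ℤ.∣ A
  A′ = ℤ.∣ᵤ⇒∣ d∣A
  B′ : + d ℤ.∣ B
  B′ = ℤ.∣ᵤ⇒∣ d∣B

module _ (a b T U : ℕ) (pell : (+ T) ^ 2 - + (a ℕ.^ 2 ℕ.+ b ℕ.^ 2) * (+ U) ^ 2 ≡ - + 4)
  (classes : ∀ (x y : ℤ) → Coprime ∣ x ∣ ∣ y ∣ → x ^ 2 - + (a ℕ.^ 2 ℕ.+ b ℕ.^ 2) * y ^ 2 ≡ - ((+ b) ^ 2) →
    ∃[ ε ] ∃[ δ ] ∃[ k ] (IsSign ε × IsSign δ × HasForm (a ℕ.^ 2 ℕ.+ b ℕ.^ 2) a T U x y ε δ k)) where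
  private
    D : ℕ
    D = a ℕ.^ 2 ℕ.+ b ℕ.^ 2

  -- The parametrisation is applied to y = Y². It gives A² + B² = 4ⁿY², and once 2ⁿ is divided out,
  -- A and B form a coprime Pythagorean pair for Y.
  quartic⇒thue : ∀ {X Y} → QuarticSol D b (X , Y) → Thue a b Y
  quartic⇒thue {X} {Y} (0<X , 0<Y , coprime , quartic) with classes (+ X) (+ (Y ℕ.* Y)) (coprime-square coprime)
    (trans (cong (λ z → (+ X) ^ 2 - + D * z ^ 2) (pos-* Y Y)) (trans (lem (+ X) (+ D) (+ Y)) quartic))
    where
    lem : ∀ X D Y → X * (X * + 1) - D * (Y * Y * (Y * Y * + 1)) ≡ X * (X * + 1) - D * (Y * (Y * (Y * (Y * + 1))))
    lem = solve-∀
  ... | ε₀ , δ₀ , k , sε₀ , sδ₀ , form = conclude (divide-by-2^ n A B (Y ℕ.* Y) sum-of-squares)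
    where
    open SumOfSquares (sumOfSquares a b T U pell (+ X) (+ (Y ℕ.* Y)) ε₀ δ₀ k sε₀ sδ₀ form)
    A B e : ℤ
    A = P + δ * + a * Q
    B = + b * Q
    e = (+ 2) ^ n
    sum-of-squares : ∣ A ∣ ℕ.* ∣ A ∣ ℕ.+ ∣ B ∣ ℕ.* ∣ B ∣ ≡ 2 ℕ.^ n ℕ.* 2 ℕ.^ n ℕ.* (Y ℕ.* Y)
    sum-of-squares = begin
      ∣ A ∣ ℕ.* ∣ A ∣ ℕ.+ ∣ B ∣ ℕ.* ∣ B ∣
        ≡⟨ cong ∣_∣ (abs-squares A B) ⟩
      ∣ A * A + B * B ∣
        ≡⟨ ℕ.*-identityˡ ∣ A * A + B * B ∣ ⟨
      1 ℕ.* ∣ A * A + B * B ∣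
        ≡⟨ cong (ℕ._* ∣ A * A + B * B ∣) (sign-abs sign-ε) ⟨
      ∣ ε ∣ ℕ.* ∣ A * A + B * B ∣
        ≡⟨ abs-* ε (A * A + B * B) ⟨
      ∣ ε * (A * A + B * B) ∣
        ≡⟨ cong ∣_∣ value ⟨
      ∣ e * e * + (Y ℕ.* Y) ∣
        ≡⟨ abs-*³ e e (+ (Y ℕ.* Y)) ⟩
      ∣ e ∣ ℕ.* ∣ e ∣ ℕ.* (Y ℕ.* Y)
        ≡⟨ cong (λ z → z ℕ.* z ℕ.* (Y ℕ.* Y)) (abs-^ (+ 2) n) ⟩
      2 ℕ.^ n ℕ.* 2 ℕ.^ n ℕ.* (Y ℕ.* Y) ∎
      where open ≡-Reasoning
    -- The quadratic form in A and B collapses to - b(P² - DQ²), which is known up to sign as the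
    -- norm of a power of T + U√D.
    thue-form : + a * (+ 2 * (A * B * δ)) - + b * (A * A - B * B) ≡ e * e * (- κ * + b)
    thue-form = begin
      + a * (+ 2 * (A * B * δ)) - + b * (A * A - B * B)
        ≡⟨ lem₁ (+ a) (+ b) P Q δ ⟩
      + b * ((δ * δ * (+ a * + a) + + b * + b) * (Q * Q) - P * P)
        ≡⟨ cong (λ z → + b * (z * (Q * Q) - P * P)) (trans (cong (λ o → o * (+ a * + a) + + b * + b) (sign² sign-δ)) (trans (cong (_+ + b * + b) (*-identityˡ (+ a * + a))) (sym (D≡ a b T U pell)))) ⟩
      + b * (+ D * (Q * Q) - P * P)
        ≡⟨ lem₂ (+ b) (P * P) (+ D * (Q * Q)) ⟩
      - (P * P - + D * (Q * Q)) * + b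
        ≡⟨ cong (λ z → - z * + b) norm ⟩
      - (κ * (e * e)) * + b
        ≡⟨ lem₃ κ e (+ b) ⟩
      e * e * (- κ * + b) ∎
      where
      open ≡-Reasoning
      lem₁ : ∀ a b P Q δ → a * (+ 2 * ((P + δ * a * Q) * (b * Q) * δ)) - b * ((P + δ * a * Q) * (P + δ * a * Q) - b * Q * (b * Q))
        ≡ b * ((δ * δ * (a * a) + b * b) * (Q * Q) - P * P)
      lem₁ = solve-∀
      lem₂ : ∀ b x y → b * (y - x) ≡ - (x - y) * b
      lem₂ = solve-∀
      lem₃ : ∀ κ e b → - (κ * (e * e)) * b ≡ e * e * (- κ * b)
      lem₃ = solve-∀
    conclude : (∃₂ λ A′ B′ → A ≡ e * A′ × B ≡ e * B′ × ∣ A′ ∣ ℕ.* ∣ A′ ∣ ℕ.+ ∣ B′ ∣ ℕ.* ∣ B′ ∣ ≡ Y ℕ.* Y) → Thue a b Y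
    conclude (A′ , B′ , A≡ , B≡ , squares) = thue-from-gaussian A′ B′ δ sign-δ coprime′ squares value-b
      where
      thue-form′ : + a * (+ 2 * (A′ * B′ * δ)) - + b * (A′ * A′ - B′ * B′) ≡ - κ * + b
      thue-form′ = *-cancelˡ-≡ (e * e) _ _ {{i*j≢0 e e {{2^n≢0 a b T U pell n}} {{2^n≢0 a b T U pell n}}}} (trans (lem (+ a) (+ b) e A′ B′ δ)
        (trans (cong₂ (λ A B → + a * (+ 2 * (A * B * δ)) - + b * (A * A - B * B)) (sym A≡) (sym B≡)) thue-form))
        where
        lem : ∀ a b e A B δ → e * e * (a * (+ 2 * (A * B * δ)) - b * (A * A - B * B))
          ≡ a * (+ 2 * (e * A * (e * B) * δ)) - b * (e * A * (e * A) - e * B * (e * B))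
        lem = solve-∀
      value-b : ∣ + a * (+ 2 * (A′ * B′ * δ)) - + b * (A′ * A′ - B′ * B′) ∣ ≡ b
      value-b = trans (cong ∣_∣ thue-form′) (trans (abs-* (- κ) (+ b)) (trans (cong (ℕ._* b) (trans (∣-i∣≡∣i∣ κ) (sign-abs sign-κ))) (ℕ.*-identityˡ b)))
      -- A common divisor of A′ and B′ divides ± b by the form just computed, and Y² as their sum of
      -- squares, hence also X² = DY⁴ - b².
      coprime′ : Coprime ∣ A′ ∣ ∣ B′ ∣
      coprime′ {d} (d∣A , d∣B) = coprime-square (coprime-squareˡ coprime) (d∣XX , d∣YY)
        where
        d∣b : d ℕ.∣ b
        d∣b = subst (d ℕ.∣_) value-b (∣-combination A′ B′ δ (+ a) (+ b) d∣A d∣B)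
        d∣YY : d ℕ.∣ Y ℕ.* Y
        d∣YY = subst (d ℕ.∣_) squares (ℕ.∣m∣n⇒∣m+n (ℕ.∣m⇒∣m*n ∣ A′ ∣ d∣A) (ℕ.∣m⇒∣m*n ∣ B′ ∣ d∣B))
        d∣XX : d ℕ.∣ X ℕ.* X
        d∣XX = ℕ.∣m+n∣m⇒∣n (subst (d ℕ.∣_) (trans (sym (quartic-ℕ D b X Y quartic)) (ℕ.+-comm (X ℕ.* X) (b ℕ.* b)))
          (ℕ.∣n⇒∣m*n D (ℕ.∣m⇒∣m*n (Y ℕ.* Y) d∣YY))) (ℕ.∣m⇒∣m*n b d∣b)

-- Counting the solutions

quartic-injective : ∀ {D b X X′ Y} → QuarticSol D b (X , Y) → QuarticSol D b (X′ , Y) → X ≡ X′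
quartic-injective {D} {b} {X} {X′} {Y} (_ , _ , _ , q) (_ , _ , _ , q′) =
  square-injective (ℕ.+-cancelʳ-≡ (b ℕ.* b) _ _ (trans (quartic-ℕ D b X Y q) (sym (quartic-ℕ D b X′ Y q′))))

no-three-distinct : ∀ {S : ℕ → Set} → (∀ {x y z} → S x → S y → S z → 1 ℕ.< x → x ℕ.< y → y ℕ.< z → ⊥) →
  ∀ {x y z} → S x → S y → S z → 1 ℕ.< x → 1 ℕ.< y → 1 ℕ.< z → x ≢ y → x ≢ z → y ≢ z → ⊥
no-three-distinct h {x} {y} {z} sx sy sz 1<x 1<y 1<z x≢y x≢z y≢z with ℕ.<-cmp x y | ℕ.<-cmp y z | ℕ.<-cmp x z
... | tri≈ _ e _ | _ | _ = x≢y e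
... | _ | tri≈ _ e _ | _ = y≢z e
... | _ | _ | tri≈ _ e _ = x≢z e
... | tri< x<y _ _ | tri< y<z _ _ | _ = h sx sy sz 1<x x<y y<z
... | tri< x<y _ _ | tri> _ _ z<y | tri< x<z _ _ = h sx sz sy 1<x x<z z<y
... | tri< x<y _ _ | tri> _ _ z<y | tri> _ _ z<x = h sz sx sy 1<z z<x x<y
... | tri> _ _ y<x | tri< y<z _ _ | tri< x<z _ _ = h sy sx sz 1<y y<x x<z
... | tri> _ _ y<x | tri< y<z _ _ | tri> _ _ z<x = h sy sz sx 1<y y<z z<x
... | tri> _ _ y<x | tri> _ _ z<y | _ = h sz sy sx 1<z z<y y<x

-- Among distinct positive integers at most one equals 1; the case split finds it, and three larger
-- ones remain.
no-four-distinct : ∀ {S : ℕ → Set} → (∀ {x y z} → S x → S y → S z → 1 ℕ.< x → x ℕ.< y → y ℕ.< z → ⊥) →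
  ∀ {w x y z} → S w → S x → S y → S z → 0 ℕ.< w → 0 ℕ.< x → 0 ℕ.< y → 0 ℕ.< z →
  w ≢ x → w ≢ y → w ≢ z → x ≢ y → x ≢ z → y ≢ z → ⊥
no-four-distinct h {w} {x} {y} {z} sw sx sy sz 0<w 0<x 0<y 0<z w≢x w≢y w≢z x≢y x≢z y≢z
  with w ℕ.≟ 1 | x ℕ.≟ 1 | y ℕ.≟ 1
... | yes refl | _ | _ = no-three-distinct h sx sy sz (ℕ.≤∧≢⇒< 0<x w≢x) (ℕ.≤∧≢⇒< 0<y w≢y) (ℕ.≤∧≢⇒< 0<z w≢z) x≢y x≢z y≢z
... | no w≢1 | yes refl | _ = no-three-distinct h sw sy sz (ℕ.≤∧≢⇒< 0<w (≢-sym w≢1)) (ℕ.≤∧≢⇒< 0<y x≢y) (ℕ.≤∧≢⇒< 0<z x≢z) w≢y w≢z y≢z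
... | no w≢1 | no x≢1 | yes refl = no-three-distinct h sw sx sz (ℕ.≤∧≢⇒< 0<w (≢-sym w≢1)) (ℕ.≤∧≢⇒< 0<x (≢-sym x≢1)) (ℕ.≤∧≢⇒< 0<z y≢z) w≢x w≢z x≢z
... | no w≢1 | no x≢1 | no y≢1 = no-three-distinct h sw sx sy (ℕ.≤∧≢⇒< 0<w (≢-sym w≢1)) (ℕ.≤∧≢⇒< 0<x (≢-sym x≢1)) (ℕ.≤∧≢⇒< 0<y (≢-sym y≢1)) w≢x w≢y x≢y

theorem1p2 : (a b : ℕ) → 0 ℕ.< a → 0 ℕ.< b → Coprime a b →
    ¬ IsSquare (a ℕ.^ 2 ℕ.+ b ℕ.^ 2) →
    (∃[ x ] ∃[ y ] (x ^ 2 - (+ (a ℕ.^ 2 ℕ.+ b ℕ.^ 2)) * y ^ 2 ≡ - (+ 1))) →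
    (T₁ U₁ : ℕ) → IsMinimalSol4 (a ℕ.^ 2 ℕ.+ b ℕ.^ 2) T₁ U₁ →
    (∀ (x y : ℤ) → Coprime ∣ x ∣ ∣ y ∣ →
    x ^ 2 - (+ (a ℕ.^ 2 ℕ.+ b ℕ.^ 2)) * y ^ 2 ≡ - ((+ b) ^ 2) →
    ∃[ ε ] ∃[ δ ] ∃[ k ] (IsSign ε × IsSign δ ×
    HasForm (a ℕ.^ 2 ℕ.+ b ℕ.^ 2) a T₁ U₁ x y ε δ k)) →
    (sols : List (ℕ × ℕ)) → Unique sols →
    All (QuarticSol (a ℕ.^ 2 ℕ.+ b ℕ.^ 2) b) sols →
    length sols ℕ.≤ 3
theorem1p2 a b 0<a 0<b coprime _ _ T U (_ , _ , pell , _) classes = at-most-three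
  where
  D : ℕ
  D = a ℕ.^ 2 ℕ.+ b ℕ.^ 2
  thue : ∀ {s} → QuarticSol D b s → Thue a b (proj₂ s)
  thue = quartic⇒thue a b T U pell classes
  Y-positive : ∀ {s} → QuarticSol D b s → 0 ℕ.< proj₂ s
  Y-positive (_ , 0<Y , _) = 0<Y
  distinct : ∀ {s s′} → QuarticSol D b s → QuarticSol D b s′ → s ≢ s′ → proj₂ s ≢ proj₂ s′
  -- Y determines X, so different solutions have different second components.
  distinct {X , Y} {X′ , .Y} q q′ s≢s′ refl = s≢s′ (cong (_, Y) (quartic-injective {D} {b} {X} {X′} {Y} q q′))
  at-most-three : (sols : List (ℕ × ℕ)) → Unique sols → All (QuarticSol D b) sols → length sols ℕ.≤ 3
  at-most-three []                     _ _ = ℕ.z≤n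
  at-most-three (_ ∷ [])               _ _ = ℕ.s≤s ℕ.z≤n
  at-most-three (_ ∷ _ ∷ [])           _ _ = ℕ.s≤s (ℕ.s≤s ℕ.z≤n)
  at-most-three (_ ∷ _ ∷ _ ∷ [])       _ _ = ℕ.≤-refl
  at-most-three (_ ∷ _ ∷ _ ∷ _ ∷ _) ((s₁₂ ∷ s₁₃ ∷ s₁₄ ∷ _) ∷ (s₂₃ ∷ s₂₄ ∷ _) ∷ (s₃₄ ∷ _) ∷ _) (q₁ ∷ q₂ ∷ q₃ ∷ q₄ ∷ _) =
    ⊥-elim (no-four-distinct (no-three-solutions 0<a 0<b coprime) (thue q₁) (thue q₂) (thue q₃) (thue q₄)
      (Y-positive q₁) (Y-positive q₂) (Y-positive q₃) (Y-positive q₄)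
      (distinct q₁ q₂ s₁₂) (distinct q₁ q₃ s₁₃) (distinct q₁ q₄ s₁₄) (distinct q₂ q₃ s₂₃) (distinct q₂ q₄ s₂₄) (distinct q₃ q₄ s₃₄))
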